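{- Fix $k\in\mathbb{Z}_{\geq 1}$. The feasible region $P^{\mathrm{Av}(312)}_k$ equals the cycle polytope $P(\mathcal{O}v(k,\mathrm{Av}(312)))$ (viewed inside $\mathbb R^{\mathcal S_k}$). Its dimension is $C_k-C_{k-1}$, where $C_k=\frac{1}{k+1}\binom{2k}{k}$ is the $k$-th Catalan number, and its vertices are exactly the vectors $\vec e_{\mathcal C}$ for $\mathcal C$ ranging over the simple cycles of $\mathcal{O}v(k,\mathrm{Av}(312))$.
   Context: For $n\ge1$, $\mathcal S_n$ is the set of permutations of $[n]$ in one-line notation; by convention $\mathcal S_0$ and $\mathrm{Av}_0(B)$ consist of the empty permutation. For distinct reals $x_1,\dots,x_m$, $\mathrm{std}(x_1,\dots,x_m)$ is the unique $\pi\in\mathcal S_m$ with $\pi(i)<\pi(j)\iff x_i<x_j$; for $I=\{i_1<\dots<i_m\}$, $\mathrm{pat}_I(\sigma)=\mathrm{std}(\sigma(i_1),\dots,\sigma(i_m))$. $\sigma$ avoids $\pi$ if no $I$ has $\mathrm{pat}_I(\sigma)=\pi$; $\mathrm{Av}_n(B)$ is the set of size-$n$ permutations avoiding all elements of $B$, $\mathrm{Av}(B)=\bigcup_{n\ge1}\mathrm{Av}_n(B)$. For $\pi\in\mathcal S_k,\sigma\in\mathcal S_n$, $\mathrm{c\text{ - }occ}(\pi,\sigma)$ is the number of intervals $I=\{i,\dots,i+k-1\}\subseteq[n]$ with $\mathrm{pat}_I(\sigma)=\pi$, and $\widetilde{\mathrm{c\text{ - }occ}}(\pi,\sigma)=\mathrm{c\text{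 - }occ}(\pi,\sigma)/n$. Feasible region: $P^{\mathrm{Av}(B)}_k$ is the set of $\vec v\in[0,1]^{\mathcal S_k}$ for which there is a sequence $(\sigma^m)$ in $\mathrm{Av}(B)$ with $|\sigma^m|\to\infty$ and $\widetilde{\mathrm{c\text{ - }occ}}(\pi,\sigma^m)\to\vec v_\pi$ for all $\pi\in\mathcal S_k$. Overlap graph: $\mathcal{O}v(k,\mathrm{Av}(B))$ is the directed multigraph with vertex set $\mathrm{Av}_{k-1}(B)$ and, for each $\pi\in\mathrm{Av}_k(B)$, one edge labelled $\pi$ from $\mathrm{pat}_{\{1,\dots,k-1\}}(\pi)$ to $\mathrm{pat}_{\{2,\dots,k\}}(\pi)$. A simple cycle is a closed walk with distinct edges and distinct vertices. For a nonempty cycle $\mathcal C$, $\vec e_{\mathcal C}\in\mathbb R^{E}$ has $e$-coordinate (number of occurrences of $e$ in $\mathcal C$)$/|\mathcal C|$; the cycle polytope is $P(G)=\mathrm{conv}\{\vec e_{\mathcal C}:\mathcal C\text{ simple cycle}\}$. Since edges of $\mathcal{O}v(k,\mathrm{Av}(B))$ are in bijection with $\mathrm{Av}_k(B)$, $\mathbb R^{E}=\mathbb R^{\mathrm{Av}_k(B)}$ is identified with the subspace of $\mathbb R^{\mathcal S_k}$ of vectors vanishing outside $\mathrm{Av}_k(B)$. Dimension means dimension of the affine hull. -}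

module Defs where

open import Level using (0ℓ)
open import Data.Nat.Base as ℕ using (ℕ; zero; suc; z≤n; s≤s)
import Data.Nat.Properties as ℕₚ
open import Data.Nat.DivMod using (_/_)
open import Data.Nat.Combinatorics using (_C_)
open import Data.Integer.Base using (+_; +<+)
open import Data.Rational as ℚ using (ℚ; 0ℚ; 1ℚ; ½; ∣_∣)
import Data.Rational.Properties as ℚₚ
open import Algebra.Bundles using (CommutativeMonoid)
import Algebra.Properties.CommutativeSemigroup as CommutativeSemigroupProperties
open import Data.Fin.Base using (Fin; toℕ; fromℕ<; _<_) renaming (zero to fzero; suc to fsuc)
import Data.Fin.Properties as Fₚ
open import Data.List.Base using (List; []; _∷_; length; filter; map; allFin)
open import Data.List.NonEmpty using (List⁺; toList) renaming (length to length⁺)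
open import Data.List.Properties using (length-tabulate; filter-notAll; filter-≐)
open import Data.List.Membership.Propositional using (_∈_)
open import Data.List.Membership.Propositional.Properties using (∈-allFin)
open import Data.List.Relation.Unary.Any as Any using (here; there)
open import Data.List.Relation.Unary.Unique.Propositional using (Unique)
open import Data.Vec.Base using (Vec; lookup; tabulate; []; _∷_)
open import Data.Vec.Properties using (lookup∘tabulate; tabulate-cong)
import Data.Vec.Properties as Vecₚ
open import Data.Vec.Functional using (foldr)
open import Data.Product using (∃; ∃-syntax; Σ-syntax; _×_; _,_; proj₁; proj₂)
open import Function using (_∘_; _⇔_; mk⇔; Injective)
open import Relation.Nullary using (¬_; yes; no; contradiction)
open import Relation.Nullary.Decidable using (map′; from-yes; _→-dec_)
open import Relation.Unary using (Pred; Decidable; ｛_｝)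
open import Relation.Binary.Definitions using (DecidableEquality; tri<; tri≈; tri>)
open import Relation.Binary.PropositionalEquality
  using (_≡_; _≢_; refl; sym; trans; cong; cong₂; subst)

Eventually : Pred ℕ 0ℓ → Set
Eventually P = ∃[ N ] (∀ {n} → N ℕ.≤ n → P n)

Cauchy : (ℕ → ℚ) → Set
Cauchy x = ∀ ε → 0ℚ ℚ.< ε →
           ∃[ N ] (∀ {m n} → N ℕ.≤ m → N ℕ.≤ n → ∣ x m ℚ.- x n ∣ ℚ.≤ ε)

-- The existential in Cauchy carries a modulus; reals are compared up to _≈ᴿ_.
record ℝ : Set where
  constructor mkℝ
  field
    seq    : ℕ → ℚ
    cauchy : Cauchy seq

open ℝ public

infix  4 _≈ᴿ_ _≤ᴿ_ _<ᴿ_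
infixl 6 _+ᴿ_ _-ᴿ_
infixl 7 _*ᴿ_

record _≈ᴿ_ (x y : ℝ) : Set where
  constructor mk≈
  field close : ∀ ε → 0ℚ ℚ.< ε → Eventually λ n → ∣ seq x n ℚ.- seq y n ∣ ℚ.≤ ε

record _≤ᴿ_ (x y : ℝ) : Set where
  constructor mk≤
  field below : ∀ ε → 0ℚ ℚ.< ε → Eventually λ n → seq x n ℚ.≤ seq y n ℚ.+ ε

record _<ᴿ_ (x y : ℝ) : Set where
  constructor mk<
  field
    gap      : ℚ
    positive : 0ℚ ℚ.< gap
    apart    : Eventually λ n → seq x n ℚ.+ gap ℚ.≤ seq y n

module _ where
  open ℚₚ.≤-Reasoning

  module ℚ+ = CommutativeSemigroupProperties
    (CommutativeMonoid.commutativeSemigroup ℚₚ.+-0-commutativeMonoid)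

  sub-+ : ∀ a b c d → (a ℚ.+ b) ℚ.- (c ℚ.+ d) ≡ (a ℚ.- c) ℚ.+ (b ℚ.- d)
  sub-+ a b c d = trans (cong ((a ℚ.+ b) ℚ.+_) (ℚₚ.neg-distrib-+ c d))
                        (ℚ+.interchange a b (ℚ.- c) (ℚ.- d))

  sub-add : ∀ a b → (a ℚ.- b) ℚ.+ b ≡ a
  sub-add a b = trans (ℚₚ.+-assoc a (ℚ.- b) b)
    (trans (cong (a ℚ.+_) (ℚₚ.+-inverseˡ b)) (ℚₚ.+-identityʳ a))

  sub-sub : ∀ a b c → a ℚ.- c ≡ (a ℚ.- b) ℚ.+ (b ℚ.- c)
  sub-sub a b c = trans (cong (ℚ._- c) (sym (sub-add a b)))
                        (ℚₚ.+-assoc (a ℚ.- b) b (ℚ.- c))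

  sub-* : ∀ a b c d → a ℚ.* b ℚ.- c ℚ.* d ≡ a ℚ.* (b ℚ.- d) ℚ.+ d ℚ.* (a ℚ.- c)
  sub-* a b c d = trans (sub-sub (a ℚ.* b) (a ℚ.* d) (c ℚ.* d)) (cong₂ ℚ._+_
    (trans (cong (a ℚ.* b ℚ.+_) (ℚₚ.neg-distribʳ-* a d)) (sym (ℚₚ.*-distribˡ-+ a b (ℚ.- d))))
    (trans (cong (a ℚ.* d ℚ.+_) (ℚₚ.neg-distribˡ-* c d))
      (trans (sym (ℚₚ.*-distribʳ-+ d a (ℚ.- c))) (ℚₚ.*-comm (a ℚ.- c) d))))

  half-pos : ∀ {ε} → 0ℚ ℚ.< ε → 0ℚ ℚ.< ½ ℚ.* ε
  half-pos {ε} ε>0 = subst (ℚ._< ½ ℚ.* ε) (ℚₚ.*-zeroʳ ½) (ℚₚ.*-monoʳ-<-pos ½ {0ℚ} {ε} ε>0)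

  half+half : ∀ ε → ½ ℚ.* ε ℚ.+ ½ ℚ.* ε ≡ ε
  half+half ε = trans (sym (ℚₚ.*-distribʳ-+ ε ½ ½)) (ℚₚ.*-identityˡ ε)

  ⊔-≤ˡ : ∀ {a b n} → a ℕ.⊔ b ℕ.≤ n → a ℕ.≤ n
  ⊔-≤ˡ {a} {b} = ℕₚ.≤-trans (ℕₚ.m≤m⊔n a b)

  ⊔-≤ʳ : ∀ {a b n} → a ℕ.⊔ b ℕ.≤ n → b ℕ.≤ n
  ⊔-≤ʳ {a} {b} = ℕₚ.≤-trans (ℕₚ.m≤n⊔m a b)

  const-cauchy : ∀ q → Cauchy (λ _ → q)
  const-cauchy q ε ε>0 = 0 , λ _ _ →
    ℚₚ.≤-trans (ℚₚ.≤-reflexive (cong ∣_∣ (ℚₚ.+-inverseʳ q))) (ℚₚ.<⇒≤ ε>0)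

  +-cauchy : ∀ x y → Cauchy x → Cauchy y → Cauchy (λ n → x n ℚ.+ y n)
  +-cauchy x y cx cy ε ε>0
    with N , f ← cx _ (half-pos ε>0) | M , g ← cy _ (half-pos ε>0) =
    N ℕ.⊔ M , λ {m} {n} p q → begin
      ∣ (x m ℚ.+ y m) ℚ.- (x n ℚ.+ y n) ∣
        ≡⟨ cong ∣_∣ (sub-+ (x m) (y m) (x n) (y n)) ⟩
      ∣ (x m ℚ.- x n) ℚ.+ (y m ℚ.- y n) ∣
        ≤⟨ ℚₚ.∣p+q∣≤∣p∣+∣q∣ (x m ℚ.- x n) (y m ℚ.- y n) ⟩
      ∣ x m ℚ.- x n ∣ ℚ.+ ∣ y m ℚ.- y n ∣
        ≤⟨ ℚₚ.+-mono-≤ (f (⊔-≤ˡ {N} {M} p) (⊔-≤ˡ {N} {M} q))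
                       (g (⊔-≤ʳ {N} {M} p) (⊔-≤ʳ {N} {M} q)) ⟩
      ½ ℚ.* ε ℚ.+ ½ ℚ.* ε
        ≡⟨ half+half ε ⟩
      ε ∎

  neg-cauchy : ∀ x → Cauchy x → Cauchy (λ n → ℚ.- x n)
  neg-cauchy x cx ε ε>0 with N , f ← cx ε ε>0 = N , λ {m} {n} p q →
    ℚₚ.≤-trans
      (ℚₚ.≤-reflexive (trans
        (cong ∣_∣ (sym (ℚₚ.neg-distrib-+ (x m) (ℚ.- x n))))
        (ℚₚ.∣-p∣≡∣p∣ (x m ℚ.- x n))))
      (f p q)

  bounded : ∀ x → Cauchy x → Σ[ K ∈ ℚ ] (0ℚ ℚ.< K × Eventually λ n → ∣ x n ∣ ℚ.≤ K)
  bounded x cx with N , f ← cx 1ℚ (ℚ.*<* (+<+ (s≤s z≤n))) =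
      1ℚ ℚ.+ ∣ x N ∣
    , ℚₚ.+-mono-<-≤ {0ℚ} {1ℚ} (ℚ.*<* (+<+ (s≤s z≤n))) (ℚₚ.0≤∣p∣ (x N))
    , N , λ {n} p → begin
      ∣ x n ∣
        ≡⟨ cong ∣_∣ (sym (sub-add (x n) (x N))) ⟩
      ∣ (x n ℚ.- x N) ℚ.+ x N ∣
        ≤⟨ ℚₚ.∣p+q∣≤∣p∣+∣q∣ (x n ℚ.- x N) (x N) ⟩
      ∣ x n ℚ.- x N ∣ ℚ.+ ∣ x N ∣
        ≤⟨ ℚₚ.+-monoˡ-≤ ∣ x N ∣ (f p ℕₚ.≤-refl) ⟩
      1ℚ ℚ.+ ∣ x N ∣ ∎

  ∣*∣-≤ : ∀ p q {A δ} → 0ℚ ℚ.≤ A → ∣ p ∣ ℚ.≤ A → ∣ q ∣ ℚ.≤ δ → ∣ p ℚ.* q ∣ ℚ.≤ A ℚ.* δ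
  ∣*∣-≤ p q {A} {δ} A≥0 p≤A q≤δ = begin
    ∣ p ℚ.* q ∣     ≡⟨ ℚₚ.∣p*q∣≡∣p∣*∣q∣ p q ⟩
    ∣ p ∣ ℚ.* ∣ q ∣ ≤⟨ ℚₚ.*-monoʳ-≤-nonNeg ∣ q ∣ ⦃ ℚ.nonNegative (ℚₚ.0≤∣p∣ q) ⦄ {∣ p ∣} {A} p≤A ⟩
    A ℚ.* ∣ q ∣     ≤⟨ ℚₚ.*-monoˡ-≤-nonNeg A ⦃ ℚ.nonNegative A≥0 ⦄ {∣ q ∣} {δ} q≤δ ⟩
    A ℚ.* δ ∎

  sub-*-≤ : ∀ a b c d A B δ → 0ℚ ℚ.≤ A → 0ℚ ℚ.≤ B → ∣ a ∣ ℚ.≤ A → ∣ d ∣ ℚ.≤ B →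
            ∣ b ℚ.- d ∣ ℚ.≤ δ → ∣ a ℚ.- c ∣ ℚ.≤ δ →
            ∣ a ℚ.* b ℚ.- c ℚ.* d ∣ ℚ.≤ A ℚ.* δ ℚ.+ B ℚ.* δ
  sub-*-≤ a b c d A B δ A≥0 B≥0 a≤A d≤B b-d≤δ a-c≤δ = begin
    ∣ a ℚ.* b ℚ.- c ℚ.* d ∣
      ≡⟨ cong ∣_∣ (sub-* a b c d) ⟩
    ∣ a ℚ.* (b ℚ.- d) ℚ.+ d ℚ.* (a ℚ.- c) ∣
      ≤⟨ ℚₚ.∣p+q∣≤∣p∣+∣q∣ (a ℚ.* (b ℚ.- d)) (d ℚ.* (a ℚ.- c)) ⟩
    ∣ a ℚ.* (b ℚ.- d) ∣ ℚ.+ ∣ d ℚ.* (a ℚ.- c) ∣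
      ≤⟨ ℚₚ.+-mono-≤ {∣ a ℚ.* (b ℚ.- d) ∣} {A ℚ.* δ} {∣ d ℚ.* (a ℚ.- c) ∣} {B ℚ.* δ}
           (∣*∣-≤ a (b ℚ.- d) A≥0 a≤A b-d≤δ) (∣*∣-≤ d (a ℚ.- c) B≥0 d≤B a-c≤δ) ⟩
    A ℚ.* δ ℚ.+ B ℚ.* δ ∎

  *-cauchy : ∀ x y → Cauchy x → Cauchy y → Cauchy (λ n → x n ℚ.* y n)
  *-cauchy x y cx cy ε ε>0
    with A , A>0 , N₁ , f₁ ← bounded x cx | B , B>0 , N₂ , f₂ ← bounded y cy = result
    where
    K = A ℚ.+ B
    K>0 : 0ℚ ℚ.< K
    K>0 = ℚₚ.+-mono-< A>0 B>0
    instance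
      K-pos : ℚ.Positive K
      K-pos = ℚ.positive K>0
      K-nz : ℚ.NonZero K
      K-nz = ℚₚ.pos⇒nonZero K
      ε-pos : ℚ.Positive ε
      ε-pos = ℚ.positive ε>0
      1/K-pos : ℚ.Positive (ℚ.1/ K)
      1/K-pos = ℚₚ.1/pos⇒pos K
    δ = ε ℚ.* ℚ.1/ K
    δ>0 : 0ℚ ℚ.< δ
    δ>0 = ℚₚ.positive⁻¹ δ ⦃ ℚₚ.pos*pos⇒pos ε (ℚ.1/ K) ⦄
    δK : A ℚ.* δ ℚ.+ B ℚ.* δ ≡ ε
    δK = begin-equality
      A ℚ.* δ ℚ.+ B ℚ.* δ    ≡⟨ ℚₚ.*-distribʳ-+ δ A B ⟨
      K ℚ.* (ε ℚ.* ℚ.1/ K)   ≡⟨ trans (sym (ℚₚ.*-assoc K ε (ℚ.1/ K))) (trans (cong (ℚ._* ℚ.1/ K) (ℚₚ.*-comm K ε)) (ℚₚ.*-assoc ε K (ℚ.1/ K))) ⟩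
      ε ℚ.* (K ℚ.* ℚ.1/ K)   ≡⟨ cong (ε ℚ.*_) (ℚₚ.*-inverseʳ K) ⟩
      ε ℚ.* 1ℚ               ≡⟨ ℚₚ.*-identityʳ ε ⟩
      ε ∎
    result : ∃[ N ] (∀ {m n} → N ℕ.≤ m → N ℕ.≤ n →
                      ∣ x m ℚ.* y m ℚ.- x n ℚ.* y n ∣ ℚ.≤ ε)
    result with M₁ , g₁ ← cx δ δ>0 | M₂ , g₂ ← cy δ δ>0 =
      (N₁ ℕ.⊔ N₂) ℕ.⊔ (M₁ ℕ.⊔ M₂) , λ {m} {n} p q →
        let pN = ⊔-≤ˡ {N₁ ℕ.⊔ N₂} {M₁ ℕ.⊔ M₂} p
            pM = ⊔-≤ʳ {N₁ ℕ.⊔ N₂} {M₁ ℕ.⊔ M₂} p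
            qN = ⊔-≤ˡ {N₁ ℕ.⊔ N₂} {M₁ ℕ.⊔ M₂} q
            qM = ⊔-≤ʳ {N₁ ℕ.⊔ N₂} {M₁ ℕ.⊔ M₂} q
        in subst (∣ x m ℚ.* y m ℚ.- x n ℚ.* y n ∣ ℚ.≤_) δK
             (sub-*-≤ (x m) (y m) (x n) (y n) A B δ (ℚₚ.<⇒≤ A>0) (ℚₚ.<⇒≤ B>0)
               (f₁ (⊔-≤ˡ {N₁} {N₂} pN)) (f₂ (⊔-≤ʳ {N₁} {N₂} qN))
               (g₂ (⊔-≤ʳ {M₁} {M₂} pM) (⊔-≤ʳ {M₁} {M₂} qM))
               (g₁ (⊔-≤ˡ {M₁} {M₂} pM) (⊔-≤ˡ {M₁} {M₂} qM)))

fromℚ : ℚ → ℝ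
fromℚ q = mkℝ (λ _ → q) (const-cauchy q)

0ᴿ 1ᴿ : ℝ
0ᴿ = fromℚ 0ℚ
1ᴿ = fromℚ 1ℚ

_+ᴿ_ _*ᴿ_ _-ᴿ_ : ℝ → ℝ → ℝ
mkℝ x cx +ᴿ mkℝ y cy = mkℝ (λ n → x n ℚ.+ y n) (+-cauchy x y cx cy)
mkℝ x cx *ᴿ mkℝ y cy = mkℝ (λ n → x n ℚ.* y n) (*-cauchy x y cx cy)
mkℝ x cx -ᴿ mkℝ y cy = mkℝ (λ n → x n ℚ.- y n) (+-cauchy x (λ n → ℚ.- y n) cx (neg-cauchy y cy))

_⟶_ : (ℕ → ℝ) → ℝ → Set
a ⟶ L = ∀ ε → 0ℚ ℚ.< ε → Eventually λ n → a n ≤ᴿ L +ᴿ fromℚ ε × L ≤ᴿ a n +ᴿ fromℚ ε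

∑ : ∀ {n} → (Fin n → ℝ) → ℝ
∑ = foldr _+ᴿ_ 0ᴿ

module _ {X : Set} where

  infix  4 _≋_
  infixl 6 _⊕_ _⊖_
  infixr 7 _·_

  _≋_ : (X → ℝ) → (X → ℝ) → Set
  v ≋ w = ∀ x → v x ≈ᴿ w x

  _⊕_ _⊖_ : (X → ℝ) → (X → ℝ) → (X → ℝ)
  (v ⊕ w) x = v x +ᴿ w x
  (v ⊖ w) x = v x -ᴿ w x

  _·_ : ℝ → (X → ℝ) → (X → ℝ)
  (c · v) x = c *ᴿ v x

  linComb : ∀ {n} → (Fin n → ℝ) → (Fin n → X → ℝ) → (X → ℝ)
  linComb c p x = ∑ λ i → c i *ᴿ p i x

  𝟎 : X → ℝ
  𝟎 _ = 0ᴿ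

  Conv : Pred (X → ℝ) 0ℓ → Pred (X → ℝ) 0ℓ
  Conv S v = Σ[ n ∈ ℕ ] Σ[ c ∈ (Fin n → ℝ) ] Σ[ p ∈ (Fin n → X → ℝ) ]
    (∀ i → S (p i)) × (∀ i → 0ᴿ ≤ᴿ c i) × ∑ c ≈ᴿ 1ᴿ × v ≋ linComb c p

  Aff : Pred (X → ℝ) 0ℓ → Pred (X → ℝ) 0ℓ
  Aff S v = Σ[ n ∈ ℕ ] Σ[ c ∈ (Fin n → ℝ) ] Σ[ p ∈ (Fin n → X → ℝ) ]
    (∀ i → S (p i)) × ∑ c ≈ᴿ 1ᴿ × v ≋ linComb c p

  Direction : Pred (X → ℝ) 0ℓ → Pred (X → ℝ) 0ℓ
  Direction A w = ∃[ u ] ∃[ v ] (A u × A v × w ≋ (u ⊖ v))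

  LinearlyIndependent : ∀ {d} → (Fin d → X → ℝ) → Set
  LinearlyIndependent b = ∀ c → linComb c b ≋ 𝟎 → ∀ i → c i ≈ᴿ 0ᴿ

  IsBasis : ∀ {d} → Pred (X → ℝ) 0ℓ → (Fin d → X → ℝ) → Set
  IsBasis W b = (∀ i → W (b i)) × LinearlyIndependent b ×
                (∀ w → W w → ∃[ c ] (w ≋ linComb c b))

  HasDimension : Pred (X → ℝ) 0ℓ → ℕ → Set
  HasDimension S d = ∃ (Aff S) × Σ[ b ∈ (Fin d → X → ℝ) ] IsBasis (Direction (Aff S)) b

  -- Vertices are extreme points.
  IsVertex : Pred (X → ℝ) 0ℓ → Pred (X → ℝ) 0ℓ
  IsVertex P v = P v × (∀ u w t → P u → P w → 0ᴿ <ᴿ t → t <ᴿ 1ᴿ →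
                        v ≋ (t · u ⊕ (1ᴿ -ᴿ t) · w) → u ≋ v × w ≋ v)

-- One-line notation, with positions and values numbered from 0.  Injectivity
-- is irrelevant, so permutations with the same word are equal.
record 𝒮 (n : ℕ) : Set where
  constructor perm
  field
    word       : Vec (Fin n) n
    .injective : Injective _≡_ _≡_ (lookup word)

open 𝒮 public using (word)

_≟ˢ_ : ∀ {n} → DecidableEquality (𝒮 n)
perm v _ ≟ˢ perm w _ = map′ (λ { refl → refl }) (cong word) (Vecₚ.≡-dec Fₚ._≟_ v w)

private
  variable
    l m n : ℕ

rank : (Fin m → Fin n) → Fin m → ℕ
rank {m} x i = length (filter (λ j → x j Fₚ.<? x i) (allFin m))

module _ where
  filter-< : ∀ {A : Set} {P Q : Pred A 0ℓ} (P? : Decidable P) (Q? : Decidable Q) →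
             (∀ {a} → P a → Q a) → ∀ {a} → ¬ P a → Q a → ∀ {xs} → a ∈ xs →
             length (filter P? xs) ℕ.< length (filter Q? xs)
  filter-< {P = P} {Q} P? Q? P⇒Q ¬p q = go
    where
    filter-≤ : ∀ xs → length (filter P? xs) ℕ.≤ length (filter Q? xs)
    filter-≤ [] = z≤n
    filter-≤ (x ∷ xs) with P? x | Q? x
    ... | yes _ | yes _  = s≤s (filter-≤ xs)
    ... | yes p | no ¬q′ = contradiction (P⇒Q p) ¬q′
    ... | no _  | yes _  = ℕₚ.m≤n⇒m≤1+n (filter-≤ xs)
    ... | no _  | no _   = filter-≤ xs
    go : ∀ {xs} → _ ∈ xs → length (filter P? xs) ℕ.< length (filter Q? xs)
    go {x ∷ xs} (here refl) with P? x | Q? x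
    ... | yes p | _      = contradiction p ¬p
    ... | no _  | yes _  = s≤s (filter-≤ xs)
    ... | no _  | no ¬q′ = contradiction q ¬q′
    go {x ∷ xs} (there a∈) with P? x | Q? x
    ... | yes _ | yes _  = s≤s (go a∈)
    ... | yes p | no ¬q′ = contradiction (P⇒Q p) ¬q′
    ... | no _  | yes _  = ℕₚ.m≤n⇒m≤1+n (go a∈)
    ... | no _  | no _   = go a∈

  rank<m : (x : Fin m → Fin n) (i : Fin m) → rank x i ℕ.< m
  rank<m {m} x i = subst (rank x i ℕ.<_) (length-tabulate (λ j → j))
    (filter-notAll (λ j → x j Fₚ.<? x i) (allFin m)
      (Any.map (λ { refl → Fₚ.<-irrefl refl }) (∈-allFin i)))

  rank-mono : (x : Fin m → Fin n) {i j : Fin m} → x i < x j → rank x i ℕ.< rank x j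
  rank-mono x {i} {j} lt =
    filter-< (λ l → x l Fₚ.<? x i) (λ l → x l Fₚ.<? x j)
      (λ p → Fₚ.<-trans p lt) (Fₚ.<-irrefl refl) lt (∈-allFin i)

  rank-injective : (x : Fin m → Fin n) → Injective _≡_ _≡_ x → Injective _≡_ _≡_ (rank x)
  rank-injective x inj {i} {j} eq with Fₚ.<-cmp (x i) (x j)
  ... | tri< lt _ _ = contradiction eq (ℕₚ.<⇒≢ (rank-mono x lt))
  ... | tri≈ _ e _  = inj e
  ... | tri> _ _ gt = contradiction (sym eq) (ℕₚ.<⇒≢ (rank-mono x gt))

  stdWord : (Fin m → Fin n) → Vec (Fin m) m
  stdWord x = tabulate λ i → fromℕ< (rank<m x i)

  toℕ-stdWord : (x : Fin m → Fin n) (i : Fin m) → toℕ (lookup (stdWord x) i) ≡ rank x i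
  toℕ-stdWord x i = trans (cong toℕ (lookup∘tabulate _ i)) (Fₚ.toℕ-fromℕ< (rank<m x i))

  stdWord-injective : (x : Fin m → Fin n) → Injective _≡_ _≡_ x →
                      Injective _≡_ _≡_ (lookup (stdWord x))
  stdWord-injective x inj {i} {j} eq = rank-injective x inj
    (trans (sym (toℕ-stdWord x i)) (trans (cong toℕ eq) (toℕ-stdWord x j)))

-- The i-th value is the number of entries below xᵢ; std-spec is the defining
-- property.
std : (x : Fin m → Fin n) → .(Injective _≡_ _≡_ x) → 𝒮 m
std x inj = perm (stdWord x) (stdWord-injective x inj)

std-spec : (x : Fin m → Fin n) (inj : Injective _≡_ _≡_ x) (i j : Fin m) →
           (lookup (word (std x inj)) i < lookup (word (std x inj)) j) ⇔ (x i < x j)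
std-spec x inj i j = mk⇔ to from
  where
  from : x i < x j → lookup (stdWord x) i < lookup (stdWord x) j
  from lt rewrite toℕ-stdWord x i | toℕ-stdWord x j = rank-mono x lt
  to : lookup (stdWord x) i < lookup (stdWord x) j → x i < x j
  to lt rewrite toℕ-stdWord x i | toℕ-stdWord x j with Fₚ.<-cmp (x i) (x j)
  ... | tri< p _ _ = p
  ... | tri≈ _ e _ = contradiction (cong (rank x) (inj e)) (ℕₚ.<⇒≢ lt)
  ... | tri> _ _ p = contradiction lt (ℕₚ.<-asym (rank-mono x p))

-- An m-element subset {i₁ < … < iₘ} of positions, as its increasing enumeration.
record Positions (m n : ℕ) : Set where
  constructor positions
  field
    at         : Fin m → Fin n
    increasing : ∀ {i j} → i < j → at i < at j

  at-injective : Injective _≡_ _≡_ at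
  at-injective {i} {j} eq with Fₚ.<-cmp i j
  ... | tri< lt _ _ = contradiction (increasing lt) (Fₚ.<-irrefl eq)
  ... | tri≈ _ e _  = e
  ... | tri> _ _ gt = contradiction (increasing gt) (Fₚ.<-irrefl (sym eq))

open Positions public

pat : Positions m n → 𝒮 n → 𝒮 m
pat I (perm w inj) = std (lookup w ∘ at I) (at-injective I ∘ inj)

-- The interval {i, …, i + m - 1}.
interval : (i m : ℕ) → .(i ℕ.+ m ℕ.≤ n) → Positions m n
interval {n} i m i+m≤n = positions at′ increasing′
  where
  at′ : Fin m → Fin n
  at′ j = fromℕ< {i ℕ.+ toℕ j} (ℕₚ.<-≤-trans (ℕₚ.+-monoʳ-< i (Fₚ.toℕ<n j)) i+m≤n)
  increasing′ : ∀ {j j′} → j < j′ → at′ j < at′ j′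
  increasing′ {j} {j′} lt
    rewrite Fₚ.toℕ-fromℕ< {i ℕ.+ toℕ j} {n} (ℕₚ.<-≤-trans (ℕₚ.+-monoʳ-< i (Fₚ.toℕ<n j)) i+m≤n)
          | Fₚ.toℕ-fromℕ< {i ℕ.+ toℕ j′} {n} (ℕₚ.<-≤-trans (ℕₚ.+-monoʳ-< i (Fₚ.toℕ<n j′)) i+m≤n)
    = ℕₚ.+-monoʳ-< i lt

Patterns : Set₁
Patterns = Pred (∃ 𝒮) 0ℓ

Avoids : Patterns → 𝒮 n → Set
Avoids {n} B σ = ∀ {m} {π : 𝒮 m} → B (m , π) → (I : Positions m n) → pat I σ ≢ π

record Av (B : Patterns) (n : ℕ) : Set where
  constructor av
  field
    underlying : 𝒮 n
    .avoids    : Avoids B underlying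

open Av public using (underlying)

_≟ᴬ_ : ∀ {B} → DecidableEquality (Av B n)
av σ _ ≟ᴬ av τ _ = map′ (λ { refl → refl }) (cong underlying) (σ ≟ˢ τ)

module _ where
  _∘ᴾ_ : Positions m n → Positions l m → Positions l n
  I ∘ᴾ J = positions (at I ∘ at J) (increasing I ∘ increasing J)

  pat-∘ : (I : Positions m n) (J : Positions l m) (σ : 𝒮 n) → pat J (pat I σ) ≡ pat (I ∘ᴾ J) σ
  pat-∘ {l = l} I J (perm w inj) = perm-cong
    (tabulate-cong λ i → Fₚ.fromℕ<-cong _ _ (rank-eq i) _ _)
    where
    perm-cong : ∀ {v v′ : Vec (Fin l) l}
                .{p : Injective _≡_ _≡_ (lookup v)} .{p′ : Injective _≡_ _≡_ (lookup v′)} →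
                v ≡ v′ → perm v p ≡ perm v′ p′
    perm-cong refl = refl
    x  = lookup w ∘ at I
    y  = lookup (stdWord x) ∘ at J
    from : ∀ a b → x (at J a) < x (at J b) → y a < y b
    from a b lt rewrite toℕ-stdWord x (at J a) | toℕ-stdWord x (at J b) = rank-mono x lt
    to : ∀ a b → y a < y b → x (at J a) < x (at J b)
    to a b lt with Fₚ.<-cmp (x (at J a)) (x (at J b))
    ... | tri< p _ _ = p
    ... | tri≈ _ e _ = contradiction lt (ℕₚ.<-irrefl
            (trans (toℕ-stdWord x (at J a)) (trans
              (cong (λ v → length (filter (λ j → x j Fₚ.<? v) (allFin _))) e)
              (sym (toℕ-stdWord x (at J b))))))
    ... | tri> _ _ p = contradiction lt (ℕₚ.<-asym (from b a p))
    rank-eq : ∀ i → rank y i ≡ rank (x ∘ at J) i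
    rank-eq i = cong length
      (filter-≐ (λ j → y j Fₚ.<? y i) (λ j → x (at J j) Fₚ.<? x (at J i))
        ((λ {a} → to a i) , (λ {a} → from a i)) (allFin l))

  pat-avoids : ∀ {B} (I : Positions m n) (σ : 𝒮 n) → Avoids B σ → Avoids B (pat I σ)
  pat-avoids I σ avoids b J eq = avoids b (I ∘ᴾ J) (trans (sym (pat-∘ I J σ)) eq)

patᴬ : ∀ {B} → Positions m n → Av B n → Av B m
patᴬ I (av σ avoids) = av (pat I σ) (pat-avoids I σ avoids)

⟦312⟧ : Patterns
⟦312⟧ = ｛ 3 , perm w inj ｝
  where
  w : Vec (Fin 3) 3
  w = fsuc (fsuc fzero) ∷ fzero ∷ fsuc fzero ∷ []
  inj : Injective _≡_ _≡_ (lookup w)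
  inj {i} {j} = from-yes
    (Fₚ.all? λ i → Fₚ.all? λ j → lookup w i Fₚ.≟ lookup w j →-dec i Fₚ.≟ j) i j

OccursAt : 𝒮 m → 𝒮 n → Fin n → Set
OccursAt {m} {n} π σ i = Σ[ p ∈ toℕ i ℕ.+ m ℕ.≤ n ] pat (interval (toℕ i) m p) σ ≡ π

occursAt? : (π : 𝒮 m) (σ : 𝒮 n) → Decidable (OccursAt π σ)
occursAt? {m} {n} π σ i with toℕ i ℕ.+ m ℕₚ.≤? n
... | no  i+m≰n = no (i+m≰n ∘ proj₁)
... | yes i+m≤n = map′ (i+m≤n ,_) proj₂ (pat (interval (toℕ i) m i+m≤n) σ ≟ˢ π)

c-occ : 𝒮 m → 𝒮 n → ℕ
c-occ {n = n} π σ = length (filter (occursAt? π σ) (allFin n))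

c-occ~ : 𝒮 m → 𝒮 n → .⦃ ℕ.NonZero n ⦄ → ℚ
c-occ~ {n = n} π σ = + c-occ π σ ℚ./ n

record Av⁺ (B : Patterns) : Set where
  field
    size         : ℕ
    ⦃ nonEmpty ⦄ : ℕ.NonZero size
    element      : Av B size

  freq : 𝒮 m → ℚ
  freq π = c-occ~ π (underlying element)

open Av⁺ public using (size; element; freq)

FeasibleRegion : (k : ℕ) → Patterns → Pred (𝒮 k → ℝ) 0ℓ
FeasibleRegion k B v =
  (∀ π → 0ᴿ ≤ᴿ v π × v π ≤ᴿ 1ᴿ) ×
  Σ[ σ ∈ (ℕ → Av⁺ B) ]
    (∀ M → Eventually λ m → M ℕ.≤ size (σ m)) ×
    (∀ π → (λ m → fromℚ (freq (σ m) π)) ⟶ v π)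

record Multigraph : Set₁ where
  field
    Vertex Edge : Set
    src tgt     : Edge → Vertex
    _≟ᴱ_        : DecidableEquality Edge

module _ (G : Multigraph) where
  open Multigraph G

  data IsWalk : Vertex → List Edge → Vertex → Set where
    []  : ∀ {u} → IsWalk u [] u
    _∷_ : ∀ {u e es v} → src e ≡ u → IsWalk (tgt e) es v → IsWalk u (e ∷ es) v

  record Cycle : Set where
    field
      edges  : List⁺ Edge
      closed : ∃[ v ] IsWalk v (toList edges) v

  -- The vertices met by a closed walk, its endpoint counted once, are the
  -- sources of its edges.
  record IsSimple (C : Cycle) : Set where
    open Cycle C
    field
      distinctEdges    : Unique (toList edges)
      distinctVertices : Unique (map src (toList edges))

  cycleVector : Cycle → (Edge → ℝ)
  cycleVector C e = fromℚ (+ length (filter (e ≟ᴱ_) (toList edges)) ℚ./ length⁺ edges)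
    where open Cycle C

  CyclePolytope : Pred (Edge → ℝ) 0ℓ
  CyclePolytope = Conv λ v → ∃[ C ] (IsSimple C × v ≋ cycleVector C)

OverlapGraph : (k : ℕ) → .⦃ ℕ.NonZero k ⦄ → Patterns → Multigraph
OverlapGraph k B = record
  { Vertex = Av B (ℕ.pred k)
  ; Edge   = Av B k
  ; src    = patᴬ (interval 0 (ℕ.pred k) ℕₚ.pred[n]≤n)
  ; tgt    = patᴬ (interval 1 (ℕ.pred k) (ℕₚ.≤-reflexive (ℕₚ.suc-pred k)))
  ; _≟ᴱ_   = _≟ᴬ_
  }

-- v is the image of w under ℝ^{Av_k(B)} ↪ ℝ^{𝒮_k}.
ExtensionByZero : ∀ {k B} → (𝒮 k → ℝ) → (Av B k → ℝ) → Set
ExtensionByZero {k} {B} v w =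
  (∀ (π : Av B k) → v (underlying π) ≈ᴿ w π) × (∀ π → ¬ Avoids B π → v π ≈ᴿ 0ᴿ)

-- The division is exact.
Catalan : ℕ → ℕ
Catalan n = ((2 ℕ.* n) C n) / suc n

-- A permutation avoids 312 exactly when its standardised tail does and its first value
-- exceeds that of this tail by at most one.  Hence the avoiders are counted by the Catalan numbers, and a
-- value can be prepended to an avoider so as to extend its initial window by any edge of
-- the overlap graph that ends there: walks in the overlap graph are precisely the sequences
-- of windows of avoiders, and the graph is strongly connected.  Counting windows
-- turns the feasible region into the set of unit flows (nonnegative circulations of total
-- weight one).  Subtracting minima along all simple cycles in turn is a continuous
-- procedure that writes a real flow as a combination of simple cycles; conversely a walk
-- that follows each cycle of a combination in proportion to its coefficient approximates
-- it.  The edges prepending the least value form a spanning tree, whose fundamental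
-- cycles give a basis of the directions.  A flow supported on a simple cycle is constant
-- along it, so simple cycles are extreme, and any other flow is a proper mixture.

module Submission where

open import Algebra.Bundles using (CommutativeRing)
import Algebra.Solver.Ring as RingSolver
import Algebra.Solver.Ring.AlmostCommutativeRing as ACR
open import Data.Bool.Base using (if_then_else_)
open import Data.Empty using (⊥; ⊥-elim; ⊥-elim-irr)
open import Data.Fin.Base as Fin
  using (Fin; toℕ; fromℕ<; _<_; punchIn; punchOut) renaming (zero to fzero; suc to fsuc)
import Data.Fin.Properties as Fₚ
import Data.Integer.Base as ℤ
import Data.Integer.Properties as ℤₚ
open import Data.List.Base as List
  using (List; []; _∷_; _++_; map; length; concat; lookup; filter; allFin; tabulate)
import Data.List.Membership.DecPropositional as ∈Dec
open import Data.List.Membership.Propositional using (_∈_; _∉_; lose)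
import Data.List.Membership.Propositional.Properties as ∈ₚ
open import Data.List.NonEmpty using (List⁺; module List⁺; toList; _∷_) renaming (length to length⁺)
import Data.List.Properties as Listₚ
open import Data.List.Relation.Unary.All as All using (All; []; _∷_)
import Data.List.Relation.Unary.All.Properties as Allₚ
open import Data.List.Relation.Unary.AllPairs as AllPairs using ([]; _∷_)
import Data.List.Relation.Unary.AllPairs.Properties as AllPairsₚ
open import Data.List.Relation.Unary.Any as Any using (here; there; Any)
import Data.List.Relation.Unary.Any.Properties as Anyₚ
import Data.List.Relation.Unary.Unique.DecPropositional as UniqueDec
open import Data.List.Relation.Unary.Unique.Propositional using (Unique)
import Data.List.Relation.Unary.Unique.Propositional.Properties as Uniqueₚ
open import Data.Maybe.Base as Maybe using (Maybe)
open import Data.Nat.Base as ℕ using (ℕ; zero; suc; z≤n; s≤s; NonZero; _∸_)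
open import Data.Nat.DivMod using (_/_; m*n/n≡m; m≡m%n+[m/n]*n; m%n<n; m/n*n≤m)
open import Data.Nat.ListAction using (sum)
open import Data.Nat.ListAction.Properties using (sum-++)
import Data.Nat.Properties as ℕₚ
open import Data.Product using (_,_; _×_; proj₁; proj₂; ∃-syntax; Σ-syntax)
open import Data.Rational as ℚ using (ℚ; 0ℚ; 1ℚ; ½; ∣_∣; mkℚ)
import Data.Rational.Properties as ℚₚ
open import Data.Rational.Unnormalised as ℚᵘ using (mkℚᵘ; *≡*)
import Data.Rational.Unnormalised.Properties as ℚᵘₚ
open import Data.Sum using (_⊎_; inj₁; inj₂; [_,_]′; map₂)
open import Data.Vec.Base as Vec using ([])
import Data.Vec.Properties as Vecₚ
open import Defs
open import Function using (_∘_; id; _⇔_; mk⇔; Equivalence; Injective)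
open import Level using (0ℓ)
open import Relation.Binary.Definitions using (tri<; tri≈; tri>; DecidableEquality)
open import Relation.Binary.PropositionalEquality
  using (_≡_; _≢_; refl; sym; trans; cong; cong₂; subst; subst₂; module ≡-Reasoning)
import Relation.Binary.Reasoning.Setoid as SetoidReasoning
open import Relation.Nullary using (¬_; Dec; yes; no; contradiction; recompute; does)
open import Relation.Nullary.Decidable using (dec⇒maybe; _×-dec_; map′)
open import Relation.Unary using (Decidable)

-- Order and equality of Cauchy reals are not decidable, so no step may ask on which edges a flow
-- vanishes. Three facts stand in for such case distinctions: a positive sum has a positive summand,
-- a refuted strict inequality gives the reverse weak one, and minima exist. This is why cycles are
-- subtracted along the full finite list rather than along the support, and why the residue is shown
-- only not to be positive. Conservation is tested against bounded natural potentials: along an open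
-- walk it fails only by the potentials of the two ends, an error that division by the size removes
-- in the limit. Circulations on a strongly connected graph have dimension one more than the number
-- of edges minus the number of vertices; fixing the total weight removes that one. Accordingly
-- there are as many edges `cons₀ v` as vertices: the tree edges and a loop at the identity. The
-- loop corrects the total of each fundamental cycle to zero and pads all tree paths to a common
-- length.

module Permutations where

  -- Permutations, their patterns, and prepending a value

  private
    variable
      w m n : ℕ

  infixl 10 _⟨_⟩
  _⟨_⟩ : 𝒮 n → Fin n → Fin n
  σ ⟨ i ⟩ = Vec.lookup (word σ) i

  -- The stored proof is irrelevant; decidable equality of positions makes it usable again.
  ⟨⟩-injective : (σ : 𝒮 n) → Injective _≡_ _≡_ (σ ⟨_⟩)
  ⟨⟩-injective (perm w inj) {i} {j} eq = recompute (i Fₚ.≟ j) (inj eq)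

  -- Pigeonhole: punching out a missed value `c` would inject `Fin (suc n)` into `Fin n`.
  ⟨⟩-surjective : (σ : 𝒮 n) (c : Fin n) → ∃[ i ] σ ⟨ i ⟩ ≡ c
  ⟨⟩-surjective {suc n} σ c with Fₚ.any? (λ i → σ ⟨ i ⟩ Fₚ.≟ c)
  ... | yes p = p
  ... | no ¬p = contradiction (Fₚ.injective⇒≤ punch-injective) ℕₚ.1+n≰n
    where
    avoids-c : ∀ i → c ≢ σ ⟨ i ⟩
    avoids-c i eq = ¬p (i , sym eq)
    punch : Fin (suc n) → Fin n
    punch i = punchOut (avoids-c i)
    punch-injective : Injective _≡_ _≡_ punch
    punch-injective {i} {j} eq = ⟨⟩-injective σ (Fₚ.punchOut-injective (avoids-c i) (avoids-c j) eq)

  <-reflects : (σ τ : 𝒮 n) → (∀ a b → σ ⟨ a ⟩ < σ ⟨ b ⟩ → τ ⟨ a ⟩ < τ ⟨ b ⟩) →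
               ∀ a b → τ ⟨ a ⟩ < τ ⟨ b ⟩ → σ ⟨ a ⟩ < σ ⟨ b ⟩
  <-reflects σ τ h a b lt with Fₚ.<-cmp (σ ⟨ a ⟩) (σ ⟨ b ⟩)
  ... | tri< p _ _ = p
  ... | tri≈ _ e _ = contradiction lt (Fₚ.<-irrefl (cong (τ ⟨_⟩) (⟨⟩-injective σ e)))
  ... | tri> _ _ p = contradiction lt (Fₚ.<-asym (h b a p))

  -- Induction on the value: the entry of `σ` with value `c` lies below the one with value `suc c`,
  -- so the values of `τ` at these positions climb as well.
  <-preserving⇒≤ : (σ τ : 𝒮 n) → (∀ a b → σ ⟨ a ⟩ < σ ⟨ b ⟩ → τ ⟨ a ⟩ < τ ⟨ b ⟩) →
                   ∀ c i → toℕ (σ ⟨ i ⟩) ≡ c → c ℕ.≤ toℕ (τ ⟨ i ⟩)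
  <-preserving⇒≤ σ τ h zero    i eq = z≤n
  <-preserving⇒≤ {n} σ τ h (suc c) i eq =
    ℕₚ.≤-<-trans (<-preserving⇒≤ σ τ h c j σj≡c) (h j i (subst₂ ℕ._<_ (sym σj≡c) (sym eq) (ℕₚ.n<1+n c)))
    where
    c<n : c ℕ.< n
    c<n = ℕₚ.<-trans (ℕₚ.n<1+n c) (subst (ℕ._< n) eq (Fₚ.toℕ<n (σ ⟨ i ⟩)))
    j = proj₁ (⟨⟩-surjective σ (fromℕ< c<n))
    σj≡c : toℕ (σ ⟨ j ⟩) ≡ c
    σj≡c = trans (cong toℕ (proj₂ (⟨⟩-surjective σ (fromℕ< c<n)))) (Fₚ.toℕ-fromℕ< c<n)

  perm-cong : (σ τ : 𝒮 n) → word σ ≡ word τ → σ ≡ τ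
  perm-cong (perm v _) (perm .v _) refl = refl

  lookup-ext : ∀ {A : Set} (v w : Vec.Vec A n) → (∀ i → Vec.lookup v i ≡ Vec.lookup w i) → v ≡ w
  lookup-ext v w e = trans (sym (Vecₚ.tabulate∘lookup v)) (trans (Vecₚ.tabulate-cong e)
      (Vecₚ.tabulate∘lookup w))

  -- By trichotomy the implication also holds backwards, so each value bounds the other. This is the
  -- extensionality principle behind almost every identity of patterns below.
  order-ext : (σ τ : 𝒮 n) → (∀ a b → σ ⟨ a ⟩ < σ ⟨ b ⟩ → τ ⟨ a ⟩ < τ ⟨ b ⟩) → σ ≡ τ
  order-ext σ τ h = perm-cong σ τ (lookup-ext (word σ) (word τ) λ i → Fₚ.toℕ-injective (ℕₚ.≤-antisym
    (<-preserving⇒≤ σ τ h _ i refl) (<-preserving⇒≤ τ σ (<-reflects σ τ h) _ i refl)))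

  pat-< : (I : Positions m n) (σ : 𝒮 n) (a b : Fin m) →
          (pat I σ ⟨ a ⟩ < pat I σ ⟨ b ⟩) ⇔ (σ ⟨ at I a ⟩ < σ ⟨ at I b ⟩)
  pat-< I σ@(perm _ _) = std-spec (λ i → σ ⟨ at I i ⟩) (at-injective I ∘ ⟨⟩-injective σ)

  module _ (I : Positions m n) (σ : 𝒮 n) {a b : Fin m} where
    pat-<⁻ : pat I σ ⟨ a ⟩ < pat I σ ⟨ b ⟩ → σ ⟨ at I a ⟩ < σ ⟨ at I b ⟩
    pat-<⁻ = Equivalence.to (pat-< I σ a b)

    pat-<⁺ : σ ⟨ at I a ⟩ < σ ⟨ at I b ⟩ → pat I σ ⟨ a ⟩ < pat I σ ⟨ b ⟩
    pat-<⁺ = Equivalence.from (pat-< I σ a b)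

  pat-at-cong : (I J : Positions m n) (σ : 𝒮 n) → (∀ a → at I a ≡ at J a) → pat I σ ≡ pat J σ
  pat-at-cong I J σ e = order-ext (pat I σ) (pat J σ) λ a b lt → pat-<⁺ J σ
    (subst₂ (λ i j → σ ⟨ i ⟩ < σ ⟨ j ⟩) (e a) (e b) (pat-<⁻ I σ lt))

  toℕ-at-interval : ∀ i .(p : i ℕ.+ m ℕ.≤ n) (a : Fin m) → toℕ (at (interval {n} i m p) a) ≡ i ℕ.+ toℕ a
  toℕ-at-interval i p a = Fₚ.toℕ-fromℕ< _

  -- Avoidance of 312

  -- Avoidance as inequalities between three positions, which survives prepending without
  -- standardising any triple.
  No312 : 𝒮 n → Set
  No312 σ = ∀ {i j l} → i < j → j < l → σ ⟨ j ⟩ < σ ⟨ l ⟩ → σ ⟨ l ⟩ < σ ⟨ i ⟩ → ⊥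

  triple : {i j l : Fin n} → i < j → j < l → Positions 3 n
  triple {n} {i} {j} {l} i<j j<l = positions at′ increasing′
    where
    at′ : Fin 3 → Fin n
    at′ fzero               = i
    at′ (fsuc fzero)        = j
    at′ (fsuc (fsuc fzero)) = l
    increasing′ : ∀ {a b} → a < b → at′ a < at′ b
    increasing′ {fzero}      {fsuc fzero}        _ = i<j
    increasing′ {fzero}      {fsuc (fsuc fzero)} _ = Fₚ.<-trans i<j j<l
    increasing′ {fsuc fzero} {fsuc (fsuc fzero)} _ = j<l
    increasing′ {fzero}             {fzero}      ()
    increasing′ {fsuc _}            {fzero}      ()
    increasing′ {fsuc fzero}        {fsuc fzero} (s≤s ())
    increasing′ {fsuc (fsuc fzero)} {fsuc fzero} (s≤s ())
    increasing′ {fsuc (fsuc fzero)} {fsuc (fsuc fzero)} (s≤s (s≤s ()))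

  avoids⇒no312 : (σ : 𝒮 n) → Avoids ⟦312⟧ σ → No312 σ
  avoids⇒no312 σ avoids {i} {j} {l} i<j j<l σj<σl σl<σi = avoids refl I (order-ext _ _ order)
    where
    I = triple i<j j<l
    σj<σi = Fₚ.<-trans σj<σl σl<σi
    order : ∀ a b → pat I σ ⟨ a ⟩ < pat I σ ⟨ b ⟩ → _
    order a b lt with pat-<⁻ I σ {a} {b} lt
    order fzero               fzero               _ | p = contradiction p (Fₚ.<-irrefl refl)
    order fzero               (fsuc fzero)        _ | p = contradiction p (Fₚ.<-asym σj<σi)
    order fzero               (fsuc (fsuc fzero)) _ | p = contradiction p (Fₚ.<-asym σl<σi)
    order (fsuc fzero)        fzero               _ | p = s≤s z≤n
    order (fsuc fzero)        (fsuc fzero)        _ | p = contradiction p (Fₚ.<-irrefl refl)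
    order (fsuc fzero)        (fsuc (fsuc fzero)) _ | p = s≤s z≤n
    order (fsuc (fsuc fzero)) fzero               _ | p = s≤s (s≤s z≤n)
    order (fsuc (fsuc fzero)) (fsuc fzero)        _ | p = contradiction p (Fₚ.<-asym σj<σl)
    order (fsuc (fsuc fzero)) (fsuc (fsuc fzero)) _ | p = contradiction p (Fₚ.<-irrefl refl)

  no312⇒avoids : (σ : 𝒮 n) → No312 σ → Avoids ⟦312⟧ σ
  no312⇒avoids σ free refl I eq = free (increasing I {fzero} {fsuc fzero} (s≤s z≤n))
    (increasing I {fsuc fzero} {fsuc (fsuc fzero)} (s≤s (s≤s z≤n)))
    (pat-<⁻ I σ (subst (λ π → π ⟨ fsuc fzero ⟩ < π ⟨ fsuc (fsuc fzero) ⟩) (sym eq) (s≤s z≤n)))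
    (pat-<⁻ I σ (subst (λ π → π ⟨ fsuc (fsuc fzero) ⟩ < π ⟨ fzero ⟩) (sym eq) (s≤s (s≤s z≤n))))

  -- Prepending a value

  toℕ-punchIn-< : (x : Fin (suc n)) (y : Fin n) → toℕ y ℕ.< toℕ x → toℕ (punchIn x y) ≡ toℕ y
  toℕ-punchIn-< (fsuc x) fzero    _         = refl
  toℕ-punchIn-< (fsuc x) (fsuc y) (s≤s y<x) = cong suc (toℕ-punchIn-< x y y<x)

  toℕ-punchIn-≥ : (x : Fin (suc n)) (y : Fin n) → toℕ x ℕ.≤ toℕ y → toℕ (punchIn x y) ≡ suc (toℕ y)
  toℕ-punchIn-≥ fzero    y        _         = refl
  toℕ-punchIn-≥ (fsuc x) (fsuc y) (s≤s x≤y) = cong suc (toℕ-punchIn-≥ x y x≤y)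

  punchIn-< : (x : Fin (suc n)) {y z : Fin n} → y < z → punchIn x y < punchIn x z
  punchIn-< x {y} {z} y<z = Fₚ.≤∧≢⇒< (Fₚ.punchIn-mono-≤ x y z (ℕₚ.<⇒≤ y<z))
    (Fₚ.<⇒≢ y<z ∘ Fₚ.punchIn-injective x y z)

  punchIn-<⁻ : (x : Fin (suc n)) {y z : Fin n} → punchIn x y < punchIn x z → y < z
  punchIn-<⁻ x {y} {z} lt = Fₚ.≤∧≢⇒< (Fₚ.punchIn-cancel-≤ x y z (ℕₚ.<⇒≤ lt))
    (λ e → Fₚ.<⇒≢ lt (cong (punchIn x) e))

  punchIn<⇒< : (x : Fin (suc n)) (y : Fin n) → punchIn x y < x → toℕ y ℕ.< toℕ x
  punchIn<⇒< x y lt with toℕ x ℕₚ.≤? toℕ y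
  ... | no  x≰y = ℕₚ.≰⇒> x≰y
  ... | yes x≤y = contradiction
    (ℕₚ.<-trans (ℕₚ.≤-<-trans x≤y (ℕₚ.n<1+n _)) (subst (ℕ._< toℕ x) (toℕ-punchIn-≥ x y x≤y) lt))
        (ℕₚ.<-irrefl refl)

  <punchIn⇒≤ : (x : Fin (suc n)) (y : Fin n) → x < punchIn x y → toℕ x ℕ.≤ toℕ y
  <punchIn⇒≤ x y lt with toℕ x ℕₚ.≤? toℕ y
  ... | yes x≤y = x≤y
  ... | no  x≰y = contradiction
    (ℕₚ.<-trans (subst (toℕ x ℕ.<_) (toℕ-punchIn-< x y (ℕₚ.≰⇒> x≰y)) lt) (ℕₚ.≰⇒> x≰y))
        (ℕₚ.<-irrefl refl)

  cons-word : Fin (suc n) → 𝒮 n → Vec.Vec (Fin (suc n)) (suc n)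
  cons-word x σ = x Vec.∷ Vec.map (punchIn x) (word σ)

  cons-injective : (x : Fin (suc n)) (σ : 𝒮 n) → Injective _≡_ _≡_ (Vec.lookup (cons-word x σ))
  cons-injective x σ {fzero}  {fzero}  _ = refl
  cons-injective x σ {fzero}  {fsuc j} e =
    contradiction (sym (trans e (Vecₚ.lookup-map j (punchIn x) (word σ)))) (Fₚ.punchInᵢ≢i x _)
  cons-injective x σ {fsuc i} {fzero}  e =
    contradiction (trans (sym (Vecₚ.lookup-map i (punchIn x) (word σ))) e) (Fₚ.punchInᵢ≢i x _)
  cons-injective x σ {fsuc i} {fsuc j} e = cong fsuc (⟨⟩-injective σ (Fₚ.punchIn-injective x _ _
    (trans (sym (Vecₚ.lookup-map i (punchIn x) (word σ))) (trans e (Vecₚ.lookup-map j (punchIn x)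
        (word σ))))))

  cons : Fin (suc n) → 𝒮 n → 𝒮 (suc n)
  cons x σ = perm (cons-word x σ) (cons-injective x σ)

  cons-⟨fsuc⟩ : (x : Fin (suc n)) (σ : 𝒮 n) (i : Fin n) → cons x σ ⟨ fsuc i ⟩ ≡ punchIn x (σ ⟨ i ⟩)
  cons-⟨fsuc⟩ x σ i = Vecₚ.lookup-map i (punchIn x) (word σ)

  module _ (x : Fin (suc n)) (σ : 𝒮 n) where
    cons-<⁺ : ∀ {i j} → σ ⟨ i ⟩ < σ ⟨ j ⟩ → cons x σ ⟨ fsuc i ⟩ < cons x σ ⟨ fsuc j ⟩
    cons-<⁺ {i} {j} lt = subst₂ _<_ (sym (cons-⟨fsuc⟩ x σ i)) (sym (cons-⟨fsuc⟩ x σ j)) (punchIn-< x lt)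

    cons-<⁻ : ∀ {i j} → cons x σ ⟨ fsuc i ⟩ < cons x σ ⟨ fsuc j ⟩ → σ ⟨ i ⟩ < σ ⟨ j ⟩
    cons-<⁻ {i} {j} lt = punchIn-<⁻ x (subst₂ _<_ (cons-⟨fsuc⟩ x σ i) (cons-⟨fsuc⟩ x σ j) lt)

    cons-<head⁻ : ∀ {i} → cons x σ ⟨ fsuc i ⟩ < x → toℕ (σ ⟨ i ⟩) ℕ.< toℕ x
    cons-<head⁻ {i} lt = punchIn<⇒< x _ (subst (_< x) (cons-⟨fsuc⟩ x σ i) lt)

    cons-<head⁺ : ∀ {i} → toℕ (σ ⟨ i ⟩) ℕ.< toℕ x → cons x σ ⟨ fsuc i ⟩ < x
    cons-<head⁺ {i} lt = subst (_< x) (sym (cons-⟨fsuc⟩ x σ i))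
      (subst (ℕ._< toℕ x) (sym (toℕ-punchIn-< x _ lt)) lt)

    head<cons⁻ : ∀ {i} → x < cons x σ ⟨ fsuc i ⟩ → toℕ x ℕ.≤ toℕ (σ ⟨ i ⟩)
    head<cons⁻ {i} lt = <punchIn⇒≤ x _ (subst (x <_) (cons-⟨fsuc⟩ x σ i) lt)

    head<cons⁺ : ∀ {i} → toℕ x ℕ.≤ toℕ (σ ⟨ i ⟩) → x < cons x σ ⟨ fsuc i ⟩
    head<cons⁺ {i} le = subst (x <_) (sym (cons-⟨fsuc⟩ x σ i))
      (subst (toℕ x ℕ.<_) (sym (toℕ-punchIn-≥ x _ le)) (s≤s le))

  rest : 𝒮 (suc n) → 𝒮 n
  rest {n} σ = pat (interval 1 n ℕₚ.≤-refl) σ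

  at-rest : (i : Fin n) → at (interval {suc n} 1 n ℕₚ.≤-refl) i ≡ fsuc i
  at-rest i = Fₚ.toℕ-injective (toℕ-at-interval 1 ℕₚ.≤-refl i)

  rest-<⁻ : (σ : 𝒮 (suc n)) {i j : Fin n} → rest σ ⟨ i ⟩ < rest σ ⟨ j ⟩ → σ ⟨ fsuc i ⟩ < σ ⟨ fsuc j ⟩
  rest-<⁻ {n} σ {i} {j} lt = subst₂ (λ a b → σ ⟨ a ⟩ < σ ⟨ b ⟩) (at-rest i) (at-rest j)
    (pat-<⁻ (interval 1 n ℕₚ.≤-refl) σ lt)

  rest-cons : (x : Fin (suc n)) (σ : 𝒮 n) → rest (cons x σ) ≡ σ
  rest-cons x σ = order-ext _ σ λ a b lt → cons-<⁻ x σ (rest-<⁻ (cons x σ) lt)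

  -- With `rest-cons` this makes head and standardised tail free coordinates on permutations;
  -- avoidance then only limits the head in terms of the tail.
  cons-rest : (σ : 𝒮 (suc n)) → cons (σ ⟨ fzero ⟩) (rest σ) ≡ σ
  cons-rest {n} σ = sym (order-ext σ _ order)
    where
    x = σ ⟨ fzero ⟩
    τ = rest σ
    keep : ∀ {i j} → σ ⟨ fsuc i ⟩ < σ ⟨ fsuc j ⟩ → τ ⟨ i ⟩ < τ ⟨ j ⟩
    keep {i} {j} lt = pat-<⁺ (interval 1 n ℕₚ.≤-refl) σ
      (subst₂ (λ a b → σ ⟨ a ⟩ < σ ⟨ b ⟩) (sym (at-rest i)) (sym (at-rest j)) lt)
    τ′ : Fin n → Fin n
    τ′ i = punchOut {i = x} {j = σ ⟨ fsuc i ⟩} (λ e → contradiction (⟨⟩-injective σ e) λ ())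
    -- σ without its head, values lowered past the head, is order isomorphic to rest σ.
    lowered : 𝒮 n
    lowered = perm (Vec.tabulate τ′) λ {i} {j} e → Fₚ.suc-injective (⟨⟩-injective σ
      (Fₚ.punchOut-injective {i = x} _ _ (trans (sym (Vecₚ.lookup∘tabulate τ′ i))
          (trans e (Vecₚ.lookup∘tabulate τ′ j)))))
    lowered-spec : ∀ i → punchIn x (lowered ⟨ i ⟩) ≡ σ ⟨ fsuc i ⟩
    lowered-spec i = trans (cong (punchIn x) (Vecₚ.lookup∘tabulate τ′ i)) (Fₚ.punchIn-punchOut {i = x}
        _)
    lowered≡τ : lowered ≡ τ
    lowered≡τ = order-ext lowered τ λ a b lt → keep
      (subst₂ _<_ (lowered-spec a) (lowered-spec b) (punchIn-< x lt))
    cons-spec : ∀ i → cons x τ ⟨ fsuc i ⟩ ≡ σ ⟨ fsuc i ⟩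
    cons-spec i = trans (cons-⟨fsuc⟩ x τ i) (trans (cong (λ ρ → punchIn x (ρ ⟨ i ⟩)) (sym lowered≡τ))
        (lowered-spec i))
    order : ∀ a b → σ ⟨ a ⟩ < σ ⟨ b ⟩ → cons x τ ⟨ a ⟩ < cons x τ ⟨ b ⟩
    order fzero    fzero    lt = lt
    order fzero    (fsuc b) lt = subst (x <_) (sym (cons-spec b)) lt
    order (fsuc a) fzero    lt = subst (_< x) (sym (cons-spec a)) lt
    order (fsuc a) (fsuc b) lt = subst₂ _<_ (sym (cons-spec a)) (sym (cons-spec b)) lt

  -- The largest value that can be prepended to σ without creating a 312.
  bound : 𝒮 n → ℕ
  bound {zero}  σ = 0
  bound {suc n} σ = suc (toℕ (σ ⟨ fzero ⟩))

  -- A new 312 has the head as its 3. If its 1 is the old first entry, no value is left for its 2;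
  -- otherwise the old first entry can replace the head, which gives a 312 in `σ`.
  cons-no312 : (x : Fin (suc n)) (σ : 𝒮 n) → No312 σ → toℕ x ℕ.≤ bound σ → No312 (cons x σ)
  cons-no312 x σ free x≤ {fsuc i} {fsuc j} {fsuc l} (s≤s i<j) (s≤s j<l) p q = free i<j j<l
      (cons-<⁻ x σ p) (cons-<⁻ x σ q)
  cons-no312 x σ free x≤ {fzero} {fsuc fzero}    {fsuc fzero}    i<j (s≤s ()) p q
  cons-no312 x σ free x≤ {fzero} {fsuc (fsuc _)} {fsuc fzero}    i<j (s≤s ()) p q
  cons-no312 x σ free x≤ {fzero} {fsuc fzero}    {fsuc (fsuc l)} i<j j<l p q =
    ℕₚ.<-irrefl refl (ℕₚ.<-≤-trans (cons-<⁻ x σ {fzero} {fsuc l} p)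
      (ℕ.s≤s⁻¹ (ℕₚ.<-≤-trans (cons-<head⁻ x σ {fsuc l} q) x≤)))
  cons-no312 x σ free x≤ {fzero} {fsuc (fsuc j)} {fsuc (fsuc l)} i<j (s≤s j<l) p q =
    free {fzero} {fsuc j} {fsuc l} (s≤s z≤n) j<l (cons-<⁻ x σ {fsuc j} {fsuc l} p)
      (Fₚ.≤∧≢⇒< (ℕ.s≤s⁻¹ (ℕₚ.<-≤-trans (cons-<head⁻ x σ {fsuc l} q) x≤))
        λ e → contradiction (⟨⟩-injective σ e) λ ())

  -- Otherwise the head, the second entry and the entry one above the second
  -- form a 312.
  no312⇒≤bound : (x : Fin (suc n)) (σ : 𝒮 n) → No312 (cons x σ) → toℕ x ℕ.≤ bound σ
  no312⇒≤bound {zero}  fzero σ free = z≤n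
  no312⇒≤bound {suc n} x     σ free with toℕ x ℕₚ.≤? bound σ
  ... | yes p = p
  ... | no ¬p = contradiction (free {fzero} {fsuc fzero} {fsuc l} (s≤s z≤n) (s≤s (l>0 l σl))
          (cons-<⁺ x σ {fzero} {l} (subst (toℕ (σ ⟨ fzero ⟩) ℕ.<_) (sym σl) (ℕₚ.n<1+n _)))
          (cons-<head⁺ x σ {l} (subst (ℕ._< toℕ x) (sym σl) (ℕₚ.≰⇒> ¬p)))) λ ()
    where
    v = suc (toℕ (σ ⟨ fzero ⟩))
    v<n : v ℕ.< suc n
    v<n = ℕₚ.<-≤-trans (ℕₚ.≰⇒> ¬p) (ℕ.s≤s⁻¹ (Fₚ.toℕ<n x))
    l = proj₁ (⟨⟩-surjective σ (fromℕ< v<n))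
    σl : toℕ (σ ⟨ l ⟩) ≡ v
    σl = trans (cong toℕ (proj₂ (⟨⟩-surjective σ (fromℕ< v<n)))) (Fₚ.toℕ-fromℕ< v<n)
    l>0 : ∀ l → toℕ (σ ⟨ l ⟩) ≡ v → 0 ℕ.< toℕ l
    l>0 fzero    e = contradiction (sym e) ℕₚ.1+n≢n
    l>0 (fsuc l) e = s≤s z≤n

  window : (w : ℕ) → .(w ℕ.≤ n) → 𝒮 n → 𝒮 w
  window w p = pat (interval 0 w p)

  -- It is enough that `x` cuts the entries of the window at the same height as `x₀` cuts their
  -- ranks.
  window-cons-order : (x : Fin (suc n)) (σ : 𝒮 n) (x₀ : Fin (suc w)) .(p : w ℕ.≤ n) →
    (∀ b → toℕ x ℕ.≤ toℕ (σ ⟨ at (interval 0 w p) b ⟩) → toℕ x₀ ℕ.≤ toℕ (window w p σ ⟨ b ⟩)) →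
    (∀ a → toℕ (σ ⟨ at (interval 0 w p) a ⟩) ℕ.< toℕ x → toℕ (window w p σ ⟨ a ⟩) ℕ.< toℕ x₀) →
    window (suc w) (s≤s p) (cons x σ) ≡ cons x₀ (window w p σ)
  window-cons-order {n} {w} x σ x₀ p f g = order-ext _ _ order
    where
    I = interval {suc n} 0 (suc w) (s≤s p)
    τ = window w p σ
    order : ∀ a b → window (suc w) (s≤s p) (cons x σ) ⟨ a ⟩ < window (suc w) (s≤s p) (cons x σ) ⟨ b ⟩ →
            cons x₀ τ ⟨ a ⟩ < cons x₀ τ ⟨ b ⟩
    order fzero    fzero    lt = contradiction lt (Fₚ.<-irrefl refl)
    order fzero    (fsuc b) lt = head<cons⁺ x₀ τ {b}
        (f b (head<cons⁻ x σ (pat-<⁻ I (cons x σ) {fzero} {fsuc b} lt)))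
    order (fsuc a) fzero    lt = cons-<head⁺ x₀ τ {a}
        (g a (cons-<head⁻ x σ (pat-<⁻ I (cons x σ) {fsuc a} {fzero} lt)))
    order (fsuc a) (fsuc b) lt = cons-<⁺ x₀ τ {a} {b} (pat-<⁺ (interval 0 w p) σ
      (cons-<⁻ x σ (pat-<⁻ I (cons x σ) {fsuc a} {fsuc b} lt)))

  window-cons-0 : (σ : 𝒮 n) .(p : w ℕ.≤ n) →
    window (suc w) (s≤s p) (cons fzero σ) ≡ cons fzero (window w p σ)
  window-cons-0 σ p = window-cons-order fzero σ fzero p (λ _ _ → z≤n) (λ _ ())

  -- The value x₀ = 1 + τ(p) is realised just above the p-th value of σ.
  extend : (σ : 𝒮 n) .(p : w ℕ.≤ n) (x₀ : Fin (suc w)) → toℕ x₀ ℕ.≤ bound (window w p σ) →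
    ∃[ x ] (toℕ x ℕ.≤ bound σ × window (suc w) (s≤s p) (cons x σ) ≡ cons x₀ (window w p σ))
  extend σ p fzero _ = fzero , z≤n , window-cons-0 σ p
  extend {zero}  {suc w} σ p (fsuc y) _ = ⊥-elim (no-room p)
    where
    no-room : .(suc w ℕ.≤ 0) → ⊥
    no-room ()
  extend {suc n} {suc w} σ p (fsuc y) y≤ = fsuc (σ ⟨ at I i ⟩) , s≤s bounded′ ,
    window-cons-order (fsuc (σ ⟨ at I i ⟩)) σ (fsuc y) p
      (λ b lt → subst (λ z → toℕ z ℕ.< toℕ (τ ⟨ b ⟩)) τi (pat-<⁺ I σ {i} {b} lt))
      (λ a le → s≤s (ℕₚ.≮⇒≥ λ lt → ℕₚ.≤⇒≯ (ℕ.s≤s⁻¹ le)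
        (pat-<⁻ I σ {i} {a} (subst (λ z → toℕ z ℕ.< toℕ (τ ⟨ a ⟩)) (sym τi) lt))))
    where
    I = interval {suc n} 0 (suc w) p
    τ = window (suc w) p σ
    i = proj₁ (⟨⟩-surjective τ y)
    τi : τ ⟨ i ⟩ ≡ y
    τi = proj₂ (⟨⟩-surjective τ y)
    -- The bound on `suc y` says `y ≤ τ(0)`; the window starts at the first entry of `σ`, so the
    -- same comparison holds in `σ` and the new head stays admissible.
    bounded′ : toℕ (σ ⟨ at I i ⟩) ℕ.≤ toℕ (σ ⟨ fzero ⟩)
    bounded′ = ℕₚ.≮⇒≥ λ lt → ℕₚ.≤⇒≯ (ℕ.s≤s⁻¹ y≤)
      (subst (λ z → toℕ (τ ⟨ fzero ⟩) ℕ.< toℕ z) τi (pat-<⁺ I σ {fzero} {i} lt))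

-- Enumeration of the avoiders and the Catalan numbers

module Enumeration where

  open Permutations
  open import Data.Nat.Combinatorics using (_C_; nCk≡nC[n∸k]; nCk+nC[k+1]≡[n+1]C[k+1]; nC1≡n; k>n⇒nCk≡0)
  open import Data.Nat.Solver using (module +-*-Solver)

  private
    variable
      w m n : ℕ

  𝒜 : ℕ → Set
  𝒜 = Av ⟦312⟧

  𝒜-cong : {σ τ : 𝒜 n} → underlying σ ≡ underlying τ → σ ≡ τ
  𝒜-cong {σ = av _ _} {av _ _} refl = refl

  no312 : (σ : 𝒜 n) → No312 (underlying σ)
  no312 (av σ avoids) i<j j<l p q = ⊥-elim-irr (avoids⇒no312 σ avoids i<j j<l p q)

  head : 𝒜 (suc n) → Fin (suc n)
  head σ = underlying σ ⟨ fzero ⟩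

  -- The same interval as in the overlap graph, whose bound is irrelevant: the target of an edge is
  -- its `tail` by computation.
  tail : 𝒜 (suc n) → 𝒜 n
  tail {n} = patᴬ (interval 1 n ℕₚ.≤-refl)

  boundᴬ : 𝒜 n → ℕ
  boundᴬ σ = bound (underlying σ)

  consᴬ : (x : Fin (suc n)) (σ : 𝒜 n) → toℕ x ℕ.≤ boundᴬ σ → 𝒜 (suc n)
  consᴬ x σ x≤ = av (cons x (underlying σ)) (no312⇒avoids (cons x (underlying σ))
      (cons-no312 x (underlying σ) (no312 σ) x≤))

  tail-consᴬ : (x : Fin (suc n)) (σ : 𝒜 n) (x≤ : toℕ x ℕ.≤ boundᴬ σ) → tail (consᴬ x σ x≤) ≡ σ
  tail-consᴬ x σ x≤ = 𝒜-cong (rest-cons x (underlying σ))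

  head≤bound : (σ : 𝒜 (suc n)) → toℕ (head σ) ℕ.≤ boundᴬ (tail σ)
  head≤bound σ = no312⇒≤bound (head σ) (rest (underlying σ))
      (subst No312 (sym (cons-rest (underlying σ))) (no312 σ))

  consᴬ-tail : (σ : 𝒜 (suc n)) → consᴬ (head σ) (tail σ) (head≤bound σ) ≡ σ
  consᴬ-tail σ = 𝒜-cong (cons-rest (underlying σ))

  consᴬ-cong : {x y : Fin (suc n)} (σ : 𝒜 n) (x≤ : toℕ x ℕ.≤ boundᴬ σ) (y≤ : toℕ y ℕ.≤ boundᴬ σ) →
               toℕ x ≡ toℕ y → consᴬ x σ x≤ ≡ consᴬ y σ y≤
  consᴬ-cong σ x≤ y≤ e = 𝒜-cong (cong (λ x → cons x (underlying σ)) (Fₚ.toℕ-injective e))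

  cons₀ : 𝒜 n → 𝒜 (suc n)
  cons₀ σ = consᴬ fzero σ z≤n

  ε : 𝒮 0
  ε = perm [] λ { {()} }

  empty : 𝒜 0
  empty = av ε (no312⇒avoids ε λ { {()} })

  -- Enumeration by the first value

  bound≤n : (σ : 𝒮 n) → bound σ ℕ.≤ n
  bound≤n {zero}  σ = z≤n
  bound≤n {suc n} σ = Fₚ.toℕ<n (σ ⟨ fzero ⟩)

  module _ (σ : 𝒜 n) where

    index : ∀ {m} → m ℕ.< boundᴬ σ → Fin (suc n)
    index m<b = fsuc (fromℕ< (ℕₚ.<-≤-trans m<b (bound≤n (underlying σ))))

    toℕ-index : ∀ {m} (m<b : m ℕ.< boundᴬ σ) → toℕ (index m<b) ≡ suc m
    toℕ-index m<b = cong suc (Fₚ.toℕ-fromℕ< _)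

    index≤bound : ∀ {m} (m<b : m ℕ.< boundᴬ σ) → toℕ (index m<b) ℕ.≤ boundᴬ σ
    index≤bound m<b = subst (ℕ._≤ boundᴬ σ) (sym (toℕ-index m<b)) m<b

    cons₊ : ∀ {m} → m ℕ.< boundᴬ σ → 𝒜 (suc n)
    cons₊ m<b = consᴬ (index m<b) σ (index≤bound m<b)

    -- Heads from `m` down to 1. Head 0 is always admissible and is treated apart by `cons₀`.
    children : ∀ m → m ℕ.≤ boundᴬ σ → List (𝒜 (suc n))
    children zero    _   = []
    children (suc m) m<b = cons₊ m<b ∷ children m (ℕₚ.<⇒≤ m<b)

    ∈-children⁻ : ∀ m (m≤b : m ℕ.≤ boundᴬ σ) {π} → π ∈ children m m≤b →
                  0 ℕ.< toℕ (head π) × toℕ (head π) ℕ.≤ m × tail π ≡ σ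
    ∈-children⁻ (suc m) m<b (here refl) =
      subst (0 ℕ.<_) (sym (toℕ-index m<b)) (s≤s z≤n) , ℕₚ.≤-reflexive (toℕ-index m<b) , tail-consᴬ
          (index m<b) σ (index≤bound m<b)
    ∈-children⁻ (suc m) m<b (there i) =
      let 0<h , h≤m , e = ∈-children⁻ m (ℕₚ.<⇒≤ m<b) i in 0<h , ℕₚ.m≤n⇒m≤1+n h≤m , e

    ∈-children⁺ : ∀ m (m≤b : m ℕ.≤ boundᴬ σ) x x≤ → 0 ℕ.< toℕ x → toℕ x ℕ.≤ m → consᴬ x σ x≤ ∈ children
        m m≤b
    ∈-children⁺ zero    _   x x≤ 0<x x≤m = contradiction (ℕₚ.<-≤-trans 0<x x≤m) λ ()
    ∈-children⁺ (suc m) m<b x x≤ 0<x x≤m = case (ℕₚ.m≤n⇒m<n∨m≡n x≤m)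
      where
      case : toℕ x ℕ.< suc m ⊎ toℕ x ≡ suc m → consᴬ x σ x≤ ∈ children (suc m) m<b
      case (inj₁ x≤m) = there (∈-children⁺ m (ℕₚ.<⇒≤ m<b) x x≤ 0<x (ℕ.s≤s⁻¹ x≤m))
      case (inj₂ e)   = here (consᴬ-cong σ x≤ (index≤bound m<b) (trans e (sym (toℕ-index m<b))))

    children-unique : ∀ m (m≤b : m ℕ.≤ boundᴬ σ) → Unique (children m m≤b)
    children-unique zero    _   = []
    children-unique (suc m) m<b = All.tabulate (λ {π} i e → ℕₚ.<-irrefl refl (ℕₚ.≤-<-trans
        (subst (λ ρ → suc m ℕ.≤ toℕ (head ρ)) e (ℕₚ.≤-reflexive (sym (toℕ-index m<b))))
        (s≤s (proj₁ (proj₂ (∈-children⁻ m (ℕₚ.<⇒≤ m<b) i))))))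
      ∷ children-unique m (ℕₚ.<⇒≤ m<b)

    allChildren : List (𝒜 (suc n))
    allChildren = children (boundᴬ σ) ℕₚ.≤-refl

  -- Avoiders whose first value is not the least. As edges they are the ones off the spanning tree,
  -- and they will index the basis of directions.
  headed : ∀ n → List (𝒜 (suc n))
  avoiders : ∀ n → List (𝒜 n)

  headed n = concat (map allChildren (avoiders n))

  avoiders zero    = empty ∷ []
  avoiders (suc n) = map cons₀ (avoiders n) ++ headed n

  ∈-headed⁻ : ∀ {π : 𝒜 (suc n)} → π ∈ headed n → 0 ℕ.< toℕ (head π)
  ∈-headed⁻ {n} i =
    let xs , i∈xs , xs∈ = ∈ₚ.∈-concat⁻′ (map allChildren (avoiders n)) i
        σ , _ , e       = ∈ₚ.∈-map⁻ allChildren xs∈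
    in proj₁ (∈-children⁻ σ (boundᴬ σ) ℕₚ.≤-refl (subst (_ ∈_) e i∈xs))

  avoiders-complete : ∀ n (σ : 𝒜 n) → σ ∈ avoiders n
  avoiders-complete zero    σ = here (𝒜-cong (order-ext (underlying σ) (underlying empty) λ ()))
  avoiders-complete (suc n) σ = subst (_∈ avoiders (suc n)) (consᴬ-tail σ) (go (head σ) (head≤bound σ))
    where
    τ = tail σ
    go : ∀ x x≤ → consᴬ x τ x≤ ∈ avoiders (suc n)
    go fzero    x≤ = ∈ₚ.∈-++⁺ˡ (subst (_∈ map cons₀ (avoiders n)) (consᴬ-cong τ z≤n x≤ refl)
      (∈ₚ.∈-map⁺ cons₀ (avoiders-complete n τ)))
    go (fsuc x) x≤ = ∈ₚ.∈-++⁺ʳ (map cons₀ (avoiders n))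
      (∈ₚ.∈-concat⁺′ (∈-children⁺ τ _ ℕₚ.≤-refl (fsuc x) x≤ (s≤s z≤n) x≤)
        (∈ₚ.∈-map⁺ allChildren (avoiders-complete n τ)))

  -- Children of distinct avoiders are disjoint because `tail` recovers the parent.
  headed-unique : ∀ n → Unique (avoiders n) → Unique (headed n)
  headed-unique n unique = Uniqueₚ.concat⁺
    (Allₚ.map⁺ (All.tabulate λ {σ} _ → children-unique σ _ _))
    (AllPairsₚ.map⁺ (AllPairs.map (λ {σ} {τ} σ≢τ {π} (i , i′) → σ≢τ
      (trans (sym (proj₂ (proj₂ (∈-children⁻ σ _ _ i)))) (proj₂ (proj₂ (∈-children⁻ τ _ _ i′)))))
          unique))

  avoiders-unique : ∀ n → Unique (avoiders n)
  avoiders-unique zero    = [] ∷ []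
  avoiders-unique (suc n) = Uniqueₚ.++⁺
    (Uniqueₚ.map⁺ (λ {σ} {τ} e → trans (sym (tail-consᴬ fzero σ z≤n)) (trans (cong tail e)
        (tail-consᴬ fzero τ z≤n)))
      (avoiders-unique n))
    (headed-unique n (avoiders-unique n))
    λ { (i , j) → let σ , _ , e = ∈ₚ.∈-map⁻ cons₀ i in
        ℕₚ.<-irrefl refl (subst (λ π → 0 ℕ.< toℕ (head π)) e (∈-headed⁻ j)) }

  -- Counting

  -- T r s counts the ways to prepend r values to an avoider σ with bound σ = s.
  T : ℕ → ℕ → ℕ
  T zero    s       = 1
  T (suc r) zero    = T r 1
  T (suc r) (suc s) = T (suc r) s + T r (suc (suc s))
    where open import Data.Nat.Base using (_+_)

  weight : ∀ r → List (𝒜 n) → ℕ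
  weight r xs = sum (map (T r ∘ boundᴬ) xs)

  module _ where
    open import Data.Nat.Base using (_+_; _*_; _∸_)
    open ≡-Reasoning
    open +-*-Solver using (solve; _:=_; _:+_; _:*_; con)

    weight-++ : ∀ r (xs ys : List (𝒜 n)) → weight r (xs ++ ys) ≡ weight r xs + weight r ys
    weight-++ r xs ys = trans (cong sum (Listₚ.map-++ (T r ∘ boundᴬ) xs ys))
        (sum-++ (map (T r ∘ boundᴬ) xs) _)

    -- `T (suc r) m` unrolls to `T r 1 + ... + T r (suc m)`, and a child with head `x` has bound
    -- `suc x`. The separate summand `T r 1` belongs to the child with head 0.
    weight-children : ∀ r (σ : 𝒜 n) m (m≤b : m ℕ.≤ boundᴬ σ) → T r 1 + weight r (children σ m m≤b) ≡ T
        (suc r) m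
    weight-children r σ zero    _   = ℕₚ.+-identityʳ _
    weight-children r σ (suc m) m<b = begin
      T r 1 + (T r (boundᴬ (cons₊ σ m<b)) + W)  ≡⟨ solve 3 (λ a b c → a :+ (b :+ c) := (a :+ c) :+ b)
          refl (T r 1) _ W ⟩
      (T r 1 + W) + T r (boundᴬ (cons₊ σ m<b))  ≡⟨ cong₂ _+_ (weight-children r σ m _)
          (cong (T r ∘ suc) (toℕ-index σ m<b)) ⟩
      T (suc r) m + T r (suc (suc m))           ∎
      where W = weight r (children σ m (ℕₚ.<⇒≤ m<b))

    weight-step : ∀ r (xs : List (𝒜 n)) →
                  weight r (map cons₀ xs ++ concat (map allChildren xs)) ≡ weight (suc r) xs
    weight-step r xs = trans (weight-++ r (map cons₀ xs) _) (go xs)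
      where
      go : ∀ xs → weight r (map cons₀ xs) + weight r (concat (map allChildren xs)) ≡ weight (suc r) xs
      go []       = refl
      go (σ ∷ xs) = begin
        (T r 1 + A) + weight r (allChildren σ ++ concat (map allChildren xs))
          ≡⟨ cong (T r 1 + A +_) (weight-++ r (allChildren σ) _) ⟩
        (T r 1 + A) + (B + C)
          ≡⟨ solve 4 (λ t a b c → (t :+ a) :+ (b :+ c) := (t :+ b) :+ (a :+ c)) refl (T r 1) A B C ⟩
        (T r 1 + B) + (A + C)
          ≡⟨ cong₂ _+_ (weight-children r σ _ ℕₚ.≤-refl) (go xs) ⟩
        weight (suc r) (σ ∷ xs) ∎
        where
        A = weight r (map cons₀ xs)
        B = weight r (allChildren σ)
        C = weight r (concat (map allChildren xs))

    -- Enlarging the avoiders by one value uses up one of the remaining `r` steps, so `n + r` is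
    -- invariant down to the empty permutation, whose bound is 0.
    weight-avoiders : ∀ r n → weight r (avoiders n) ≡ T (n + r) 0
    weight-avoiders r zero    = ℕₚ.+-identityʳ _
    weight-avoiders r (suc n) = begin
      weight r (avoiders (suc n)) ≡⟨ weight-step r (avoiders n) ⟩
      weight (suc r) (avoiders n) ≡⟨ weight-avoiders (suc r) n ⟩
      T (n + suc r) 0             ≡⟨ cong (λ k → T k 0) (ℕₚ.+-suc n r) ⟩
      T (suc n + r) 0             ∎

    length≡weight : (xs : List (𝒜 n)) → length xs ≡ weight 0 xs
    length≡weight []       = refl
    length≡weight (x ∷ xs) = cong suc (length≡weight xs)

    -- N C (r - 1), read as 0 at r = 0
    _C₋_ : ℕ → ℕ → ℕ
    N C₋ zero  = 0
    N C₋ suc r = N C r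

    pascal : ∀ N r → N C₋ r + N C r ≡ suc N C r
    pascal N zero    = refl
    pascal N (suc r) = nCk+nC[k+1]≡[n+1]C[k+1] N r

    central : ∀ r → suc (2 * r) C r ≡ suc (2 * r) C suc r
    central r = begin
      N C r           ≡⟨ nCk≡nC[n∸k] {r} {N} (ℕₚ.≤-trans (ℕₚ.m≤m+n r _) (ℕₚ.n≤1+n _)) ⟩
      N C (N ∸ r)     ≡⟨ cong (λ k → N C (k ∸ r)) (solve 1 (λ r → con 1 :+ con 2 :* r := r :+
          (con 1 :+ r)) refl r) ⟩
      N C (r + suc r ∸ r) ≡⟨ cong (N C_) (ℕₚ.m+n∸m≡n r (suc r)) ⟩
      N C suc r       ∎
      where N = suc (2 * r)

    -- The ballot formula, a difference of two neighbouring binomials, stated additively. The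
    -- recursion for `T` is Pascal's rule applied to both; at `s = 0` the symmetry of the odd row
    -- closes the induction.
    T-ballot : ∀ r s → T r s + (2 * r + s) C₋ r ≡ (2 * r + s) C r
    T-ballot zero    s       = refl
    T-ballot (suc r) zero    = begin
      T r 1 + (2 * suc r + 0) C r        ≡⟨ cong (λ k → T r 1 + k C r) N+1 ⟩
      T r 1 + suc N C r                  ≡⟨ cong (T r 1 +_) (sym (pascal N r)) ⟩
      T r 1 + (N C₋ r + N C r)           ≡⟨ sym (ℕₚ.+-assoc (T r 1) _ _) ⟩
      (T r 1 + N C₋ r) + N C r           ≡⟨ cong (λ k → (T r 1 + k C₋ r) + N C r) (ℕₚ.+-comm 1 (2 * r))
          ⟩
      (T r 1 + (2 * r + 1) C₋ r) + N C r ≡⟨ cong (_+ N C r) (T-ballot r 1) ⟩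
      (2 * r + 1) C r + N C r            ≡⟨ cong (λ k → k C r + N C r) (ℕₚ.+-comm (2 * r) 1) ⟩
      N C r + N C r                      ≡⟨ cong (N C r +_) (central r) ⟩
      N C r + N C suc r                  ≡⟨ pascal N (suc r) ⟩
      suc N C suc r                      ≡⟨ cong (_C suc r) (sym N+1) ⟩
      (2 * suc r + 0) C suc r            ∎
      where
      N = suc (2 * r)
      N+1 : 2 * suc r + 0 ≡ suc N
      N+1 = solve 1 (λ r → con 2 :* (con 1 :+ r) :+ con 0 := con 1 :+ (con 1 :+ con 2 :* r)) refl r
    T-ballot (suc r) (suc s) = begin
      (T (suc r) s + T r (2 + s)) + (2 * suc r + suc s) C r
        ≡⟨ cong (λ k → (T (suc r) s + T r (2 + s)) + k C r) (ℕₚ.+-suc (2 * suc r) s) ⟩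
      (T (suc r) s + T r (2 + s)) + suc N C r
        ≡⟨ cong (T (suc r) s + T r (2 + s) +_) (sym (pascal N r)) ⟩
      (T (suc r) s + T r (2 + s)) + (N C₋ r + N C r)
        ≡⟨ solve 4 (λ a b c d → (a :+ b) :+ (c :+ d) := (b :+ c) :+ (a :+ d)) refl (T (suc r) s) _ _ _ ⟩
      (T r (2 + s) + N C₋ r) + (T (suc r) s + N C r)
        ≡⟨ cong₂ _+_ (cong (λ k → T r (2 + s) + k C₋ r) N≡) refl ⟩
      (T r (2 + s) + (2 * r + (2 + s)) C₋ r) + (T (suc r) s + N C r)
        ≡⟨ cong₂ _+_ (T-ballot r (2 + s)) (T-ballot (suc r) s) ⟩
      (2 * r + (2 + s)) C r + N C suc r
        ≡⟨ cong (λ k → k C r + N C suc r) (sym N≡) ⟩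
      N C r + N C suc r
        ≡⟨ pascal N (suc r) ⟩
      suc N C suc r
        ≡⟨ cong (_C suc r) (sym (ℕₚ.+-suc (2 * suc r) s)) ⟩
      (2 * suc r + suc s) C suc r ∎
      where
      N = 2 * suc r + s
      N≡ : N ≡ 2 * r + (2 + s)
      N≡ = solve 2 (λ r s → con 2 :* (con 1 :+ r) :+ s := con 2 :* r :+ (con 2 :+ s)) refl r s

    -- The identity of `(k + 1) C(n, k + 1)` and `(n - k) C(n, k)`, without truncated subtraction.
    absorption : ∀ n k → suc k * (n C suc k) + k * (n C k) ≡ n * (n C k)
    absorption zero    zero    = refl
    absorption zero    (suc k) = begin
      suc (suc k) * (0 C suc (suc k)) + suc k * (0 C suc k) ≡⟨ cong₂ (λ a b → suc (suc k) * a + suc k *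
          b) (k>n⇒nCk≡0 {0} {suc (suc k)} (s≤s z≤n)) (k>n⇒nCk≡0 {0} {suc k} (s≤s z≤n)) ⟩
      suc (suc k) * 0 + suc k * 0                       ≡⟨ solve 1 (λ k → (con 2 :+ k) :* con 0 :+
          (con 1 :+ k) :* con 0 := con 0) refl k ⟩
      0                                                 ∎
    absorption (suc n) zero    = begin
      1 * (suc n C 1) + 0     ≡⟨ ℕₚ.+-identityʳ _ ⟩
      1 * (suc n C 1)         ≡⟨ ℕₚ.*-identityˡ _ ⟩
      suc n C 1             ≡⟨ nC1≡n (suc n) ⟩
      suc n                 ≡⟨ sym (ℕₚ.*-identityʳ (suc n)) ⟩
      suc n * 1             ∎
    absorption (suc n) (suc k) = begin
      (2 + k) * (suc n C (2 + k)) + suc k * (suc n C suc k)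
        ≡⟨ cong₂ (λ x y → (2 + k) * x + suc k * y) (sym (pascal n (2 + k))) (sym (pascal n (suc k))) ⟩
      (2 + k) * (b + c) + suc k * (a + b)
        ≡⟨ solve 4 (λ k a b c → (con 2 :+ k) :* (b :+ c) :+ (con 1 :+ k) :* (a :+ b) :=
             ((con 2 :+ k) :* c :+ (con 1 :+ k) :* b) :+ ((con 1 :+ k) :* b :+ k :* a) :+ (a :+ b))
                 refl k a b c ⟩
      ((2 + k) * c + suc k * b) + (suc k * b + k * a) + (a + b)
        ≡⟨ cong₂ (λ x y → x + y + (a + b)) (absorption n (suc k)) (absorption n k) ⟩
      n * b + n * a + (a + b)
        ≡⟨ solve 3 (λ n a b → n :* b :+ n :* a :+ (a :+ b) := (con 1 :+ n) :* (a :+ b)) refl n a b ⟩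
      suc n * (a + b)
        ≡⟨ cong (suc n *_) (pascal n (suc k)) ⟩
      suc n * (suc n C suc k) ∎
      where
      a = n C k
      b = n C suc k
      c = n C (2 + k)

    -- Absorption at `k = n - 1` with a common summand cancelled. It turns the ballot difference at
    -- `s = 0` into the central coefficient divided by `suc n`.
    absorption-central : ∀ n → suc n * (2 * n) C₋ n ≡ n * ((2 * n) C n)
    absorption-central zero    = refl
    absorption-central (suc m) = ℕₚ.+-cancelʳ-≡ (m * X) (suc (suc m) * X) (suc m * (N C suc m)) (begin
      suc (suc m) * X + m * X       ≡⟨ solve 2 (λ m x → (con 2 :+ m) :* x :+ m :* x :=
          (con 2 :* (con 1 :+ m)) :* x) refl m X ⟩
      N * X                         ≡⟨ sym (absorption N m) ⟩
      suc m * (N C suc m) + m * X     ∎)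
      where
      N = 2 * suc m
      X = N C m

    T≡Catalan : ∀ n → T n 0 ≡ Catalan n
    T≡Catalan n = begin
      T n 0                   ≡⟨ sym (m*n/n≡m (T n 0) (suc n)) ⟩
      (T n 0 * suc n) / suc n ≡⟨ cong (_/ suc n) (ℕₚ.+-cancelʳ-≡ (n * (N C n)) (T n 0 * suc n) (N C n)
          eq) ⟩
      (N C n) / suc n         ∎
      where
      N = 2 * n
      ballot : T n 0 + N C₋ n ≡ N C n
      ballot = subst (λ k → T n 0 + k C₋ n ≡ k C n) (ℕₚ.+-identityʳ N) (T-ballot n 0)
      eq : T n 0 * suc n + n * (N C n) ≡ N C n + n * (N C n)
      eq = begin
        T n 0 * suc n + n * (N C n)        ≡⟨ cong (T n 0 * suc n +_) (sym (absorption-central n)) ⟩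
        T n 0 * suc n + suc n * N C₋ n   ≡⟨ solve 3 (λ t n c → t :* (con 1 :+ n) :+ (con 1 :+ n) :* c
            := (con 1 :+ n) :* (t :+ c)) refl (T n 0) n (N C₋ n) ⟩
        suc n * (T n 0 + N C₋ n)         ≡⟨ cong (suc n *_) ballot ⟩
        N C n + n * (N C n)                ∎

    length-avoiders : ∀ n → length (avoiders n) ≡ Catalan n
    length-avoiders n = begin
      length (avoiders n)   ≡⟨ length≡weight (avoiders n) ⟩
      weight 0 (avoiders n) ≡⟨ weight-avoiders 0 n ⟩
      T (n + 0) 0           ≡⟨ cong (λ k → T k 0) (ℕₚ.+-identityʳ n) ⟩
      T n 0                 ≡⟨ T≡Catalan n ⟩
      Catalan n             ∎

    length-headed : ∀ n → length (headed n) ≡ Catalan (suc n) ∸ Catalan n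
    length-headed n = begin
      length (headed n)
        ≡⟨ sym (ℕₚ.m+n∸m≡n (length (avoiders n)) _) ⟩
      length (avoiders n) + length (headed n) ∸ length (avoiders n)
        ≡⟨ cong₂ _∸_ total (length-avoiders n) ⟩
      Catalan (suc n) ∸ Catalan n ∎
      where
      total : length (avoiders n) + length (headed n) ≡ Catalan (suc n)
      total = begin
        length (avoiders n) + length (headed n)             ≡⟨ cong (_+ length (headed n))
            (sym (Listₚ.length-map cons₀ (avoiders n))) ⟩
        length (map cons₀ (avoiders n)) + length (headed n)
            ≡⟨ sym (Listₚ.length-++ (map cons₀ (avoiders n))) ⟩
        length (avoiders (suc n))                           ≡⟨ length-avoiders (suc n) ⟩
        Catalan (suc n)                                     ∎

-- Order and arithmetic of the Cauchy reals

module CauchySequences where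

  open ℤ using (+_; +<+)
  open import Data.Rational.Solver using () renaming (module +-*-Solver to ℚ-Solver)

  open ℚ-Solver using (solve; _:=_; _:+_; _:-_; _:*_; :-_; con)

  -- Rational inequalities

  0<1ℚ : 0ℚ ℚ.< 1ℚ
  0<1ℚ = ℚ.*<* (+<+ (s≤s z≤n))

  ≤-diff : ∀ {a b x y} → a ℚ.≤ b → x ℚ.- y ≡ a ℚ.- b → x ℚ.≤ y
  ≤-diff {a} {b} {x} {y} a≤b eq = begin
    x               ≡⟨ sym (sub-add x y) ⟩
    (x ℚ.- y) ℚ.+ y ≡⟨ cong (ℚ._+ y) eq ⟩
    (a ℚ.- b) ℚ.+ y ≤⟨ ℚₚ.+-monoˡ-≤ y (ℚₚ.+-monoˡ-≤ (ℚ.- b) a≤b) ⟩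
    (b ℚ.- b) ℚ.+ y ≡⟨ cong (ℚ._+ y) (ℚₚ.+-inverseʳ b) ⟩
    0ℚ ℚ.+ y        ≡⟨ ℚₚ.+-identityˡ y ⟩
    y               ∎
    where open ℚₚ.≤-Reasoning

  p≤∣p∣ : ∀ p → p ℚ.≤ ∣ p ∣
  p≤∣p∣ p with ℚₚ.≤-total 0ℚ p
  ... | inj₁ 0≤p = ℚₚ.≤-reflexive (sym (ℚₚ.0≤p⇒∣p∣≡p 0≤p))
  ... | inj₂ p≤0 = ℚₚ.≤-trans p≤0 (ℚₚ.0≤∣p∣ p)

  ∣-∣-comm : ∀ p q → ∣ p ℚ.- q ∣ ≡ ∣ q ℚ.- p ∣
  ∣-∣-comm p q = trans (sym (ℚₚ.∣-p∣≡∣p∣ (p ℚ.- q)))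
    (cong ∣_∣ (solve 2 (λ p q → :- (p :- q) := q :- p) refl p q))

  ∣-∣≤⇒≤+ : ∀ p q {ε} → ∣ p ℚ.- q ∣ ℚ.≤ ε → p ℚ.≤ q ℚ.+ ε
  ∣-∣≤⇒≤+ p q {ε} h = ≤-diff (ℚₚ.≤-trans (p≤∣p∣ (p ℚ.- q)) h)
    (solve 3 (λ p q ε → p :- (q :+ ε) := (p :- q) :- ε) refl p q ε)

  ∣-∣≤⇒≥+ : ∀ p q {ε} → ∣ p ℚ.- q ∣ ℚ.≤ ε → q ℚ.≤ p ℚ.+ ε
  ∣-∣≤⇒≥+ p q {ε} h = ∣-∣≤⇒≤+ q p (subst (ℚ._≤ ε) (∣-∣-comm p q) h)

  ≤+⇒∣-∣≤ : ∀ p q {ε} → p ℚ.≤ q ℚ.+ ε → q ℚ.≤ p ℚ.+ ε → ∣ p ℚ.- q ∣ ℚ.≤ ε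
  ≤+⇒∣-∣≤ p q {ε} h k with ℚₚ.∣p∣≡p∨∣p∣≡-p (p ℚ.- q)
  ... | inj₁ e = subst (ℚ._≤ ε) (sym e)
    (≤-diff h (solve 3 (λ p q ε → (p :- q) :- ε := p :- (q :+ ε)) refl p q ε))
  ... | inj₂ e = subst (ℚ._≤ ε) (sym e)
    (≤-diff k (solve 3 (λ p q ε → (:- (p :- q)) :- ε := q :- (p :+ ε)) refl p q ε))

  0≤*ℚ : ∀ {p q} → 0ℚ ℚ.≤ p → 0ℚ ℚ.≤ q → 0ℚ ℚ.≤ p ℚ.* q
  0≤*ℚ {p} {q} 0≤p 0≤q = ℚₚ.nonNegative⁻¹ (p ℚ.* q)
    ⦃ ℚₚ.nonNeg*nonNeg⇒nonNeg p ⦃ ℚ.nonNegative 0≤p ⦄ q ⦃ ℚ.nonNegative 0≤q ⦄ ⦄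

  *ℚ-monoˡ-≤ : ∀ r {p q} → 0ℚ ℚ.≤ r → p ℚ.≤ q → r ℚ.* p ℚ.≤ r ℚ.* q
  *ℚ-monoˡ-≤ r {p} {q} 0≤r = ℚₚ.*-monoˡ-≤-nonNeg r ⦃ ℚ.nonNegative 0≤r ⦄ {p} {q}

  inverse : ∀ {K} → 0ℚ ℚ.< K → Σ[ J ∈ ℚ ] (0ℚ ℚ.< J × K ℚ.* J ≡ 1ℚ)
  inverse {K} K>0 = ℚ.1/ K , ℚₚ.positive⁻¹ (ℚ.1/ K) ⦃ ℚₚ.1/pos⇒pos K ⦄ , ℚₚ.*-inverseʳ K
    where
    instance
      K-pos : ℚ.Positive K
      K-pos = ℚ.positive K>0
      K-nz : ℚ.NonZero K
      K-nz = ℚₚ.pos⇒nonZero K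

  0<*ℚ : ∀ {p q} → 0ℚ ℚ.< p → 0ℚ ℚ.< q → 0ℚ ℚ.< p ℚ.* q
  0<*ℚ {p} {q} 0<p 0<q = ℚₚ.positive⁻¹ (p ℚ.* q)
    ⦃ ℚₚ.pos*pos⇒pos p ⦃ ℚ.positive 0<p ⦄ q ⦃ ℚ.positive 0<q ⦄ ⦄

  ratio : ∀ {K ε} → 0ℚ ℚ.< K → 0ℚ ℚ.< ε → Σ[ δ ∈ ℚ ] (0ℚ ℚ.< δ × K ℚ.* δ ≡ ε)
  ratio {K} {ε} K>0 ε>0 with J , J>0 , KJ ← inverse K>0 =
    J ℚ.* ε , 0<*ℚ J>0 ε>0 ,
    trans (sym (ℚₚ.*-assoc K J ε)) (trans (cong (ℚ._* ε) KJ) (ℚₚ.*-identityˡ ε))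

  -- Minimum is nonexpansive; both the Cauchy property of `minᴿ` and its universal property rest on
  -- this.
  ⊓-+-≤ : ∀ a b c d {ε} → a ℚ.≤ c ℚ.+ ε → b ℚ.≤ d ℚ.+ ε → a ℚ.⊓ b ℚ.≤ (c ℚ.⊓ d) ℚ.+ ε
  ⊓-+-≤ a b c d {ε} h k with ℚₚ.⊓-sel c d
  ... | inj₁ e = subst (λ z → a ℚ.⊓ b ℚ.≤ z ℚ.+ ε) (sym e) (ℚₚ.≤-trans (ℚₚ.p⊓q≤p a b) h)
  ... | inj₂ e = subst (λ z → a ℚ.⊓ b ℚ.≤ z ℚ.+ ε) (sym e) (ℚₚ.≤-trans (ℚₚ.p⊓q≤q a b) k)

  -- Order on the reals

  private
    variable
      a b c d x y z : ℝ

  eventually-map : ∀ {P Q : ℕ → Set} → (∀ n → P n → Q n) → Eventually P → Eventually Q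
  eventually-map f (N , p) = N , λ {n} le → f n (p le)

  eventually-zip : ∀ {P Q R : ℕ → Set} → (∀ n → P n → Q n → R n) →
                   Eventually P → Eventually Q → Eventually R
  eventually-zip f (N , p) (M , q) = N ℕ.⊔ M , λ {n} le →
    f n (p (⊔-≤ˡ {N} {M} le)) (q (⊔-≤ʳ {N} {M} le))

  eventually-always : ∀ {P : ℕ → Set} → (∀ n → P n) → Eventually P
  eventually-always p = 0 , λ {n} _ → p n

  ≤ᴿ-trans : x ≤ᴿ y → y ≤ᴿ z → x ≤ᴿ z
  ≤ᴿ-trans {x} {y} {z} (mk≤ f) (mk≤ g) = mk≤ λ ε ε>0 →
    eventually-zip
      (λ n h k → ≤-diff (ℚₚ.+-mono-≤ h k)
        (trans (cong (λ e → seq x n ℚ.- (seq z n ℚ.+ e)) (sym (half+half ε)))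
          (solve 4 (λ x y z e → x :- (z :+ (e :+ e)) := (x :+ y) :- ((y :+ e) :+ (z :+ e))) refl
            (seq x n) (seq y n) (seq z n) (½ ℚ.* ε))))
      (f _ (half-pos ε>0)) (g _ (half-pos ε>0))

  +ᴿ-mono-≤ : a ≤ᴿ b → c ≤ᴿ d → a +ᴿ c ≤ᴿ b +ᴿ d
  +ᴿ-mono-≤ {a} {b} {c} {d} (mk≤ f) (mk≤ g) = mk≤ λ ε ε>0 →
    eventually-zip
      (λ n h k → ≤-diff (ℚₚ.+-mono-≤ h k)
        (trans (cong (λ e → (seq a n ℚ.+ seq c n) ℚ.- ((seq b n ℚ.+ seq d n) ℚ.+ e))
            (sym (half+half ε)))
          (solve 5 (λ a b c d e → (a :+ c) :- ((b :+ d) :+ (e :+ e)) := (a :+ c) :-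
              ((b :+ e) :+ (d :+ e))) refl
            (seq a n) (seq b n) (seq c n) (seq d n) (½ ℚ.* ε))))
      (f _ (half-pos ε>0)) (g _ (half-pos ε>0))

  -- An inequality follows from any other with the same difference of sides;
  -- the identity is checked termwise on the defining sequences.
  ≤ᴿ-diff : a ≤ᴿ b → (∀ n → seq x n ℚ.- seq y n ≡ seq a n ℚ.- seq b n) → x ≤ᴿ y
  ≤ᴿ-diff {a} {b} {x} {y} (mk≤ f) eq = mk≤ λ ε ε>0 → eventually-map
    (λ n h → ≤-diff h (trans
      (solve 3 (λ x y e → x :- (y :+ e) := (x :- y) :- e) refl (seq x n) (seq y n) ε)
      (trans (cong (ℚ._- ε) (eq n))
        (solve 3 (λ x y e → (x :- y) :- e := x :- (y :+ e)) refl (seq a n) (seq b n) ε))))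
    (f ε ε>0)

  ≤ᴿ-pointwise : (∀ n → seq x n ℚ.≤ seq y n) → x ≤ᴿ y
  ≤ᴿ-pointwise h = mk≤ λ ε ε>0 → eventually-always λ n →
    subst (ℚ._≤ _) (ℚₚ.+-identityʳ _) (ℚₚ.+-mono-≤ (h n) (ℚₚ.<⇒≤ ε>0))

  ≈⇒≤ : x ≈ᴿ y → x ≤ᴿ y
  ≈⇒≤ {x} {y} (mk≈ f) = mk≤ λ ε ε>0 → eventually-map (λ n → ∣-∣≤⇒≤+ (seq x n) (seq y n)) (f ε ε>0)

  ≈⇒≥ : x ≈ᴿ y → y ≤ᴿ x
  ≈⇒≥ {x} {y} (mk≈ f) = mk≤ λ ε ε>0 → eventually-map (λ n → ∣-∣≤⇒≥+ (seq x n) (seq y n)) (f ε ε>0)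

  ≤ᴿ-antisym : x ≤ᴿ y → y ≤ᴿ x → x ≈ᴿ y
  ≤ᴿ-antisym {x} {y} (mk≤ f) (mk≤ g) = mk≈ λ ε ε>0 → eventually-zip (λ n → ≤+⇒∣-∣≤ (seq x n) (seq y n))
      (f ε ε>0) (g ε ε>0)

  ≤ᴿ-refl : x ≤ᴿ x
  ≤ᴿ-refl = ≤ᴿ-pointwise (λ n → ℚₚ.≤-refl)

  ≡⇒≈ : (∀ n → seq x n ≡ seq y n) → x ≈ᴿ y
  ≡⇒≈ h = ≤ᴿ-antisym (≤ᴿ-pointwise λ n → ℚₚ.≤-reflexive (h n))
                     (≤ᴿ-pointwise λ n → ℚₚ.≤-reflexive (sym (h n)))

  ≈-refl : x ≈ᴿ x
  ≈-refl = ≡⇒≈ (λ _ → refl)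

  ≈-reflexive : x ≡ y → x ≈ᴿ y
  ≈-reflexive refl = ≈-refl

  ≈-sym : x ≈ᴿ y → y ≈ᴿ x
  ≈-sym e = ≤ᴿ-antisym (≈⇒≥ e) (≈⇒≤ e)

  ≈-trans : x ≈ᴿ y → y ≈ᴿ z → x ≈ᴿ z
  ≈-trans e f = ≤ᴿ-antisym (≤ᴿ-trans (≈⇒≤ e) (≈⇒≤ f)) (≤ᴿ-trans (≈⇒≥ f) (≈⇒≥ e))

  ≤-≈ : x ≤ᴿ y → y ≈ᴿ z → x ≤ᴿ z
  ≤-≈ h e = ≤ᴿ-trans h (≈⇒≤ e)

  ≈-≤ : x ≈ᴿ y → y ≤ᴿ z → x ≤ᴿ z
  ≈-≤ e h = ≤ᴿ-trans (≈⇒≤ e) h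

  ≈-diff : a ≈ᴿ b → (∀ n → seq x n ℚ.- seq y n ≡ seq a n ℚ.- seq b n) → x ≈ᴿ y
  ≈-diff {a} {b} {x} {y} e eq = ≤ᴿ-antisym (≤ᴿ-diff (≈⇒≤ e) eq)
    (≤ᴿ-diff (≈⇒≥ e) λ n → trans
      (solve 2 (λ x y → y :- x := :- (x :- y)) refl (seq x n) (seq y n))
      (trans (cong ℚ.-_ (eq n))
        (solve 2 (λ x y → :- (x :- y) := y :- x) refl (seq a n) (seq b n))))

  +ᴿ-cong : a ≈ᴿ b → c ≈ᴿ d → a +ᴿ c ≈ᴿ b +ᴿ d
  +ᴿ-cong {a} {b} {c} {d} e f = ≤ᴿ-antisym {a +ᴿ c} {b +ᴿ d}
    (+ᴿ-mono-≤ {a} {b} {c} {d} (≈⇒≤ e) (≈⇒≤ f)) (+ᴿ-mono-≤ {b} {a} {d} {c} (≈⇒≥ e) (≈⇒≥ f))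

  -ᴿ-cong : a ≈ᴿ b → c ≈ᴿ d → a -ᴿ c ≈ᴿ b -ᴿ d
  -ᴿ-cong {a} {b} {c} {d} e f = ≈-diff (+ᴿ-cong e (≈-sym f)) λ n →
    solve 4 (λ a b c d → (a :- c) :- (b :- d) := (a :+ d) :- (b :+ c)) refl
      (seq a n) (seq b n) (seq c n) (seq d n)

  *ᴿ-cong : a ≈ᴿ b → c ≈ᴿ d → a *ᴿ c ≈ᴿ b *ᴿ d
  *ᴿ-cong {a} {b} {c} {d} (mk≈ f) (mk≈ g) = mk≈ λ ε ε>0 →
    let A , A>0 , eA = bounded (seq a) (cauchy a)
        D , D>0 , eD = bounded (seq d) (cauchy d)
        δ , δ>0 , Kδ = ratio {A ℚ.+ D} {ε} (ℚₚ.+-mono-< A>0 D>0) ε>0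
        eq = trans (sym (ℚₚ.*-distribʳ-+ δ A D)) Kδ
    in eventually-zip
         (λ { n (ha , hd) (hf , hg) → subst (_ ℚ.≤_) eq
           (sub-*-≤ (seq a n) (seq c n) (seq b n) (seq d n) A D δ
             (ℚₚ.<⇒≤ A>0) (ℚₚ.<⇒≤ D>0) ha hd hg hf) })
         (eventually-zip (λ _ p q → p , q) eA eD)
         (eventually-zip (λ _ p q → p , q) (f δ δ>0) (g δ δ>0))

  0≤*ᴿ : 0ᴿ ≤ᴿ x → 0ᴿ ≤ᴿ y → 0ᴿ ≤ᴿ x *ᴿ y
  0≤*ᴿ {x} {y} (mk≤ f) (mk≤ g) = mk≤ λ ε ε>0 →
    let A , A>0 , eA = bounded (seq x) (cauchy x)
        B , B>0 , eB = bounded (seq y) (cauchy y)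
        δ , δ>0 , Kδ = ratio {A ℚ.+ B} {ε} (ℚₚ.+-mono-< A>0 B>0) ε>0
        eq = trans (sym (ℚₚ.*-distribʳ-+ δ A B)) Kδ
    in eventually-zip
         (λ { n (ha , hb) (hf , hg) → subst (λ e → 0ℚ ℚ.≤ seq x n ℚ.* seq y n ℚ.+ e) eq
            (bound (seq x n) (seq y n) A B δ (ℚₚ.<⇒≤ A>0) (ℚₚ.<⇒≤ B>0) (ℚₚ.<⇒≤ δ>0)
              (ℚₚ.≤-trans (p≤∣p∣ _) ha) (ℚₚ.≤-trans (p≤∣p∣ _) hb) hf hg) })
         (eventually-zip (λ _ p q → p , q) eA eB)
         (eventually-zip (λ _ p q → p , q) (f δ δ>0) (g δ δ>0))
    where
    -- Both factors are only known to be at least `-δ`. For `q ≥ 0` expand `(p + δ) q ≥ 0` and use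
    -- `q ≤ B`; for `q ≤ 0` expand `(A - p)(-q) ≥ 0`, so that `p q ≥ A q ≥ -A δ`.
    bound : ∀ p q A B δ → 0ℚ ℚ.≤ A → 0ℚ ℚ.≤ B → 0ℚ ℚ.≤ δ → p ℚ.≤ A → q ℚ.≤ B →
            0ℚ ℚ.≤ p ℚ.+ δ → 0ℚ ℚ.≤ q ℚ.+ δ → 0ℚ ℚ.≤ p ℚ.* q ℚ.+ (A ℚ.* δ ℚ.+ B ℚ.* δ)
    bound p q A B δ 0≤A 0≤B 0≤δ p≤A q≤B hp hq with ℚₚ.≤-total 0ℚ q
    ... | inj₁ 0≤q = ≤-diff
          (ℚₚ.+-mono-≤ (0≤*ℚ hp 0≤q)
            (ℚₚ.+-mono-≤ (*ℚ-monoˡ-≤ δ 0≤δ q≤B) (0≤*ℚ 0≤A 0≤δ)))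
          (solve 5 (λ p q A B δ → con 0ℚ :- (p :* q :+ (A :* δ :+ B :* δ)) :=
                      (con 0ℚ :+ (δ :* q :+ con 0ℚ)) :- ((p :+ δ) :* q :+ (δ :* B :+ A :* δ))) refl p q
                          A B δ)
    ... | inj₂ q≤0 = ≤-diff
          (ℚₚ.+-mono-≤
            (0≤*ℚ {A ℚ.- p} { ℚ.- q} (≤-diff p≤A (solve 2 (λ A p → con 0ℚ :- (A :- p) := p :- A) refl A
                p))
                  (≤-diff q≤0 (solve 1 (λ q → con 0ℚ :- (:- q) := q :- con 0ℚ) refl q)))
            (ℚₚ.+-mono-≤ (0≤*ℚ 0≤A hq) (0≤*ℚ 0≤B 0≤δ)))
          (solve 5 (λ p q A B δ → con 0ℚ :- (p :* q :+ (A :* δ :+ B :* δ)) :=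
                      (con 0ℚ :+ (con 0ℚ :+ con 0ℚ)) :- ((A :- p) :* (:- q) :+ (A :* (q :+ δ) :+ B :*
                          δ))) refl p q A B δ)

  *ᴿ-monoˡ-≤ : 0ᴿ ≤ᴿ a → x ≤ᴿ y → a *ᴿ x ≤ᴿ a *ᴿ y
  *ᴿ-monoˡ-≤ {a} {x} {y} 0≤a x≤y = ≤ᴿ-diff (0≤*ᴿ {a} {y -ᴿ x} 0≤a
    (≤ᴿ-diff x≤y λ n → solve 2 (λ x y → con 0ℚ :- (y :- x) := x :- y) refl (seq x n) (seq y n)))
    λ n → solve 3 (λ a x y → a :* x :- a :* y := con 0ℚ :- a :* (y :- x)) refl (seq a n) (seq x n)
        (seq y n)

  fromℚ-mono-≤ : ∀ {p q} → p ℚ.≤ q → fromℚ p ≤ᴿ fromℚ q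
  fromℚ-mono-≤ h = ≤ᴿ-pointwise (λ _ → h)

  fromℚ-mono-< : ∀ {p q} → p ℚ.< q → fromℚ p <ᴿ fromℚ q
  fromℚ-mono-< {p} {q} h = mk< (q ℚ.- p) (ℚₚ.≤-<-trans (ℚₚ.≤-reflexive (sym (ℚₚ.+-inverseʳ p)))
      (ℚₚ.+-monoˡ-< (ℚ.- p) h))
    (eventually-always λ _ → ℚₚ.≤-reflexive (solve 2 (λ p q → p :+ (q :- p) := q) refl p q))

  <⇒gap : (x<y : x <ᴿ y) → x +ᴿ fromℚ (_<ᴿ_.gap x<y) ≤ᴿ y
  <⇒gap {x} {y} (mk< g g>0 e) = mk≤ λ ε ε>0 → eventually-map
    (λ n h → ℚₚ.≤-trans h (subst (ℚ._≤ seq y n ℚ.+ ε) (ℚₚ.+-identityʳ _) (ℚₚ.+-monoʳ-≤ (seq y n)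
        (ℚₚ.<⇒≤ ε>0)))) e

  gap⇒< : ∀ {g} → 0ℚ ℚ.< g → x +ᴿ fromℚ g ≤ᴿ y → x <ᴿ y
  gap⇒< {x} {y} {g} g>0 (mk≤ f) = mk< (½ ℚ.* g) (half-pos g>0) (eventually-map
    (λ n h → ≤-diff h (trans
       (solve 3 (λ x y g → (x :+ g) :- y := (x :+ (g :+ g)) :- (y :+ g)) refl (seq x n) (seq y n)
           (½ ℚ.* g))
       (cong (λ e → seq x n ℚ.+ e ℚ.- (seq y n ℚ.+ ½ ℚ.* g)) (half+half g))))
    (f _ (half-pos g>0)))

  <-≤-transᴿ : x <ᴿ y → y ≤ᴿ z → x <ᴿ z
  <-≤-transᴿ x<y@(mk< g g>0 _) h = gap⇒< g>0 (≤ᴿ-trans (<⇒gap x<y) h)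

  ≤-<-transᴿ : x ≤ᴿ y → y <ᴿ z → x <ᴿ z
  ≤-<-transᴿ {x} {y} {z} h y<z@(mk< g g>0 _) = gap⇒< {x} {z} {g} g>0
    (≤ᴿ-trans {x +ᴿ fromℚ g} {y +ᴿ fromℚ g} {z} (+ᴿ-mono-≤ {x} {y} {fromℚ g} {fromℚ g} h ≤ᴿ-refl)
        (<⇒gap y<z))

  <⇒≤ᴿ : x <ᴿ y → x ≤ᴿ y
  <⇒≤ᴿ {x} {y} x<y@(mk< g g>0 _) = ≤ᴿ-trans
    (≤ᴿ-pointwise λ n → subst (ℚ._≤ seq x n ℚ.+ g) (ℚₚ.+-identityʳ _) (ℚₚ.+-monoʳ-≤ (seq x n)
        (ℚₚ.<⇒≤ g>0)))
    (<⇒gap x<y)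

  <-irreflᴿ : ¬ (x <ᴿ x)
  <-irreflᴿ {x} (mk< g g>0 (N , h)) = ℚₚ.<-irrefl refl (ℚₚ.<-≤-trans g>0
    (≤-diff (h (ℕₚ.≤-refl {N})) (solve 2 (λ x g → g :- con 0ℚ := (x :+ g) :- x) refl (seq x N) g)))

  0<-⇒< : 0ᴿ <ᴿ y -ᴿ x → x <ᴿ y
  0<-⇒< {y} {x} h@(mk< g g>0 _) = gap⇒< g>0 (≤ᴿ-diff (<⇒gap h) λ n →
    solve 3 (λ x y g → (x :+ g) :- y := (con 0ℚ :+ g) :- (y :- x)) refl (seq x n) (seq y n) g)

  -- Comparing sufficiently good rational approximations decides x < y up to ε.
  <⊎≤+ : ∀ x y ε → 0ℚ ℚ.< ε → x <ᴿ y ⊎ y ≤ᴿ x +ᴿ fromℚ ε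
  <⊎≤+ x y ε ε>0 = decide (seq y N ℚₚ.≤? seq x N ℚ.+ (η ℚ.+ η))
    where
    η = ½ ℚ.* (½ ℚ.* ε)
    η>0 : 0ℚ ℚ.< η
    η>0 = half-pos (half-pos ε>0)
    4η : (η ℚ.+ η) ℚ.+ (η ℚ.+ η) ≡ ε
    4η = trans (cong₂ ℚ._+_ (half+half (½ ℚ.* ε)) (half+half (½ ℚ.* ε))) (half+half ε)
    N = proj₁ (cauchy x η η>0) ℕ.⊔ proj₁ (cauchy y η η>0)
    fx : ∀ {n} → N ℕ.≤ n → ∣ seq x N ℚ.- seq x n ∣ ℚ.≤ η
    fx le = proj₂ (cauchy x η η>0) (ℕₚ.m≤m⊔n _ _) (ℕₚ.≤-trans (ℕₚ.m≤m⊔n _ _) le)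
    fy : ∀ {n} → N ℕ.≤ n → ∣ seq y N ℚ.- seq y n ∣ ℚ.≤ η
    fy le = proj₂ (cauchy y η η>0) (ℕₚ.m≤n⊔m _ _) (ℕₚ.≤-trans (ℕₚ.m≤n⊔m _ _) le)
    near : seq y N ℚ.≤ seq x N ℚ.+ (η ℚ.+ η) → y ≤ᴿ x +ᴿ fromℚ ε
    near h = (mk≤ λ ε′ ε′>0 → N , λ {n} le →
          ℚₚ.≤-trans
            (≤-diff (ℚₚ.+-mono-≤ h (ℚₚ.+-mono-≤ (∣-∣≤⇒≤+ (seq x N) (seq x n) (fx le))
                (∣-∣≤⇒≥+ (seq y N) (seq y n) (fy le))))
              (trans (cong (λ e → seq y n ℚ.- (seq x n ℚ.+ e)) (sym 4η))
                (solve 5 (λ xN yN xn yn e → yn :- (xn :+ ((e :+ e) :+ (e :+ e))) :=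
                  (yN :+ (xN :+ yn)) :- ((xN :+ (e :+ e)) :+ ((xn :+ e) :+ (yN :+ e)))) refl
                  (seq x N) (seq y N) (seq x n) (seq y n) η)))
            (subst (ℚ._≤ (seq x n ℚ.+ ε) ℚ.+ ε′) (ℚₚ.+-identityʳ _) (ℚₚ.+-monoʳ-≤ (seq x n ℚ.+ ε)
                (ℚₚ.<⇒≤ ε′>0))))
    far : ¬ (seq y N ℚ.≤ seq x N ℚ.+ (η ℚ.+ η)) → x <ᴿ y
    far ¬h = (0<-⇒< {y} {x} (gap⇒< {0ᴿ} {y -ᴿ x} {g} g>0 (mk≤ λ ε′ ε′>0 → N , λ {n} le →
            ℚₚ.≤-trans (≤-diff (ℚₚ.+-mono-≤ (∣-∣≤⇒≥+ (seq x N) (seq x n) (fx le)) (∣-∣≤⇒≤+ (seq y N)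
                (seq y n) (fy le)))
              (solve 5 (λ xN yN xn yn e → (con 0ℚ :+ ((yN :- xN) :- (e :+ e))) :- (yn :- xn) :=
                  (xn :+ yN) :- ((xN :+ e) :+ (yn :+ e))) refl
                 (seq x N) (seq y N) (seq x n) (seq y n) η))
              (subst (ℚ._≤ (seq y n ℚ.- seq x n) ℚ.+ ε′) (ℚₚ.+-identityʳ _)
                  (ℚₚ.+-monoʳ-≤ (seq y n ℚ.- seq x n) (ℚₚ.<⇒≤ ε′>0))))))
      where
      g = (seq y N ℚ.- seq x N) ℚ.- (η ℚ.+ η)
      g>0 : 0ℚ ℚ.< g
      g>0 = subst (ℚ._< g) (ℚₚ.+-inverseʳ (seq x N ℚ.+ (η ℚ.+ η)))
        (subst (seq x N ℚ.+ (η ℚ.+ η) ℚ.- (seq x N ℚ.+ (η ℚ.+ η)) ℚ.<_)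
          (solve 3 (λ x y e → y :- (x :+ (e :+ e)) := (y :- x) :- (e :+ e)) refl (seq x N) (seq y N) η)
          (ℚₚ.+-monoˡ-< (ℚ.- (seq x N ℚ.+ (η ℚ.+ η))) (ℚₚ.≰⇒> ¬h)))
    decide : Dec (seq y N ℚ.≤ seq x N ℚ.+ (η ℚ.+ η)) → x <ᴿ y ⊎ y ≤ᴿ x +ᴿ fromℚ ε
    decide (yes h) = inj₂ (near h)
    decide (no ¬h) = inj₁ (far ¬h)

  ≤ᴿ-from-ε : (∀ ε → 0ℚ ℚ.< ε → x ≤ᴿ y +ᴿ fromℚ ε) → x ≤ᴿ y
  ≤ᴿ-from-ε {x} {y} h = mk≤ λ ε ε>0 → eventually-map
    (λ n k → subst (λ e → seq x n ℚ.≤ e)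
      (trans (ℚₚ.+-assoc (seq y n) (½ ℚ.* ε) (½ ℚ.* ε)) (cong (seq y n ℚ.+_) (half+half ε))) k)
    (_≤ᴿ_.below (h _ (half-pos ε>0)) _ (half-pos ε>0))

  -- At every precision `<⊎≤+` leaves only its second alternative. This is how a refuted positivity
  -- becomes the vanishing of the residue in `decompose`.
  ≮⇒≥ᴿ : ¬ (x <ᴿ y) → y ≤ᴿ x
  ≮⇒≥ᴿ {x} {y} ¬< = ≤ᴿ-from-ε {y} {x} go
    where
    go : ∀ ε → 0ℚ ℚ.< ε → y ≤ᴿ x +ᴿ fromℚ ε
    go ε ε>0 = [ (λ lt → contradiction lt ¬<) , id ]′ (<⊎≤+ x y ε ε>0)

  -- Compare `x` with 0 up to half the gap `g` of the sum: if `x` is not found positive it is at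
  -- most `g / 2`, which leaves at least `g / 2` for `y`.
  0<+⇒0<⊎0< : ∀ x y → 0ᴿ <ᴿ x +ᴿ y → 0ᴿ <ᴿ x ⊎ 0ᴿ <ᴿ y
  0<+⇒0<⊎0< x y h@(mk< g g>0 _) = map₂ small (<⊎≤+ 0ᴿ x (½ ℚ.* g) (half-pos g>0))
    where
    small : x ≤ᴿ 0ᴿ +ᴿ fromℚ (½ ℚ.* g) → 0ᴿ <ᴿ y
    small le = gap⇒< {0ᴿ} {y} (half-pos g>0) (≤ᴿ-diff
        {(0ᴿ +ᴿ fromℚ g) +ᴿ x} {(x +ᴿ y) +ᴿ (0ᴿ +ᴿ fromℚ (½ ℚ.* g))} {0ᴿ +ᴿ fromℚ (½ ℚ.* g)} {y}
        (+ᴿ-mono-≤ {0ᴿ +ᴿ fromℚ g} {x +ᴿ y} {x} {0ᴿ +ᴿ fromℚ (½ ℚ.* g)} (<⇒gap h) le) λ n →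
        trans (solve 3 (λ x y g → (con 0ℚ :+ g) :- y := (con 0ℚ :+ (g :+ g) :+ x) :-
            ((x :+ y) :+ (con 0ℚ :+ g))) refl
                 (seq x n) (seq y n) (½ ℚ.* g))
              (cong (λ e → (0ℚ ℚ.+ e ℚ.+ seq x n) ℚ.- ((seq x n ℚ.+ seq y n) ℚ.+ (0ℚ ℚ.+ ½ ℚ.* g)))
                  (half+half g)))

  -- The positive factor is bounded below by its rational gap, and a rational can be inverted.
  *ᴿ-cancel-≤0 : 0ᴿ <ᴿ a → 0ᴿ ≤ᴿ x → a *ᴿ x ≤ᴿ 0ᴿ → x ≤ᴿ 0ᴿ
  *ᴿ-cancel-≤0 {a} {x} 0<a@(mk< g g>0 _) 0≤x ax≤0 =
    let J , J>0 , gJ = inverse g>0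
        gx≤0 : fromℚ g *ᴿ x ≤ᴿ 0ᴿ
        gx≤0 = ≤ᴿ-diff (+ᴿ-mono-≤ ax≤0 (*ᴿ-monoˡ-≤ {x} 0≤x (<⇒gap 0<a)))
          λ n → solve 3 (λ a x g → g :* x :- con 0ℚ := (a :* x :+ x :* (con 0ℚ :+ g)) :-
              (con 0ℚ :+ x :* a)) refl (seq a n) (seq x n) g
    in ≤ᴿ-diff (*ᴿ-monoˡ-≤ {fromℚ J} (fromℚ-mono-≤ (ℚₚ.<⇒≤ J>0)) gx≤0) λ n →
         trans (cong (ℚ._- 0ℚ) (trans (sym (ℚₚ.*-identityˡ (seq x n))) (cong (ℚ._* seq x n) (sym gJ))))
           (solve 3 (λ g J x → (g :* J) :* x :- con 0ℚ := J :* (g :* x) :- J :* con 0ℚ) refl g J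
               (seq x n))

  -- Taken termwise, hence defined without knowing which argument is smaller; the decomposition of
  -- flows depends on that.
  minᴿ : ℝ → ℝ → ℝ
  minᴿ x y = mkℝ (λ n → seq x n ℚ.⊓ seq y n) λ ε ε>0 →
    let N , f = cauchy x ε ε>0
        M , g = cauchy y ε ε>0
    in N ℕ.⊔ M , λ {m} {n} p q →
      ≤+⇒∣-∣≤ (seq x m ℚ.⊓ seq y m) (seq x n ℚ.⊓ seq y n)
        (⊓-+-≤ (seq x m) (seq y m) (seq x n) (seq y n) (∣-∣≤⇒≤+ (seq x m) (seq x n) (f (⊔-≤ˡ {N} {M} p)
            (⊔-≤ˡ {N} {M} q))) (∣-∣≤⇒≤+ (seq y m) (seq y n) (g (⊔-≤ʳ {N} {M} p) (⊔-≤ʳ {N} {M} q))))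
        (⊓-+-≤ (seq x n) (seq y n) (seq x m) (seq y m) (∣-∣≤⇒≥+ (seq x m) (seq x n) (f (⊔-≤ˡ {N} {M} p)
            (⊔-≤ˡ {N} {M} q))) (∣-∣≤⇒≥+ (seq y m) (seq y n) (g (⊔-≤ʳ {N} {M} p) (⊔-≤ʳ {N} {M} q))))

  minᴿ-≤ˡ : minᴿ x y ≤ᴿ x
  minᴿ-≤ˡ {x} {y} = ≤ᴿ-pointwise {minᴿ x y} {x} (λ n → ℚₚ.p⊓q≤p (seq x n) (seq y n))

  minᴿ-≤ʳ : minᴿ x y ≤ᴿ y
  minᴿ-≤ʳ {x} {y} = ≤ᴿ-pointwise {minᴿ x y} {y} (λ n → ℚₚ.p⊓q≤q (seq x n) (seq y n))

  minᴿ-glb : z ≤ᴿ x → z ≤ᴿ y → z ≤ᴿ minᴿ x y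
  minᴿ-glb {z} {x} {y} (mk≤ f) (mk≤ g) = mk≤ λ ε ε>0 →
    eventually-zip (λ n h k → subst (ℚ._≤ _) (ℚₚ.⊓-idem (seq z n)) (⊓-+-≤ (seq z n) (seq z n) (seq x n)
        (seq y n) h k)) (f ε ε>0) (g ε ε>0)

  minᴿ-glb-< : z <ᴿ x → z <ᴿ y → z <ᴿ minᴿ x y
  minᴿ-glb-< {z} {x} {y} z<x@(mk< g g>0 _) z<y@(mk< h h>0 _) =
    gap⇒< {z} {minᴿ x y} {g ℚ.⊓ h} min>0 (minᴿ-glb {z +ᴿ fromℚ (g ℚ.⊓ h)} {x} {y}
      (≤ᴿ-trans {z +ᴿ fromℚ (g ℚ.⊓ h)} {z +ᴿ fromℚ g} {x} (+ᴿ-mono-≤ {z} {z} {fromℚ (g ℚ.⊓ h)}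
          {fromℚ g} ≤ᴿ-refl (fromℚ-mono-≤ (ℚₚ.p⊓q≤p g h))) (<⇒gap z<x))
      (≤ᴿ-trans {z +ᴿ fromℚ (g ℚ.⊓ h)} {z +ᴿ fromℚ h} {y} (+ᴿ-mono-≤ {z} {z} {fromℚ (g ℚ.⊓ h)}
          {fromℚ h} ≤ᴿ-refl (fromℚ-mono-≤ (ℚₚ.p⊓q≤q g h))) (<⇒gap z<y)))
    where
    min>0 : 0ℚ ℚ.< g ℚ.⊓ h
    min>0 with ℚₚ.⊓-sel g h
    ... | inj₁ e = subst (0ℚ ℚ.<_) (sym e) g>0
    ... | inj₂ e = subst (0ℚ ℚ.<_) (sym e) h>0

  -- Naturals as rationals and reals

  ℚℕ : ℕ → ℚ
  ℚℕ n = + n ℚ./ 1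

  toℚᵘ-/ : ∀ i n .⦃ _ : ℕ.NonZero n ⦄ → ℚ.toℚᵘ (i ℚ./ n) ℚᵘ.≃ i ℚᵘ./ n
  toℚᵘ-/ i (suc n) = ℚₚ.toℚᵘ-fromℚᵘ (mkℚᵘ i n)

  ℚℕ-+ : ∀ m n → ℚℕ (m ℕ.+ n) ≡ ℚℕ m ℚ.+ ℚℕ n
  ℚℕ-+ m n = ℚₚ.toℚᵘ-injective (begin
    ℚ.toℚᵘ (ℚℕ (m ℕ.+ n))                ≈⟨ toℚᵘ-/ (+ (m ℕ.+ n)) 1 ⟩
    mkℚᵘ (+ (m ℕ.+ n)) 0                 ≈⟨ *≡*
        (cong (ℤ._* + 1) (sym (cong₂ ℤ._+_ (ℤₚ.*-identityʳ (+ m)) (ℤₚ.*-identityʳ (+ n))))) ⟩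
    mkℚᵘ (+ m) 0 ℚᵘ.+ mkℚᵘ (+ n) 0       ≈⟨ ℚᵘₚ.+-cong (toℚᵘ-/ (+ m) 1) (toℚᵘ-/ (+ n) 1) ⟨
    ℚ.toℚᵘ (ℚℕ m) ℚᵘ.+ ℚ.toℚᵘ (ℚℕ n)     ≈⟨ ℚₚ.toℚᵘ-homo-+ (ℚℕ m) (ℚℕ n) ⟨
    ℚ.toℚᵘ (ℚℕ m ℚ.+ ℚℕ n)               ∎)
    where open ℚᵘₚ.≃-Reasoning

  ℚℕ-* : ∀ m n → ℚℕ (m ℕ.* n) ≡ ℚℕ m ℚ.* ℚℕ n
  ℚℕ-* m n = ℚₚ.toℚᵘ-injective (begin
    ℚ.toℚᵘ (ℚℕ (m ℕ.* n))                ≈⟨ toℚᵘ-/ (+ (m ℕ.* n)) 1 ⟩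
    mkℚᵘ (+ (m ℕ.* n)) 0                 ≈⟨ *≡* (cong (ℤ._* + 1) (ℤₚ.pos-* m n)) ⟩
    mkℚᵘ (+ m) 0 ℚᵘ.* mkℚᵘ (+ n) 0       ≈⟨ ℚᵘₚ.*-cong (toℚᵘ-/ (+ m) 1) (toℚᵘ-/ (+ n) 1) ⟨
    ℚ.toℚᵘ (ℚℕ m) ℚᵘ.* ℚ.toℚᵘ (ℚℕ n)     ≈⟨ ℚₚ.toℚᵘ-homo-* (ℚℕ m) (ℚℕ n) ⟨
    ℚ.toℚᵘ (ℚℕ m ℚ.* ℚℕ n)               ∎)
    where open ℚᵘₚ.≃-Reasoning

  /≡*1/ : ∀ c n .⦃ _ : ℕ.NonZero n ⦄ → + c ℚ./ n ≡ (+ 1 ℚ./ n) ℚ.* ℚℕ c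
  /≡*1/ c n@(suc n-1) = ℚₚ.toℚᵘ-injective (begin
    ℚ.toℚᵘ (+ c ℚ./ n)                          ≈⟨ toℚᵘ-/ (+ c) n ⟩
    mkℚᵘ (+ c) n-1                              ≈⟨ *≡* (cong₂ ℤ._*_ (sym (ℤₚ.*-identityˡ (+ c)))
        (ℤₚ.*-identityʳ (+ n))) ⟩
    mkℚᵘ (+ 1) n-1 ℚᵘ.* mkℚᵘ (+ c) 0            ≈⟨ ℚᵘₚ.*-cong (toℚᵘ-/ (+ 1) n) (toℚᵘ-/ (+ c) 1) ⟨
    ℚ.toℚᵘ (+ 1 ℚ./ n) ℚᵘ.* ℚ.toℚᵘ (ℚℕ c)       ≈⟨ ℚₚ.toℚᵘ-homo-* (+ 1 ℚ./ n) (ℚℕ c) ⟨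
    ℚ.toℚᵘ ((+ 1 ℚ./ n) ℚ.* ℚℕ c)               ∎)
    where open ℚᵘₚ.≃-Reasoning

  n/n≡1 : ∀ n .⦃ _ : ℕ.NonZero n ⦄ → (+ 1 ℚ./ n) ℚ.* ℚℕ n ≡ 1ℚ
  n/n≡1 n@(suc n-1) = trans (sym (/≡*1/ n n)) (ℚₚ.toℚᵘ-injective (ℚᵘₚ.≃-trans (toℚᵘ-/ (+ n) n)
    (*≡* (trans (ℤₚ.*-identityʳ (+ n)) (sym (ℤₚ.*-identityˡ (+ n)))))))

  0≤1/ : ∀ n .⦃ _ : ℕ.NonZero n ⦄ → 0ℚ ℚ.≤ + 1 ℚ./ n
  0≤1/ n = ℚₚ.nonNegative⁻¹ _ ⦃ ℚₚ.normalize-nonNeg 1 n ⦄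

  0≤ℚℕ : ∀ n → 0ℚ ℚ.≤ ℚℕ n
  0≤ℚℕ n = ℚₚ.nonNegative⁻¹ _ ⦃ ℚₚ.normalize-nonNeg n 1 ⦄

  ℚℕ-mono-≤ : ∀ {m n} → m ℕ.≤ n → ℚℕ m ℚ.≤ ℚℕ n
  ℚℕ-mono-≤ {m} {n} m≤n = subst (ℚℕ m ℚ.≤_)
    (trans (sym (ℚℕ-+ m (n ℕ.∸ m))) (cong ℚℕ (ℕₚ.m+[n∸m]≡n m≤n)))
    (subst (ℚ._≤ ℚℕ m ℚ.+ ℚℕ (n ℕ.∸ m)) (ℚₚ.+-identityʳ _) (ℚₚ.+-monoʳ-≤ (ℚℕ m) (0≤ℚℕ (n ℕ.∸ m))))

  -- The numerator of a positive rational bounds it from above.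
  archimedean : ∀ q → ∃[ n ] q ℚ.≤ ℚℕ n
  archimedean q@(ℚ.mkℚ (+ p) d _) = p , ℚₚ.toℚᵘ-cancel-≤ (ℚᵘₚ.≤-respʳ-≃ (ℚᵘₚ.≃-sym (toℚᵘ-/ (+ p) 1))
    (ℚᵘ.*≤* (ℤₚ.*-monoˡ-≤-nonNeg (+ p) (ℤ.+≤+ (s≤s z≤n)))))
  archimedean q@(ℚ.mkℚ ℤ.-[1+ p ] d _) = 0 , ℚₚ.≤-trans (ℚₚ.nonPositive⁻¹ q) (0≤ℚℕ 0)

open CauchySequences

-- The reals as a commutative ring

module RealRing where

  infixl 6 _+_ _-_
  infixl 7 _*_
  infix  8 -_

  private
    variable
      a b c d x y z : ℝ

  -- Unfolding the operations during conversion checking drags in the Cauchy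
  -- proofs they carry, so everything below uses opaque copies.
  opaque
    _+_ _*_ _⊓_ : ℝ → ℝ → ℝ
    _+_ = _+ᴿ_
    _*_ = _*ᴿ_
    _⊓_ = minᴿ

    -_ : ℝ → ℝ
    - x = 0ᴿ -ᴿ x

    ι : ℚ → ℝ
    ι = fromℚ

  _-_ : ℝ → ℝ → ℝ
  x - y = x + - y

  #_ : ℕ → ℝ
  # n = ι (ℚℕ n)

  opaque
    unfolding _+_

    +-def : ∀ x y → x + y ≡ x +ᴿ y
    +-def x y = refl

    *-def : ∀ x y → x * y ≡ x *ᴿ y
    *-def x y = refl

    ι-def : ∀ q → ι q ≡ fromℚ q
    ι-def q = refl

    seq-+ : ∀ x y n → seq (x + y) n ≡ seq x n ℚ.+ seq y n
    seq-+ x y n = refl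

    seq-* : ∀ x y n → seq (x * y) n ≡ seq x n ℚ.* seq y n
    seq-* x y n = refl

    seq-neg : ∀ x n → seq (- x) n ≡ ℚ.- seq x n
    seq-neg x n = ℚₚ.+-identityˡ (ℚ.- seq x n)

    seq-ι : ∀ p n → seq (ι p) n ≡ p
    seq-ι p n = refl

    +-cong : a ≈ᴿ b → c ≈ᴿ d → a + c ≈ᴿ b + d
    +-cong {a} {b} {c} {d} = +ᴿ-cong {a} {b} {c} {d}

    *-cong : a ≈ᴿ b → c ≈ᴿ d → a * c ≈ᴿ b * d
    *-cong {a} {b} {c} {d} = *ᴿ-cong {a} {b} {c} {d}

    neg-cong : a ≈ᴿ b → - a ≈ᴿ - b
    neg-cong {a} {b} e = -ᴿ-cong {0ᴿ} {0ᴿ} {a} {b} ≈-refl e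

    ι-mono-≤ : ∀ {p q} → p ℚ.≤ q → ι p ≤ᴿ ι q
    ι-mono-≤ = fromℚ-mono-≤

    ι-mono-< : ∀ {p q} → p ℚ.< q → ι p <ᴿ ι q
    ι-mono-< = fromℚ-mono-<

    +-mono-≤ : a ≤ᴿ b → c ≤ᴿ d → a + c ≤ᴿ b + d
    +-mono-≤ {a} {b} {c} {d} = +ᴿ-mono-≤ {a} {b} {c} {d}

    0≤* : ι 0ℚ ≤ᴿ x → ι 0ℚ ≤ᴿ y → ι 0ℚ ≤ᴿ x * y
    0≤* {x} {y} = 0≤*ᴿ {x} {y}

    *-monoˡ-≤ : ι 0ℚ ≤ᴿ a → x ≤ᴿ y → a * x ≤ᴿ a * y
    *-monoˡ-≤ {a} {x} {y} = *ᴿ-monoˡ-≤ {a} {x} {y}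

    <⇒+gap : (x<y : x <ᴿ y) → x + ι (_<ᴿ_.gap x<y) ≤ᴿ y
    <⇒+gap {x} {y} = <⇒gap {x} {y}

    +gap⇒< : ∀ {g} → 0ℚ ℚ.< g → x + ι g ≤ᴿ y → x <ᴿ y
    +gap⇒< {x} {y} {g} = gap⇒< {x} {y} {g}

    ≤-from-ε : (∀ ε → 0ℚ ℚ.< ε → x ≤ᴿ y + ι ε) → x ≤ᴿ y
    ≤-from-ε {x} {y} = ≤ᴿ-from-ε {x} {y}

    0<+⇒0< : ∀ x y → ι 0ℚ <ᴿ x + y → ι 0ℚ <ᴿ x ⊎ ι 0ℚ <ᴿ y
    0<+⇒0< = 0<+⇒0<⊎0<

    *-cancel-≤0 : ι 0ℚ <ᴿ a → ι 0ℚ ≤ᴿ x → a * x ≤ᴿ ι 0ℚ → x ≤ᴿ ι 0ℚ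
    *-cancel-≤0 {a} {x} = *ᴿ-cancel-≤0 {a} {x}

    ⊓-≤ˡ : ∀ x y → x ⊓ y ≤ᴿ x
    ⊓-≤ˡ x y = minᴿ-≤ˡ {x} {y}

    ⊓-≤ʳ : ∀ x y → x ⊓ y ≤ᴿ y
    ⊓-≤ʳ x y = minᴿ-≤ʳ {x} {y}

    ⊓-glb : z ≤ᴿ x → z ≤ᴿ y → z ≤ᴿ x ⊓ y
    ⊓-glb {z} {x} {y} = minᴿ-glb {z} {x} {y}

    ⊓-glb-< : z <ᴿ x → z <ᴿ y → z <ᴿ x ⊓ y
    ⊓-glb-< {z} {x} {y} = minᴿ-glb-< {z} {x} {y}

    approximate : ∀ x ε → 0ℚ ℚ.< ε → Σ[ q ∈ ℚ ] (x ≤ᴿ ι (q ℚ.+ ε) × ι q ≤ᴿ x + ι ε)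
    approximate x ε ε>0 = let N , f = cauchy x ε ε>0 in seq x N
      , mk≤ (λ η η>0 → N , λ {n} le → weaken η>0 (∣-∣≤⇒≥+ (seq x N) (seq x n) (f ℕₚ.≤-refl le)))
      , mk≤ (λ η η>0 → N , λ {n} le → weaken η>0 (∣-∣≤⇒≤+ (seq x N) (seq x n) (f ℕₚ.≤-refl le)))
      where
      weaken : ∀ {p q η} → 0ℚ ℚ.< η → p ℚ.≤ q → p ℚ.≤ q ℚ.+ η
      weaken {p} {q} {η} η>0 p≤q = subst (ℚ._≤ q ℚ.+ η) (ℚₚ.+-identityʳ p)
          (ℚₚ.+-mono-≤ p≤q (ℚₚ.<⇒≤ η>0))

  +-assoc : ∀ x y z → (x + y) + z ≈ᴿ x + (y + z)
  +-assoc x y z = ≡⇒≈ λ n → begin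
    seq ((x + y) + z) n                    ≡⟨ seq-+ (x + y) z n ⟩
    seq (x + y) n ℚ.+ seq z n              ≡⟨ cong (ℚ._+ seq z n) (seq-+ x y n) ⟩
    (seq x n ℚ.+ seq y n) ℚ.+ seq z n      ≡⟨ ℚₚ.+-assoc (seq x n) (seq y n) (seq z n) ⟩
    seq x n ℚ.+ (seq y n ℚ.+ seq z n)      ≡⟨ cong (seq x n ℚ.+_) (seq-+ y z n) ⟨
    seq x n ℚ.+ seq (y + z) n              ≡⟨ seq-+ x (y + z) n ⟨
    seq (x + (y + z)) n                    ∎
    where open ≡-Reasoning

  +-comm : ∀ x y → x + y ≈ᴿ y + x
  +-comm x y = ≡⇒≈ λ n → trans (seq-+ x y n) (trans (ℚₚ.+-comm (seq x n) (seq y n)) (sym (seq-+ y x n)))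

  +-identityˡ : ∀ x → ι 0ℚ + x ≈ᴿ x
  +-identityˡ x = ≡⇒≈ λ n → trans (seq-+ (ι 0ℚ) x n)
    (trans (cong (ℚ._+ seq x n) (seq-ι 0ℚ n)) (ℚₚ.+-identityˡ (seq x n)))

  +-identityʳ : ∀ x → x + ι 0ℚ ≈ᴿ x
  +-identityʳ x = ≈-trans (+-comm x (ι 0ℚ)) (+-identityˡ x)

  +-inverseˡ : ∀ x → - x + x ≈ᴿ ι 0ℚ
  +-inverseˡ x = ≡⇒≈ λ n → trans (seq-+ (- x) x n) (trans (cong (ℚ._+ seq x n) (seq-neg x n))
    (trans (ℚₚ.+-inverseˡ (seq x n)) (sym (seq-ι 0ℚ n))))

  +-inverseʳ : ∀ x → x + - x ≈ᴿ ι 0ℚ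
  +-inverseʳ x = ≈-trans (+-comm x (- x)) (+-inverseˡ x)

  *-assoc : ∀ x y z → (x * y) * z ≈ᴿ x * (y * z)
  *-assoc x y z = ≡⇒≈ λ n → begin
    seq ((x * y) * z) n                    ≡⟨ seq-* (x * y) z n ⟩
    seq (x * y) n ℚ.* seq z n              ≡⟨ cong (ℚ._* seq z n) (seq-* x y n) ⟩
    (seq x n ℚ.* seq y n) ℚ.* seq z n      ≡⟨ ℚₚ.*-assoc (seq x n) (seq y n) (seq z n) ⟩
    seq x n ℚ.* (seq y n ℚ.* seq z n)      ≡⟨ cong (seq x n ℚ.*_) (seq-* y z n) ⟨
    seq x n ℚ.* seq (y * z) n              ≡⟨ seq-* x (y * z) n ⟨
    seq (x * (y * z)) n                    ∎
    where open ≡-Reasoning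

  *-comm : ∀ x y → x * y ≈ᴿ y * x
  *-comm x y = ≡⇒≈ λ n → trans (seq-* x y n) (trans (ℚₚ.*-comm (seq x n) (seq y n)) (sym (seq-* y x n)))

  *-identityˡ : ∀ x → ι 1ℚ * x ≈ᴿ x
  *-identityˡ x = ≡⇒≈ λ n → trans (seq-* (ι 1ℚ) x n)
    (trans (cong (ℚ._* seq x n) (seq-ι 1ℚ n)) (ℚₚ.*-identityˡ (seq x n)))

  *-identityʳ : ∀ x → x * ι 1ℚ ≈ᴿ x
  *-identityʳ x = ≈-trans (*-comm x (ι 1ℚ)) (*-identityˡ x)

  *-distribˡ-+ : ∀ x y z → x * (y + z) ≈ᴿ x * y + x * z
  *-distribˡ-+ x y z = ≡⇒≈ λ n → begin
    seq (x * (y + z)) n                                    ≡⟨ seq-* x (y + z) n ⟩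
    seq x n ℚ.* seq (y + z) n                              ≡⟨ cong (seq x n ℚ.*_) (seq-+ y z n) ⟩
    seq x n ℚ.* (seq y n ℚ.+ seq z n)                      ≡⟨ ℚₚ.*-distribˡ-+ (seq x n) (seq y n)
        (seq z n) ⟩
    seq x n ℚ.* seq y n ℚ.+ seq x n ℚ.* seq z n            ≡⟨ cong₂ ℚ._+_ (seq-* x y n) (seq-* x z n) ⟨
    seq (x * y) n ℚ.+ seq (x * z) n                        ≡⟨ seq-+ (x * y) (x * z) n ⟨
    seq (x * y + x * z) n                                  ∎
    where open ≡-Reasoning

  *-distribʳ-+ : ∀ x y z → (y + z) * x ≈ᴿ y * x + z * x
  *-distribʳ-+ x y z = ≈-trans (*-comm (y + z) x)
    (≈-trans (*-distribˡ-+ x y z) (+-cong (*-comm x y) (*-comm x z)))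

  ι-+ : ∀ p q → ι (p ℚ.+ q) ≈ᴿ ι p + ι q
  ι-+ p q = ≡⇒≈ λ n → trans (seq-ι _ n) (sym (trans (seq-+ (ι p) (ι q) n) (cong₂ ℚ._+_ (seq-ι p n)
      (seq-ι q n))))

  ι-* : ∀ p q → ι (p ℚ.* q) ≈ᴿ ι p * ι q
  ι-* p q = ≡⇒≈ λ n → trans (seq-ι _ n) (sym (trans (seq-* (ι p) (ι q) n) (cong₂ ℚ._*_ (seq-ι p n)
      (seq-ι q n))))

  ι-neg : ∀ p → ι (ℚ.- p) ≈ᴿ - ι p
  ι-neg p = ≡⇒≈ λ n → trans (seq-ι _ n) (sym (trans (seq-neg (ι p) n) (cong ℚ.-_ (seq-ι p n))))

  -‿def : ∀ x y → x - y ≈ᴿ x -ᴿ y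
  -‿def x y = ≡⇒≈ λ n → trans (seq-+ x (- y) n) (cong (seq x n ℚ.+_) (seq-neg y n))

  ℝ-commutativeRing : CommutativeRing 0ℓ 0ℓ
  ℝ-commutativeRing = record
    { Carrier = ℝ
    ; _≈_ = _≈ᴿ_
    ; _+_ = _+_
    ; _*_ = _*_
    ; -_ = -_
    ; 0# = ι 0ℚ
    ; 1# = ι 1ℚ
    ; isCommutativeRing = record
      { isRing = record
        { +-isAbelianGroup = record
          { isGroup = record
            { isMonoid = record
              { isSemigroup = record
                { isMagma = record
                  { isEquivalence = record { refl = ≈-refl ; sym = ≈-sym ; trans = ≈-trans }
                  ; ∙-cong = +-cong }
                ; assoc = +-assoc }
              ; identity = +-identityˡ , +-identityʳ }
            ; inverse = +-inverseˡ , +-inverseʳ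
            ; ⁻¹-cong = neg-cong }
          ; comm = +-comm }
        ; *-cong = *-cong
        ; *-assoc = *-assoc
        ; *-identity = *-identityˡ , *-identityʳ
        ; distrib = *-distribˡ-+ , *-distribʳ-+ }
      ; *-comm = *-comm } }

  private
    ι-morphism : CommutativeRing.rawRing ℚₚ.+-*-commutativeRing
      ACR.-Raw-AlmostCommutative⟶ ACR.fromCommutativeRing ℝ-commutativeRing
    ι-morphism = record
      { ⟦_⟧ = ι
      ; +-homo = ι-+
      ; *-homo = ι-*
      ; -‿homo = ι-neg
      ; 0-homo = ≈-refl
      ; 1-homo = ≈-refl }

    ι≟ : ∀ p q → Maybe (ι p ≈ᴿ ι q)
    ι≟ p q = Maybe.map (≈-reflexive ∘ cong ι) (dec⇒maybe (p ℚₚ.≟ q))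

  -- Coefficients are rational since normalisation has to test them for equality, which real
  -- coefficients would not allow.
  module ℝ-Solver = RingSolver
    (CommutativeRing.rawRing ℚₚ.+-*-commutativeRing)
    (ACR.fromCommutativeRing ℝ-commutativeRing) ι-morphism ι≟

  module ≈-Reasoning = SetoidReasoning (CommutativeRing.setoid ℝ-commutativeRing)

open RealRing

-- Natural numbers as reals, and finite sums

module FiniteSums where

  open ℤ using (+_)

  open ℝ-Solver using (solve; _:=_; _:+_; _:-_; _:*_; :-_; con)

  private
    variable
      a b c d x y z : ℝ
      A B : Set

  #-+ : ∀ m n → # (m ℕ.+ n) ≈ᴿ # m + # n
  #-+ m n = ≈-trans (≈-reflexive (cong ι (ℚℕ-+ m n))) (ι-+ (ℚℕ m) (ℚℕ n))

  #-* : ∀ m n → # (m ℕ.* n) ≈ᴿ # m * # n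
  #-* m n = ≈-trans (≈-reflexive (cong ι (ℚℕ-* m n))) (ι-* (ℚℕ m) (ℚℕ n))

  #-mono-≤ : ∀ {m n} → m ℕ.≤ n → # m ≤ᴿ # n
  #-mono-≤ h = ι-mono-≤ (ℚℕ-mono-≤ h)

  0≤# : ∀ n → # 0 ≤ᴿ # n
  0≤# n = #-mono-≤ {0} {n} ℕ.z≤n

  -‿cong : a ≈ᴿ b → c ≈ᴿ d → a - c ≈ᴿ b - d
  -‿cong e f = +-cong e (neg-cong f)

  +-monoʳ-≤ : ∀ x → a ≤ᴿ b → x + a ≤ᴿ x + b
  +-monoʳ-≤ x h = +-mono-≤ (≤ᴿ-refl {x}) h

  +-monoˡ-≤ : ∀ x → a ≤ᴿ b → a + x ≤ᴿ b + x
  +-monoˡ-≤ x h = +-mono-≤ h (≤ᴿ-refl {x})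

  ≤-diffᴿ : a ≤ᴿ b → x - y ≈ᴿ a - b → x ≤ᴿ y
  ≤-diffᴿ {a} {b} {x} {y} a≤b e = ≈-≤ (solve 2 (λ x y → x := (x :- y) :+ y) ≈-refl x y)
    (≤-≈ (+-monoˡ-≤ y (≈-≤ e (+-monoˡ-≤ (- b) a≤b)))
      (solve 2 (λ b y → (b :- b) :+ y := y) ≈-refl b y))

  ≈-diffᴿ : a ≈ᴿ b → x - y ≈ᴿ a - b → x ≈ᴿ y
  ≈-diffᴿ {a} {b} {x} {y} e f = ≤ᴿ-antisym (≤-diffᴿ (≈⇒≤ e) f)
    (≤-diffᴿ (≈⇒≥ e) (≈-trans (solve 2 (λ x y → y :- x := :- (x :- y)) ≈-refl x y)
      (≈-trans (neg-cong f) (solve 2 (λ x y → :- (x :- y) := y :- x) ≈-refl a b))))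

  ≤⇒0≤- : x ≤ᴿ y → # 0 ≤ᴿ y - x
  ≤⇒0≤- {x} {y} h = ≤-diffᴿ h (solve 2 (λ x y → con 0ℚ :- (y :- x) := x :- y) ≈-refl x y)

  0≤-⇒≤ : # 0 ≤ᴿ y - x → x ≤ᴿ y
  0≤-⇒≤ {y} {x} h = ≤-diffᴿ h (solve 2 (λ x y → x :- y := con 0ℚ :- (y :- x)) ≈-refl x y)

  0≤+ : # 0 ≤ᴿ x → # 0 ≤ᴿ y → # 0 ≤ᴿ x + y
  0≤+ {x} {y} h k = ≈-≤ (≈-sym (+-identityˡ (# 0))) (+-mono-≤ h k)

  <⇒0<-ᴿ : x <ᴿ y → # 0 <ᴿ y - x
  <⇒0<-ᴿ {x} {y} h = +gap⇒< (_<ᴿ_.positive h)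
    (≤-diffᴿ (<⇒+gap h) (solve 3 (λ x y g → (con 0ℚ :+ g) :- (y :- x) := (x :+ g) :- y) ≈-refl x y _))

  0<-⇒<ᴿ : # 0 <ᴿ y - x → x <ᴿ y
  0<-⇒<ᴿ {y} {x} h = +gap⇒< (_<ᴿ_.positive h)
    (≤-diffᴿ (<⇒+gap h) (solve 3 (λ x y g → (x :+ g) :- y := (con 0ℚ :+ g) :- (y :- x)) ≈-refl x y _))

  *-congˡ : ∀ x → a ≈ᴿ b → x * a ≈ᴿ x * b
  *-congˡ x e = *-cong (≈-refl {x}) e

  *-congʳ : ∀ x → a ≈ᴿ b → a * x ≈ᴿ b * x
  *-congʳ x e = *-cong e (≈-refl {x})

  +-congˡ : ∀ x → a ≈ᴿ b → x + a ≈ᴿ x + b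
  +-congˡ x e = +-cong (≈-refl {x}) e

  +-congʳ : ∀ x → a ≈ᴿ b → a + x ≈ᴿ b + x
  +-congʳ x e = +-cong e (≈-refl {x})

  *-zeroˡ : ∀ x → # 0 * x ≈ᴿ # 0
  *-zeroˡ = solve 1 (λ x → con 0ℚ :* x := con 0ℚ) ≈-refl

  *-zeroʳ : ∀ x → x * # 0 ≈ᴿ # 0
  *-zeroʳ = solve 1 (λ x → x :* con 0ℚ := con 0ℚ) ≈-refl

  ≤-suc-quotient : ∀ m n .⦃ _ : ℕ.NonZero n ⦄ → m ℕ.≤ suc (m ℕ./ n) ℕ.* n
  ≤-suc-quotient m n = ℕₚ.≤-trans (ℕₚ.≤-reflexive (m≡m%n+[m/n]*n m n))
    (ℕₚ.+-monoˡ-≤ (m ℕ./ n ℕ.* n) (ℕₚ.<⇒≤ (m%n<n m n)))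

  -- Truncating a rational approximation
  natural-approximation : ∀ x → # 0 ≤ᴿ x → ∃[ m ] (# m ≤ᴿ x + # 2 × x ≤ᴿ # m + # 2)
  natural-approximation x 0≤x with approximate x 1ℚ 0<1ℚ
  ... | mkℚ (+ p) d-1 cop , x≤ , ≤x = p ℕ./ suc d-1 ,
        ≤ᴿ-trans (ι-mono-≤ floor≤) (≤ᴿ-trans ≤x (+-monoʳ-≤ x (#-mono-≤ {1} {2} (ℕ.s≤s ℕ.z≤n)))) ,
        ≤-≈ (≤ᴿ-trans x≤ (ι-mono-≤ (ℚₚ.+-monoˡ-≤ 1ℚ ≤1+floor)))
          (≈-trans (≈-trans (ι-+ _ 1ℚ) (+-congʳ (ι 1ℚ) (#-+ 1 (p ℕ./ suc d-1))))
            (solve 1 (λ m → (con 1ℚ :+ m) :+ con 1ℚ := m :+ con (ℚℕ 2)) ≈-refl (# (p ℕ./ suc d-1))))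
    where
    floor≤ : ℚℕ (p ℕ./ suc d-1) ℚ.≤ mkℚ (+ p) d-1 cop
    floor≤ = ℚₚ.toℚᵘ-cancel-≤ (ℚᵘₚ.≤-respˡ-≃ (ℚᵘₚ.≃-sym (toℚᵘ-/ (+ (p ℕ./ suc d-1)) 1)) (ℚᵘ.*≤*
      (ℤₚ.≤-trans (ℤₚ.≤-reflexive (sym (ℤₚ.pos-* (p ℕ./ suc d-1) (suc d-1))))
        (ℤₚ.≤-trans (ℤ.+≤+ (m/n*n≤m p (suc d-1))) (ℤₚ.≤-reflexive (sym (ℤₚ.*-identityʳ (+ p))))))))
    ≤1+floor : mkℚ (+ p) d-1 cop ℚ.≤ ℚℕ (suc (p ℕ./ suc d-1))
    ≤1+floor = ℚₚ.toℚᵘ-cancel-≤ (ℚᵘₚ.≤-respʳ-≃ (ℚᵘₚ.≃-sym (toℚᵘ-/ (+ suc (p ℕ./ suc d-1)) 1)) (ℚᵘ.*≤*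
      (ℤₚ.≤-trans (ℤₚ.≤-reflexive (ℤₚ.*-identityʳ (+ p)))
        (ℤₚ.≤-trans (ℤ.+≤+ (≤-suc-quotient p (suc d-1)))
            (ℤₚ.≤-reflexive (ℤₚ.pos-* (suc (p ℕ./ suc d-1)) (suc d-1)))))))
  ... | q@(mkℚ ℤ.-[1+ p ] d-1 cop) , x≤ , ≤x = 0 ,
        ≤ᴿ-trans 0≤x (≈-≤ (≈-sym (+-identityʳ x)) (+-monoʳ-≤ x (0≤# 2))) ,
        ≤ᴿ-trans x≤ (≤-≈ (ι-mono-≤ (ℚₚ.≤-trans (ℚₚ.+-monoˡ-≤ 1ℚ (ℚₚ.nonPositive⁻¹ q))
            (ℚℕ-mono-≤ {1} {2} (ℕ.s≤s ℕ.z≤n))))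
          (≈-sym (+-identityˡ (# 2))))

  -- Finite sums

  Sum : List A → (A → ℝ) → ℝ
  Sum []       f = # 0
  Sum (x ∷ xs) f = f x + Sum xs f

  Sum-cong-∈ : ∀ (xs : List A) {f g : A → ℝ} → (∀ {x} → x ∈ xs → f x ≈ᴿ g x) → Sum xs f ≈ᴿ Sum xs g
  Sum-cong-∈ []       e = ≈-refl
  Sum-cong-∈ (x ∷ xs) e = +-cong (e (here refl)) (Sum-cong-∈ xs (e ∘ there))

  Sum-cong : ∀ (xs : List A) {f g : A → ℝ} → (∀ x → f x ≈ᴿ g x) → Sum xs f ≈ᴿ Sum xs g
  Sum-cong xs e = Sum-cong-∈ xs (λ {x} _ → e x)

  Sum-0 : ∀ (xs : List A) → Sum xs (λ _ → # 0) ≈ᴿ # 0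
  Sum-0 []       = ≈-refl
  Sum-0 (x ∷ xs) = ≈-trans (+-identityˡ _) (Sum-0 xs)

  Sum-+ : ∀ (xs : List A) (f g : A → ℝ) → Sum xs (λ x → f x + g x) ≈ᴿ Sum xs f + Sum xs g
  Sum-+ []       f g = ≈-sym (+-identityˡ (# 0))
  Sum-+ (x ∷ xs) f g = ≈-trans (+-congˡ (f x + g x) (Sum-+ xs f g))
    (solve 4 (λ a b c d → (a :+ b) :+ (c :+ d) := (a :+ c) :+ (b :+ d)) ≈-refl (f x) (g x) (Sum xs f)
        (Sum xs g))

  Sum-*ˡ : ∀ (xs : List A) c (f : A → ℝ) → Sum xs (λ x → c * f x) ≈ᴿ c * Sum xs f
  Sum-*ˡ []       c f = ≈-sym (*-zeroʳ c)
  Sum-*ˡ (x ∷ xs) c f = ≈-trans (+-congˡ (c * f x) (Sum-*ˡ xs c f))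
      (≈-sym (*-distribˡ-+ c (f x) (Sum xs f)))

  Sum-neg : ∀ (xs : List A) (f : A → ℝ) → Sum xs (λ x → - f x) ≈ᴿ - Sum xs f
  Sum-neg []       f = solve 0 (con 0ℚ := :- con 0ℚ) ≈-refl
  Sum-neg (x ∷ xs) f = ≈-trans (+-congˡ (- f x) (Sum-neg xs f))
    (solve 2 (λ a b → :- a :+ :- b := :- (a :+ b)) ≈-refl (f x) (Sum xs f))

  Sum-‿- : ∀ (xs : List A) (f g : A → ℝ) → Sum xs (λ x → f x - g x) ≈ᴿ Sum xs f - Sum xs g
  Sum-‿- xs f g = ≈-trans (Sum-+ xs f (λ x → - g x)) (+-congˡ (Sum xs f) (Sum-neg xs g))

  Sum-comm : ∀ (xs : List A) (ys : List B) (f : A → B → ℝ) →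
             Sum xs (λ x → Sum ys (f x)) ≈ᴿ Sum ys (λ y → Sum xs (λ x → f x y))
  Sum-comm []       ys f = ≈-sym (Sum-0 ys)
  Sum-comm (x ∷ xs) ys f = ≈-trans (+-congˡ (Sum ys (f x)) (Sum-comm xs ys f))
    (≈-sym (Sum-+ ys (f x) (λ y → Sum xs (λ x → f x y))))

  Sum-++ : ∀ (xs ys : List A) (f : A → ℝ) → Sum (xs ++ ys) f ≈ᴿ Sum xs f + Sum ys f
  Sum-++ []       ys f = ≈-sym (+-identityˡ _)
  Sum-++ (x ∷ xs) ys f = ≈-trans (+-congˡ (f x) (Sum-++ xs ys f))
      (≈-sym (+-assoc (f x) (Sum xs f) (Sum ys f)))

  Sum-map : ∀ (h : A → B) (xs : List A) (f : B → ℝ) → Sum (map h xs) f ≡ Sum xs (f ∘ h)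
  Sum-map h []       f = refl
  Sum-map h (x ∷ xs) f = cong (λ s → f (h x) + s) (Sum-map h xs f)

  Sum-mono-≤ : ∀ (xs : List A) {f g : A → ℝ} → (∀ x → f x ≤ᴿ g x) → Sum xs f ≤ᴿ Sum xs g
  Sum-mono-≤ []       h = ≤ᴿ-refl
  Sum-mono-≤ (x ∷ xs) h = +-mono-≤ (h x) (Sum-mono-≤ xs h)

  0≤Sum : ∀ (xs : List A) {f : A → ℝ} → (∀ x → # 0 ≤ᴿ f x) → # 0 ≤ᴿ Sum xs f
  0≤Sum xs h = ≈-≤ (≈-sym (Sum-0 xs)) (Sum-mono-≤ xs h)

  ∈⇒≤Sum : ∀ {xs : List A} {f : A → ℝ} → (∀ x → # 0 ≤ᴿ f x) → ∀ {x} → x ∈ xs → f x ≤ᴿ Sum xs f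
  ∈⇒≤Sum {xs = x ∷ xs} {f} h (here refl) = ≈-≤ (≈-sym (+-identityʳ (f x)))
      (+-monoʳ-≤ (f x) (0≤Sum xs h))
  ∈⇒≤Sum {xs = y ∷ xs} {f} h (there i)   = ≈-≤ (≈-sym (+-identityˡ _)) (+-mono-≤ (h y) (∈⇒≤Sum h i))

  0<Sum⇒ : ∀ (xs : List A) (f : A → ℝ) → # 0 <ᴿ Sum xs f → ∃[ x ] (x ∈ xs × # 0 <ᴿ f x)
  0<Sum⇒ []       f h = contradiction h <-irreflᴿ
  0<Sum⇒ (x ∷ xs) f h = [ (λ k → x , here refl , k) , (λ k → let y , i , p = 0<Sum⇒ xs f k in y , there
      i , p) ]′
    (0<+⇒0< (f x) (Sum xs f) h)

  Sum-# : ∀ (xs : List A) (f : A → ℕ) → Sum xs (λ x → # f x) ≈ᴿ # sum (map f xs)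
  Sum-# []       f = ≈-refl
  Sum-# (x ∷ xs) f = ≈-trans (+-congˡ (# f x) (Sum-# xs f)) (≈-sym (#-+ (f x) _))

  ≤-from-* : ∀ {K} → (∀ ε → 0ℚ ℚ.< ε → x ≤ᴿ y + # K * ι ε) → x ≤ᴿ y
  ≤-from-* {x} {y} {K} h = ≤-from-ε λ ε ε>0 →
    -- Dividing by `suc K` instead of `K` covers the case that `K` is 0.
    let K′>0 = ℚₚ.<-≤-trans 0<1ℚ (ℚℕ-mono-≤ {1} {suc K} (ℕ.s≤s ℕ.z≤n))
        δ , δ>0 , e = ratio K′>0 ε>0
    in ≤ᴿ-trans (h δ δ>0) (+-monoʳ-≤ y (≤ᴿ-trans
         (≈-≤ (≈-sym (ι-* (ℚℕ K) δ)) (ι-mono-≤ (ℚₚ.*-monoʳ-≤-nonNeg δ ⦃ ℚ.nonNegative (ℚₚ.<⇒≤ δ>0) ⦄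
             (ℚℕ-mono-≤ (ℕₚ.n≤1+n K)))))
         (≈⇒≤ (≈-reflexive (cong ι e)))))

  opaque
    unfolding _+_

    ∑-lookup : ∀ (xs : List A) (f : A → ℝ) → ∑ (λ i → f (lookup xs i)) ≈ᴿ Sum xs f
    ∑-lookup []       f = ≈-refl
    ∑-lookup (x ∷ xs) f = +ᴿ-cong {f x} {f x} {∑ (λ i → f (lookup xs i))} {Sum xs f} ≈-refl
        (∑-lookup xs f)

open FiniteSums

open ℤ using (+_)

open ℝ-Solver using (solve; _:=_; _:+_; _:-_; _:*_; :-_; con)

-- Indicators, multiplicities and the pigeonhole principle

module Indicator {A : Set} (_≟_ : DecidableEquality A) where
  δ : A → A → ℕ
  δ x y = if does (x ≟ y) then 1 else 0

  δ-refl : ∀ x → δ x x ≡ 1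
  δ-refl x with x ≟ x
  ... | yes _  = refl
  ... | no x≢x = contradiction refl x≢x

  δ-≢ : ∀ {x y} → x ≢ y → δ x y ≡ 0
  δ-≢ {x} {y} x≢y with x ≟ y
  ... | yes x≡y = contradiction x≡y x≢y
  ... | no _    = refl

  δ≤1 : ∀ x y → δ x y ℕ.≤ 1
  δ≤1 x y with x ≟ y
  ... | yes _ = s≤s z≤n
  ... | no _  = z≤n

  count : A → List A → ℕ
  count x ys = length (filter (x ≟_) ys)

  count-∷ : ∀ x y ys → count x (y ∷ ys) ≡ δ x y ℕ.+ count x ys
  count-∷ x y ys with x ≟ y
  ... | yes _ = refl
  ... | no _  = refl

  count-++ : ∀ x ys zs → count x (ys ++ zs) ≡ count x ys ℕ.+ count x zs
  count-++ x ys zs = trans (cong length (Listₚ.filter-++ (x ≟_) ys zs))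
      (Listₚ.length-++ (filter (x ≟_) ys))

  count≤length : ∀ x ys → count x ys ℕ.≤ length ys
  count≤length x ys = Listₚ.length-filter (x ≟_) ys

  count-∉ : ∀ {x} ys → x ∉ ys → count x ys ≡ 0
  count-∉         []       _  = refl
  count-∉ {x} (y ∷ ys) x∉ = trans (count-∷ x y ys)
    (trans (cong (ℕ._+ count x ys) (δ-≢ (x∉ ∘ here))) (count-∉ ys (x∉ ∘ there)))

  count-∈ : ∀ {x ys} → Unique ys → x ∈ ys → count x ys ≡ 1
  count-∈ {x} {y ∷ ys} (y∉ ∷ u) (here refl) = trans (count-∷ x y ys)
    (cong₂ ℕ._+_ (δ-refl x) (count-∉ ys (λ i → All.lookup y∉ i refl)))
  count-∈ {x} {y ∷ ys} (y∉ ∷ u) (there i) = trans (count-∷ x y ys)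
    (cong₂ ℕ._+_ (δ-≢ (λ x≡y → All.lookup y∉ i (sym x≡y))) (count-∈ u i))

module _ {A V : Set} (_≟_ : DecidableEquality V) (h : A → V) where
  open Indicator _≟_

  Sum-δ-∉ : ∀ xs {v} (k : A → ℝ) → v ∉ map h xs → Sum xs (λ x → # δ (h x) v * k x) ≈ᴿ # 0
  Sum-δ-∉ []       k v∉ = ≈-refl
  Sum-δ-∉ (x ∷ xs) {v} k v∉ = ≈-trans (+-cong
      (≈-trans (≈-reflexive (cong (λ d → # d * k x) (δ-≢ (v∉ ∘ here ∘ sym)))) (*-zeroˡ (k x)))
      (Sum-δ-∉ xs k (v∉ ∘ there)))
    (+-identityˡ (# 0))

  -- The map `h` serves three uses: the identity on all edges, `src` along a simple cycle, and
  -- `lookup` into the list that indexes the basis.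
  Sum-δ : ∀ {xs} (k : A → ℝ) → Unique (map h xs) → ∀ {x} → x ∈ xs → Sum xs (λ y → # δ (h y) (h x) * k
      y) ≈ᴿ k x
  Sum-δ {x ∷ xs} k (x∉ ∷ u) (here refl) = ≈-trans (+-cong
      (≈-trans (≈-reflexive (cong (λ d → # d * k x) (δ-refl (h x)))) (*-identityˡ (k x)))
      (Sum-δ-∉ xs k (λ i → All.lookup x∉ i refl)))
    (+-identityʳ (k x))
  Sum-δ {y ∷ xs} k (y∉ ∷ u) {x} (there i) = ≈-trans (+-cong
      (≈-trans (≈-reflexive (cong (λ d → # d * k y) (δ-≢ (All.lookup y∉ (∈ₚ.∈-map⁺ h i)))))
          (*-zeroˡ (k y)))
      (Sum-δ k u i))
    (+-identityˡ (k x))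

lookup-injective : ∀ {A : Set} {xs : List A} → Unique xs → ∀ i j → lookup xs i ≡ lookup xs j → i ≡ j
lookup-injective (_ ∷ _)  Fin.zero    Fin.zero    _ = refl
lookup-injective (x∉ ∷ _) Fin.zero    (Fin.suc j) e = contradiction e (All.lookup x∉ (∈ₚ.∈-lookup j))
lookup-injective (x∉ ∷ _) (Fin.suc i) Fin.zero    e = contradiction (sym e)
    (All.lookup x∉ (∈ₚ.∈-lookup i))
lookup-injective (_ ∷ u)  (Fin.suc i) (Fin.suc j) e = cong Fin.suc (lookup-injective u i j e)

unique-⊆⇒length≤ : ∀ {A : Set} {xs ys : List A} → Unique xs → (∀ {x} → x ∈ xs → x ∈ ys) → length xs ℕ.≤
    length ys
unique-⊆⇒length≤ {A} {xs} {ys} u xs⊆ys = Fₚ.injective⇒≤ {f = f} f-injective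
  where
  f : Fin (length xs) → Fin (length ys)
  f i = Any.index (xs⊆ys (∈ₚ.∈-lookup i))
  f-injective : ∀ {i j} → f i ≡ f j → i ≡ j
  f-injective {i} {j} e = lookup-injective u i j (trans (Anyₚ.lookup-index (xs⊆ys (∈ₚ.∈-lookup i)))
    (trans (cong (lookup ys) e) (sym (Anyₚ.lookup-index (xs⊆ys (∈ₚ.∈-lookup j))))))

-- Flows on a finite graph and their decomposition into simple cycles

module Flows (G : Multigraph) (Es : List (Multigraph.Edge G))
             (complete : ∀ e → e ∈ Es) (unique : Unique Es)
             (_≟ⱽ_ : DecidableEquality (Multigraph.Vertex G)) where

  open Multigraph G
  open Indicator _≟ᴱ_ public
  module V = Indicator _≟ⱽ_

  private
    variable
      f f′ f₁ f₂ : Edge → ℝ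
      u v : Vertex
      es : List Edge

  χ : List Edge → Edge → ℝ
  χ es e = # count e es

  -- The bridge from walks to flows: a pairing with multiplicities can be evaluated by induction
  -- along the walk.
  Sum-χ : ∀ es (k : Edge → ℝ) → Sum Es (λ e → χ es e * k e) ≈ᴿ Sum es k
  Sum-χ []       k = ≈-trans (Sum-cong Es (λ e → *-zeroˡ (k e))) (Sum-0 Es)
  Sum-χ (e ∷ es) k = begin
    Sum Es (λ e′ → χ (e ∷ es) e′ * k e′)
      ≈⟨ Sum-cong Es (λ e′ → ≈-trans
           (*-congʳ (k e′) (≈-trans (≈-reflexive (cong #_ (count-∷ e′ e es))) (#-+ (δ e′ e) _)))
           (*-distribʳ-+ (k e′) (# δ e′ e) (χ es e′))) ⟩
    Sum Es (λ e′ → # δ e′ e * k e′ + χ es e′ * k e′)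
      ≈⟨ Sum-+ Es (λ e′ → # δ e′ e * k e′) (λ e′ → χ es e′ * k e′) ⟩
    Sum Es (λ e′ → # δ e′ e * k e′) + Sum Es (λ e′ → χ es e′ * k e′)
      ≈⟨ +-cong (Sum-δ _≟ᴱ_ id k (subst Unique (sym (Listₚ.map-id Es)) unique) (complete e))
          (Sum-χ es k) ⟩
    k e + Sum es k ∎
    where open ≈-Reasoning

  Sum-χ-total : ∀ es → Sum Es (χ es) ≈ᴿ # length es
  Sum-χ-total es = ≈-trans (Sum-cong Es (λ e → ≈-sym (*-identityʳ (χ es e))))
    (≈-trans (Sum-χ es (λ _ → # 1)) (Sum-const es))
    where
    Sum-const : ∀ es → Sum es (λ _ → # 1) ≈ᴿ # length es
    Sum-const []       = ≈-refl
    Sum-const (e ∷ es) = ≈-trans (+-congˡ (# 1) (Sum-const es)) (≈-sym (#-+ 1 (length es)))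

  -- Conservation tested against bounded potentials; the indicator of a
  -- vertex gives Kirchhoff's law there.
  Conserved : (Edge → ℝ) → Set
  Conserved f = ∀ (g : Vertex → ℕ) K → (∀ v → g v ℕ.≤ K) →
    Sum Es (λ e → # g (src e) * f e) ≈ᴿ Sum Es (λ e → # g (tgt e) * f e)

  NonNeg : (Edge → ℝ) → Set
  NonNeg f = ∀ e → # 0 ≤ᴿ f e

  record IsFlow (f : Edge → ℝ) : Set where
    field
      nonNeg    : NonNeg f
      total     : Sum Es f ≈ᴿ # 1
      conserved : Conserved f

  open IsFlow public

  pairing-cong : (w : Edge → ℝ) → (∀ e → f e ≈ᴿ f′ e) → Sum Es (λ e → w e * f e) ≈ᴿ Sum Es
      (λ e → w e * f′ e)
  pairing-cong w h = Sum-cong Es (λ e → *-congˡ (w e) (h e))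

  conserved-cong : (∀ e → f e ≈ᴿ f′ e) → Conserved f → Conserved f′
  conserved-cong h c g K b = ≈-trans (pairing-cong (#_ ∘ g ∘ src) (≈-sym ∘ h))
    (≈-trans (c g K b) (pairing-cong (#_ ∘ g ∘ tgt) h))

  pairing-‿- : (w : Edge → ℝ) (f₁ f₂ : Edge → ℝ) →
    Sum Es (λ e → w e * (f₁ e - f₂ e)) ≈ᴿ Sum Es (λ e → w e * f₁ e) - Sum Es (λ e → w e * f₂ e)
  pairing-‿- w f₁ f₂ = ≈-trans
    (Sum-cong Es λ e → solve 3 (λ w a b → w :* (a :- b) := w :* a :- w :* b) ≈-refl (w e) (f₁ e) (f₂ e))
    (Sum-‿- Es (λ e → w e * f₁ e) (λ e → w e * f₂ e))

  pairing-* : (w : Edge → ℝ) (c : ℝ) (f : Edge → ℝ) →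
    Sum Es (λ e → w e * (c * f e)) ≈ᴿ c * Sum Es (λ e → w e * f e)
  pairing-* w c f = ≈-trans
    (Sum-cong Es λ e → solve 3 (λ w c a → w :* (c :* a) := c :* (w :* a)) ≈-refl (w e) c (f e))
    (Sum-*ˡ Es c (λ e → w e * f e))

  conserved-‿- : Conserved f₁ → Conserved f₂ → Conserved (λ e → f₁ e - f₂ e)
  conserved-‿- {f₁} {f₂} c₁ c₂ g K b = ≈-trans (pairing-‿- (#_ ∘ g ∘ src) f₁ f₂)
    (≈-trans (-‿cong (c₁ g K b) (c₂ g K b)) (≈-sym (pairing-‿- (#_ ∘ g ∘ tgt) f₁ f₂)))

  conserved-* : ∀ c → Conserved f → Conserved (λ e → c * f e)
  conserved-* {f} c k g K b = ≈-trans (pairing-* (#_ ∘ g ∘ src) c f)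
    (≈-trans (*-congˡ c (k g K b)) (≈-sym (pairing-* (#_ ∘ g ∘ tgt) c f)))

  isFlow-cong : (∀ e → f e ≈ᴿ f′ e) → IsFlow f → IsFlow f′
  isFlow-cong h φ = record
    { nonNeg    = λ e → ≤-≈ (nonNeg φ e) (h e)
    ; total     = ≈-trans (Sum-cong Es (≈-sym ∘ h)) (total φ)
    ; conserved = conserved-cong h (conserved φ) }

  -- The potential telescopes; the end values change sides to avoid subtraction.
  walk-balance : (g : Vertex → ℕ) → IsWalk G u es v →
    Sum es (λ e → # g (src e)) + # g v ≈ᴿ Sum es (λ e → # g (tgt e)) + # g u
  walk-balance g [] = ≈-refl
  walk-balance {u} {e ∷ es} {v} g (refl ∷ p) = ≈-trans (+-assoc (# g u) _ _)
    (≈-trans (+-congˡ (# g u) (walk-balance g p))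
      (solve 3 (λ a s t → a :+ (s :+ t) := (t :+ s) :+ a) ≈-refl (# g u) (Sum es (λ e → # g (tgt e)))
          (# g (tgt e))))

  pairing-χ : (w : Edge → ℝ) (es : List Edge) → Sum Es (λ e → w e * χ es e) ≈ᴿ Sum es w
  pairing-χ w es = ≈-trans (Sum-cong Es λ e → *-comm (w e) (χ es e)) (Sum-χ es w)

  conserved-χ : IsWalk G u es u → Conserved (χ es)
  conserved-χ {u} {es} p g K b = ≈-trans (pairing-χ (#_ ∘ g ∘ src) es)
    (≈-trans (≈-diffᴿ (walk-balance g p)
      (solve 3 (λ a b c → a :- b := (a :+ c) :- (b :+ c)) ≈-refl (Sum es (#_ ∘ g ∘ src))
          (Sum es (#_ ∘ g ∘ tgt)) (# g u)))
      (≈-sym (pairing-χ (#_ ∘ g ∘ tgt) es)))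

  edgesOf : Cycle G → List Edge
  edgesOf C = toList (Cycle.edges C)

  weightOf : Cycle G → ℝ
  weightOf C = ι (+ 1 ℚ./ length⁺ (Cycle.edges C))

  0≤weight : ∀ C → # 0 ≤ᴿ weightOf C
  0≤weight C = ι-mono-≤ (0≤1/ (length⁺ (Cycle.edges C)))

  weight*length : ∀ C → weightOf C * # length (edgesOf C) ≈ᴿ # 1
  weight*length C = ≈-trans (≈-sym (ι-* _ _)) (≈-reflexive (cong ι (n/n≡1 (length⁺ (Cycle.edges C)))))

  cycleVector≈ : ∀ C e → cycleVector G C e ≈ᴿ weightOf C * χ (edgesOf C) e
  cycleVector≈ C e = ≈-trans
      (≈-reflexive (trans (cong fromℚ (/≡*1/ (count e (edgesOf C)) (length⁺ (Cycle.edges C))))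
          (sym (ι-def _))))
    (ι-* _ _)

  weightedCycle-isFlow : ∀ C → IsFlow (λ e → weightOf C * χ (edgesOf C) e)
  weightedCycle-isFlow C = record
    { nonNeg    = λ e → 0≤* (0≤weight C) (0≤# (count e (edgesOf C)))
    ; total     = ≈-trans (Sum-*ˡ Es (weightOf C) (χ (edgesOf C)))
                    (≈-trans (*-congˡ (weightOf C) (Sum-χ-total (edgesOf C))) (weight*length C))
    ; conserved = conserved-* (weightOf C) (conserved-χ (proj₂ (Cycle.closed C))) }

  cycleVector-isFlow : ∀ C → IsFlow (cycleVector G C)
  cycleVector-isFlow C = isFlow-cong (≈-sym ∘ cycleVector≈ C) (weightedCycle-isFlow C)

  -- Simple cycles through positive edges

  indicator-0< : ∀ v w x → # 0 <ᴿ # V.δ v w * x → v ≡ w × # 0 <ᴿ x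
  indicator-0< v w x = go (v ≟ⱽ w) refl
    where
    go : (d : Dec (v ≡ w)) → d ≡ (v ≟ⱽ w) → # 0 <ᴿ # V.δ v w * x → v ≡ w × # 0 <ᴿ x
    go (yes e) _ h = e , <-≤-transᴿ h
        (≈⇒≤ (≈-trans (≈-reflexive (cong (λ d → # d * x) (trans (cong (λ z → V.δ z w) e)
            (V.δ-refl w)))) (*-identityˡ x)))
    go (no ne) _ h = contradiction
        (<-≤-transᴿ h (≈⇒≤ (≈-trans (≈-reflexive (cong (λ d → # d * x) (V.δ-≢ ne))) (*-zeroˡ x))))
            <-irreflᴿ

  -- Test conservation with the indicator of `src e`: the outflow is at least `f e`, so the inflow
  -- is positive, and a positive sum has a positive term.
  predecessor : NonNeg f → Conserved f → ∀ {e} → # 0 <ᴿ f e → ∃[ e′ ] (tgt e′ ≡ src e × # 0 <ᴿ f e′)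
  predecessor {f} f≥0 c {e} 0<fe =
    let e′ , _ , h = 0<Sum⇒ Es (λ e′ → # g (tgt e′) * f e′) inflow>0
    in e′ , indicator-0< (tgt e′) (src e) (f e′) h
    where
    g : Vertex → ℕ
    g v = V.δ v (src e)
    outflow≥ : f e ≤ᴿ Sum Es (λ e′ → # g (src e′) * f e′)
    outflow≥ = ≈-≤ (≈-sym (≈-trans (≈-reflexive (cong (λ d → # d * f e) (V.δ-refl (src e))))
        (*-identityˡ (f e))))
      (∈⇒≤Sum (λ e′ → 0≤* (0≤# (g (src e′))) (f≥0 e′)) (complete e))
    inflow>0 : # 0 <ᴿ Sum Es (λ e′ → # g (tgt e′) * f e′)
    inflow>0 = <-≤-transᴿ (<-≤-transᴿ 0<fe outflow≥) (≈⇒≤ (c g 1 (λ v → V.δ≤1 v (src e))))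

  -- Cutting the walk at its visit to `v` leaves `v` off the earlier sources, so that an edge from
  -- `v` to the start closes the prefix to a simple cycle.
  prefix-to : ∀ {b} → IsWalk G u es b → Unique (map src es) → v ∈ map src es →
    ∃[ pre ] (IsWalk G u pre v × Unique (map src pre) × v ∉ map src pre × (∀ {e} → e ∈ pre → e ∈ es))
  prefix-to (refl ∷ p) (x ∷ xs) (here refl) = [] , [] , [] , (λ ()) , λ ()
  prefix-to {es = e ∷ es} {v} (refl ∷ p) (e∉ ∷ xs) (there i) =
    let pre , q , un , v∉ , ⊆ = prefix-to p xs i
    in e ∷ pre , refl ∷ q
       , All.tabulate (λ {w} w∈ → let e′ , e′∈ , eq = ∈ₚ.∈-map⁻ src w∈ in
           All.lookup e∉ (subst (_∈ map src es) (sym eq) (∈ₚ.∈-map⁺ src (⊆ e′∈)))) ∷ un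
       , (λ { (here v≡) → All.lookup e∉ i (sym v≡) ; (there j) → v∉ j })
       , λ { (here refl) → here refl ; (there j) → there (⊆ j) }

  SimpleCycle : Set
  SimpleCycle = Σ[ C ∈ Cycle G ] IsSimple G C

  closedWalk⇒simple : ∀ e es → IsWalk G (src e) (e ∷ es) (src e) → Unique (map src (e ∷ es)) →
      SimpleCycle
  closedWalk⇒simple e es p un = record { edges = e ∷ es ; closed = src e , p }
    , record { distinctEdges = Uniqueₚ.map⁻ un ; distinctVertices = un }

  -- Walking backwards along positive edges, some vertex repeats.
  positiveCycle : NonNeg f → Conserved f → ∀ {e} → # 0 <ᴿ f e →
    Σ[ C ∈ SimpleCycle ] (∀ {e} → e ∈ edgesOf (proj₁ C) → # 0 <ᴿ f e)
  positiveCycle {f} f≥0 c {e₀} 0<fe₀ = search (length Es) e₀ [] (refl ∷ []) ([] ∷ [])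
    (λ { (here refl) → 0<fe₀ }) (ℕₚ.≤-reflexive (ℕₚ.+-comm 1 (length Es)))
    where
    search : ∀ fuel e es → IsWalk G (src e) (e ∷ es) (tgt e₀) → Unique (map src (e ∷ es)) →
      (∀ {e′} → e′ ∈ e ∷ es → # 0 <ᴿ f e′) → length Es ℕ.< fuel ℕ.+ length (e ∷ es) →
      Σ[ C ∈ SimpleCycle ] (∀ {e} → e ∈ edgesOf (proj₁ C) → # 0 <ᴿ f e)
    -- Without fuel the walk would have more distinct edges than the graph.
    search zero e es p un pos long = contradiction
      (unique-⊆⇒length≤ (Uniqueₚ.map⁻ un) (λ {x} _ → complete x)) (ℕₚ.<⇒≱ long)
    search (suc fuel) e es p un pos long = continue (predecessor f≥0 c (pos (here refl)))
      where
      continue : ∃[ e′ ] (tgt e′ ≡ src e × # 0 <ᴿ f e′) → _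
      continue (e′ , t≡s , 0<fe′) = decide (src e′ ∈? map src (e ∷ es))
        where
        open ∈Dec _≟ⱽ_ using (_∈?_)
        decide : Dec (src e′ ∈ map src (e ∷ es)) → _
        decide (yes i) =
          let pre , q , un′ , ∉pre , ⊆ = prefix-to p un i
          in closedWalk⇒simple e′ pre (refl ∷ subst (λ w → IsWalk G w pre (src e′)) (sym t≡s) q)
               (All.tabulate (λ w∈ w≡ → ∉pre (subst (_∈ map src pre) (sym w≡) w∈)) ∷ un′)
             , λ { (here refl) → 0<fe′ ; (there j) → pos (⊆ j) }
        decide (no ∉) = search fuel e′ (e ∷ es)
          (refl ∷ subst (λ w → IsWalk G w (e ∷ es) (tgt e₀)) (sym t≡s) p)
          (All.tabulate (λ w∈ w≡ → ∉ (subst (_∈ map src (e ∷ es)) (sym w≡) w∈)) ∷ un)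
          (λ { (here refl) → 0<fe′ ; (there j) → pos j })
          (subst (length Es ℕ.<_) (sym (ℕₚ.+-suc fuel (length (e ∷ es)))) long)

  -- Enumerating the simple cycles

  isWalk? : ∀ u es v → Dec (IsWalk G u es v)
  isWalk? u []       v = map′ (λ { refl → [] }) (λ { [] → refl }) (u ≟ⱽ v)
  isWalk? u (e ∷ es) v = map′ (λ { (p , q) → p ∷ q }) (λ { (p ∷ q) → p , q })
    ((src e ≟ⱽ u) ×-dec isWalk? (tgt e) es v)

  SimplyClosed : List⁺ Edge → Set
  SimplyClosed (e ∷ es) = IsWalk G (src e) (e ∷ es) (src e) × Unique (map src (e ∷ es))

  simplyClosed? : ∀ es → Dec (SimplyClosed es)
  simplyClosed? (e ∷ es) = isWalk? (src e) (e ∷ es) (src e) ×-dec UniqueDec.unique? _≟ⱽ_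
      (map src (e ∷ es))

  simplyClosed : ((C , _) : SimpleCycle) → SimplyClosed (Cycle.edges C)
  simplyClosed (record { edges = e ∷ es ; closed = v , refl ∷ p } , s) = refl ∷ p ,
      IsSimple.distinctVertices s

  collect : List (List⁺ Edge) → List SimpleCycle
  collect []       = []
  collect ((e ∷ es) ∷ ess) with simplyClosed? (e ∷ es)
  ... | yes (p , un) = closedWalk⇒simple e es p un ∷ collect ess
  ... | no _         = collect ess

  ∈-collect : ∀ {ess} es → SimplyClosed es → es ∈ ess → ∃[ C ] (C ∈ collect ess × Cycle.edges (proj₁ C)
      ≡ es)
  ∈-collect {ess = (e ∷ es) ∷ ess} _ s (here refl) with simplyClosed? (e ∷ es)
  ... | yes _ = _ , here refl , refl
  ... | no ¬s = contradiction s ¬s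
  ∈-collect {ess = (e ∷ es) ∷ ess} es′ s (there i) with simplyClosed? (e ∷ es) | ∈-collect es′ s i
  ... | yes _ | C , C∈ , eq = C , there C∈ , eq
  ... | no _  | C , C∈ , eq = C , C∈ , eq

  listsOfLength≤ : ℕ → List (List Edge)
  listsOfLength≤ zero    = [] ∷ []
  listsOfLength≤ (suc n) = [] ∷ concat (map (λ e → map (e ∷_) (listsOfLength≤ n)) Es)

  ∈-listsOfLength≤ : ∀ n es → length es ℕ.≤ n → es ∈ listsOfLength≤ n
  ∈-listsOfLength≤ zero    []       _       = here refl
  ∈-listsOfLength≤ (suc n) []       _       = here refl
  ∈-listsOfLength≤ (suc n) (e ∷ es) (s≤s l) = there (∈ₚ.∈-concat⁺′
    (∈ₚ.∈-map⁺ (e ∷_) (∈-listsOfLength≤ n es l))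
    (∈ₚ.∈-map⁺ (λ e → map (e ∷_) (listsOfLength≤ n)) (complete e)))

  simpleCycles : List SimpleCycle
  simpleCycles = collect (concat (map (λ e → map (e ∷_) (listsOfLength≤ (length Es))) Es))

  -- Distinct edges bound the length by `length Es`, so a finite search suffices. Cycles are matched
  -- by their edges alone, because the accompanying proofs may differ.
  simpleCycles-complete : ∀ C → ∃[ C′ ] (C′ ∈ simpleCycles × Cycle.edges (proj₁ C′) ≡ Cycle.edges
      (proj₁ C))
  simpleCycles-complete C@(record { edges = e ∷ es } , s) = ∈-collect (e ∷ es) (simplyClosed C)
    (∈ₚ.∈-concat⁺′ (∈ₚ.∈-map⁺ (e ∷_) (∈-listsOfLength≤ (length Es) es
        (ℕₚ.≤-trans (ℕₚ.n≤1+n _) (unique-⊆⇒length≤ (IsSimple.distinctEdges s) (λ {x} _ → complete x)))))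
      (∈ₚ.∈-map⁺ (λ e → map (e ∷_) (listsOfLength≤ (length Es))) (complete e)))

  -- Decomposition into simple cycles

  minimum : (Edge → ℝ) → Edge → List Edge → ℝ
  minimum f e []        = f e
  minimum f e (e′ ∷ es) = f e ⊓ minimum f e′ es

  minimum-≤ : ∀ f e es {e′} → e′ ∈ e ∷ es → minimum f e es ≤ᴿ f e′
  minimum-≤ f e []        (here refl) = ≤ᴿ-refl
  minimum-≤ f e (e′ ∷ es) (here refl) = ⊓-≤ˡ (f e) _
  minimum-≤ f e (e′ ∷ es) (there i)   = ≤ᴿ-trans (⊓-≤ʳ (f e) _) (minimum-≤ f e′ es i)

  minimum-glb : ∀ f e es {x} → (∀ {e′} → e′ ∈ e ∷ es → x ≤ᴿ f e′) → x ≤ᴿ minimum f e es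
  minimum-glb f e []        h = h (here refl)
  minimum-glb f e (e′ ∷ es) h = ⊓-glb (h (here refl)) (minimum-glb f e′ es (h ∘ there))

  minimum-glb-< : ∀ f e es {x} → (∀ {e′} → e′ ∈ e ∷ es → x <ᴿ f e′) → x <ᴿ minimum f e es
  minimum-glb-< f e []        h = h (here refl)
  minimum-glb-< f e (e′ ∷ es) h = ⊓-glb-< (h (here refl)) (minimum-glb-< f e′ es (h ∘ there))

  χ-simple-∈ : ((C , _) : SimpleCycle) → ∀ {e} → e ∈ edgesOf C → χ (edgesOf C) e ≈ᴿ # 1
  χ-simple-∈ (C , s) i = ≈-reflexive (cong #_ (count-∈ (IsSimple.distinctEdges s) i))

  χ-∉ : ∀ {e} es → e ∉ es → χ es e ≈ᴿ # 0
  χ-∉ es e∉ = ≈-reflexive (cong #_ (count-∉ es e∉))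

  open ∈Dec _≟ᴱ_ using (_∈?_)

  *χ≤ : NonNeg f → ((C , s) : SimpleCycle) → ∀ {t} → (∀ {e} → e ∈ edgesOf C → t ≤ᴿ f e) → ∀ e → t * χ
      (edgesOf C) e ≤ᴿ f e
  *χ≤ {f} f≥0 C@(C₀ , _) {t} h e = decide (e ∈? edgesOf C₀)
    where
    decide : Dec (e ∈ edgesOf C₀) → t * χ (edgesOf C₀) e ≤ᴿ f e
    decide (yes i) = ≈-≤ (≈-trans (*-congˡ t (χ-simple-∈ C i)) (*-identityʳ t)) (h i)
    decide (no ∉)  = ≈-≤ (≈-trans (*-congˡ t (χ-∉ (edgesOf C₀) ∉)) (*-zeroʳ t)) (f≥0 e)

  Weighted : Set
  Weighted = ℝ × SimpleCycle

  combination : List Weighted → Edge → ℝ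
  combination ws e = Sum ws (λ { (m , C , _) → m * χ (edgesOf C) e })

  -- `exhausted` is a negation because positivity is not decided. `residue≤` makes the exhaustion of
  -- one cycle persist while later cycles are subtracted.
  record Residual (cs : List SimpleCycle) (f : Edge → ℝ) : Set where
    field
      residue       : Edge → ℝ
      parts         : List Weighted
      parts≥0       : All (λ w → # 0 ≤ᴿ proj₁ w) parts
      decomposition : ∀ e → f e ≈ᴿ combination parts e + residue e
      residue≥0     : NonNeg residue
      residue-cons  : Conserved residue
      residue≤      : ∀ e → residue e ≤ᴿ f e
      exhausted     : ∀ {C} → C ∈ cs → ¬ (∀ {e} → e ∈ edgesOf (proj₁ C) → # 0 <ᴿ residue e)

  -- Subtracting the minimum of f along each simple cycle in turn depends
  -- continuously on f, so it makes sense for real flows.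
  subtractAll : ∀ cs {f} → NonNeg f → Conserved f → Residual cs f
  subtractAll [] {f} f≥0 c = record
    { residue = f ; parts = [] ; parts≥0 = [] ; decomposition = λ e → ≈-sym (+-identityˡ (f e))
    ; residue≥0 = f≥0 ; residue-cons = c ; residue≤ = λ e → ≤ᴿ-refl ; exhausted = λ () }
  subtractAll (C@(C₀ , s) ∷ cs) {f} f≥0 c = record
    { residue = residue ; parts = (m , C) ∷ parts
    ; parts≥0 = minimum-glb f (List⁺.head (Cycle.edges C₀)) (List⁺.tail (Cycle.edges C₀))
        (λ {e} _ → f≥0 e) ∷ parts≥0
    ; decomposition = λ e → ≈-trans
        (solve 2 (λ a b → a := b :+ (a :- b)) ≈-refl (f e) (m * χ (edgesOf C₀) e))
        (≈-trans (+-congˡ (m * χ (edgesOf C₀) e) (decomposition e))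
            (≈-sym (+-assoc (m * χ (edgesOf C₀) e) _ _)))
    ; residue≥0 = residue≥0 ; residue-cons = residue-cons
    ; residue≤ = λ e → ≤ᴿ-trans (residue≤ e) (0≤-⇒≤ (≤-≈ (0≤* m≥0 (0≤# (count e (edgesOf C₀))))
        (solve 2 (λ a b → b := a :- (a :- b)) ≈-refl (f e) (m * χ (edgesOf C₀) e))))
    -- If the final residue were positive along this cycle, `f` would exceed `m` on all its edges,
    -- and so would its minimum there, which is `m` itself.
    ; exhausted = λ { (here refl) pos → <-irreflᴿ (minimum-glb-< f (List⁺.head (Cycle.edges C₀))
        (List⁺.tail (Cycle.edges C₀)) (λ {e} i →
          0<-⇒<ᴿ (<-≤-transᴿ (pos i) (≤-≈ (residue≤ e) (-‿cong (≈-refl {f e})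
            (≈-trans (*-congˡ m (χ-simple-∈ C i)) (*-identityʳ m)))))))
        ; (there i) → exhausted i } }
    where
    m = minimum f (List⁺.head (Cycle.edges C₀)) (List⁺.tail (Cycle.edges C₀))
    m≥0 : # 0 ≤ᴿ m
    m≥0 = minimum-glb f (List⁺.head (Cycle.edges C₀)) (List⁺.tail (Cycle.edges C₀)) (λ {e} _ → f≥0 e)
    f₁≥0 : NonNeg (λ e → f e - m * χ (edgesOf C₀) e)
    f₁≥0 e = ≤⇒0≤- (*χ≤ f≥0 C (minimum-≤ f (List⁺.head (Cycle.edges C₀)) (List⁺.tail (Cycle.edges C₀)))
        e)
    c₁ : Conserved (λ e → f e - m * χ (edgesOf C₀) e)
    c₁ = conserved-‿- c (conserved-* m (conserved-χ (proj₂ (Cycle.closed C₀))))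
    open Residual (subtractAll cs f₁≥0 c₁)

  -- A positive entry of the residue would lie in a simple cycle of positive entries, but every
  -- simple cycle is exhausted. A residue that is nonnegative and nowhere positive vanishes.
  decompose : NonNeg f → Conserved f → Σ[ ws ∈ List Weighted ] (All (λ w → # 0 ≤ᴿ proj₁ w) ws × ∀ e → f
      e ≈ᴿ combination ws e)
  decompose {f} f≥0 c = parts , parts≥0 , λ e → ≈-trans (decomposition e)
      (≈-trans (+-congˡ (combination parts e) (≤ᴿ-antisym (≮⇒≥ᴿ (residue≯0 e)) (residue≥0 e)))
          (+-identityʳ _))
    where
    open Residual (subtractAll simpleCycles f≥0 c)
    residue≯0 : ∀ e → ¬ (# 0 <ᴿ residue e)
    residue≯0 e 0<r =
      let C , pos = positiveCycle residue≥0 residue-cons 0<r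
          C′ , C′∈ , eq = simpleCycles-complete C
      in exhausted C′∈ (λ i → pos (subst (λ es → _ ∈ toList es) eq i))

  module _ {f : Edge → ℝ} (φ : IsFlow f) (C : SimpleCycle)
           (supported : ∀ e → e ∉ edgesOf (proj₁ C) → f e ≈ᴿ # 0) where
    private
      C₀ = proj₁ C
      es₀ = edgesOf C₀

    Sum-support : (w : Edge → ℝ) → Sum Es (λ e → w e * f e) ≈ᴿ Sum es₀ (λ e → w e * f e)
    Sum-support w = ≈-trans (Sum-cong Es (λ e → decide e (e ∈? es₀))) (Sum-χ es₀ (λ e → w e * f e))
      where
      decide : ∀ e → Dec (e ∈ es₀) → w e * f e ≈ᴿ χ es₀ e * (w e * f e)
      decide e (yes i) = ≈-sym (≈-trans (*-congʳ (w e * f e) (χ-simple-∈ C i))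
          (*-identityˡ (w e * f e)))
      decide e (no ∉)  = ≈-trans zero′ (≈-sym (≈-trans (*-congˡ (χ es₀ e) zero′) (*-zeroʳ (χ es₀ e))))
        where
        zero′ : w e * f e ≈ᴿ # 0
        zero′ = ≈-trans (*-congˡ (w e) (supported e ∉)) (*-zeroʳ (w e))

    -- Test conservation at the vertex between the two edges. The inflow is at least `f e`; the
    -- outflow is just `f e′`, since a simple cycle leaves the vertex once and `f` vanishes off the
    -- cycle.
    consecutive : ∀ {e e′} → e ∈ es₀ → e′ ∈ es₀ → tgt e ≡ src e′ → f e ≤ᴿ f e′
    consecutive {e} {e′} i i′ t≡s = ≤-≈ (≈-≤
        (≈-sym (≈-trans (≈-reflexive (cong (λ d → # d * f e) (trans (cong (λ v → V.δ v (src e′)) t≡s)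
            (V.δ-refl (src e′))))) (*-identityˡ (f e))))
        (∈⇒≤Sum (λ e″ → 0≤* (0≤# (V.δ (tgt e″) (src e′))) (nonNeg φ e″)) i))
      (≈-trans (≈-sym (Sum-support (λ e″ → # V.δ (tgt e″) (src e′))))
        (≈-trans (≈-sym (conserved φ (λ v → V.δ v (src e′)) 1 (λ v → V.δ≤1 v (src e′))))
          (≈-trans (Sum-support (λ e″ → # V.δ (src e″) (src e′)))
            (Sum-δ _≟ⱽ_ src f (IsSimple.distinctVertices (proj₂ C)) i′))))

    first≤ : ∀ {u e es v} → IsWalk G u (e ∷ es) v → (∀ {e′} → e′ ∈ e ∷ es → e′ ∈ es₀) →
             ∀ {e′} → e′ ∈ e ∷ es → f e ≤ᴿ f e′
    first≤ p ⊆ (here refl) = ≤ᴿ-refl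
    first≤ {es = e″ ∷ es} (p ∷ q ∷ r) ⊆ (there i) = ≤ᴿ-trans
      (consecutive (⊆ (here refl)) (⊆ (there (here refl))) (sym q)) (first≤ (q ∷ r) (⊆ ∘ there) i)

    ≤next : ∀ {u es b e₁} → IsWalk G u es b → b ≡ src e₁ → e₁ ∈ es₀ → (∀ {e′} → e′ ∈ es → e′ ∈ es₀) →
            ∀ {e′} → e′ ∈ es → f e′ ≤ᴿ f e₁
    ≤next (p ∷ [])    b≡ e₁∈ ⊆ (here refl) = consecutive (⊆ (here refl)) e₁∈ b≡
    ≤next (p ∷ q ∷ r) b≡ e₁∈ ⊆ (here refl) = ≤ᴿ-trans
      (consecutive (⊆ (here refl)) (⊆ (there (here refl))) (sym q)) (≤next (q ∷ r) b≡ e₁∈ (⊆ ∘ there)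
          (here refl))
    ≤next (p ∷ q)     b≡ e₁∈ ⊆ (there i)   = ≤next q b≡ e₁∈ (⊆ ∘ there) i

    supported⇒≈cycle : ∀ e → f e ≈ᴿ weightOf C₀ * χ es₀ e
    supported⇒≈cycle = go (Cycle.edges C₀) refl (simplyClosed C)
      where
      go : ∀ es → Cycle.edges C₀ ≡ es → SimplyClosed es → ∀ e → f e ≈ᴿ weightOf C₀ * χ es₀ e
      go (e₁ ∷ es) eq (p , _) e = decide (e ∈? es₀)
        where
        ⊆ : ∀ {e} → e ∈ e₁ ∷ es → e ∈ es₀
        ⊆ {e} = subst (λ xs → e ∈ toList xs) (sym eq)
        ⊇ : ∀ {e} → e ∈ es₀ → e ∈ e₁ ∷ es
        ⊇ {e} = subst (λ xs → e ∈ toList xs) eq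
        -- One inequality per step suffices on a cycle: follow it from `e₁` to `e`, and then from
        -- `e` back to `e₁`.
        constant : ∀ {e} → e ∈ es₀ → f e ≈ᴿ f e₁
        constant i = ≤ᴿ-antisym (≤next p refl (⊆ (here refl)) ⊆ (⊇ i)) (first≤ p ⊆ (⊇ i))
        1≈ : # 1 ≈ᴿ # length es₀ * f e₁
        1≈ = begin
          # 1                             ≈⟨ total φ ⟨
          Sum Es f                        ≈⟨ Sum-cong Es (λ e → *-identityˡ (f e)) ⟨
          Sum Es (λ e → # 1 * f e)        ≈⟨ Sum-support (λ _ → # 1) ⟩
          Sum es₀ (λ e → # 1 * f e)       ≈⟨ Sum-cong-∈ es₀ (λ {e} i → ≈-trans (*-comm (# 1) (f e))
              (*-congʳ (# 1) (constant i))) ⟩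
          Sum es₀ (λ e → f e₁ * # 1)      ≈⟨ Sum-*ˡ es₀ (f e₁) (λ _ → # 1) ⟩
          f e₁ * Sum es₀ (λ _ → # 1)      ≈⟨ *-congˡ (f e₁) (Sum-cong es₀ λ _ → ≈-refl) ⟩
          f e₁ * Sum es₀ (λ _ → # 1)      ≈⟨ *-congˡ (f e₁) (≈-trans (≈-sym (Sum-χ es₀ (λ _ → # 1)))
                                               (≈-trans (Sum-cong Es λ e → *-identityʳ (χ es₀ e))
                                                   (Sum-χ-total es₀))) ⟩
          f e₁ * # length es₀             ≈⟨ *-comm (f e₁) (# length es₀) ⟩
          # length es₀ * f e₁             ∎
          where open ≈-Reasoning
        f₁≈ : f e₁ ≈ᴿ weightOf C₀
        f₁≈ = begin
          f e₁                                    ≈⟨ *-identityˡ (f e₁) ⟨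
          # 1 * f e₁                              ≈⟨ *-congʳ (f e₁) (weight*length C₀) ⟨
          (weightOf C₀ * # length es₀) * f e₁     ≈⟨ *-assoc (weightOf C₀) (# length es₀) (f e₁) ⟩
          weightOf C₀ * (# length es₀ * f e₁)     ≈⟨ *-congˡ (weightOf C₀) 1≈ ⟨
          weightOf C₀ * # 1                       ≈⟨ *-identityʳ (weightOf C₀) ⟩
          weightOf C₀                             ∎
          where open ≈-Reasoning
        decide : Dec (e ∈ es₀) → f e ≈ᴿ weightOf C₀ * χ es₀ e
        decide (yes i) = ≈-trans (constant i) (≈-trans f₁≈ (≈-sym
          (≈-trans (*-congˡ (weightOf C₀) (χ-simple-∈ C i)) (*-identityʳ (weightOf C₀)))))
        decide (no ∉) = ≈-trans (supported e ∉) (≈-sym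
          (≈-trans (*-congˡ (weightOf C₀) (χ-∉ es₀ ∉)) (*-zeroʳ (weightOf C₀))))

opaque
  unfolding _+_

  from+ᴿ : ∀ {x y ε} → x ≤ᴿ y +ᴿ fromℚ ε → x ≤ᴿ y + ι ε
  from+ᴿ h = h

  to+ᴿ : ∀ {x y ε} → x ≤ᴿ y + ι ε → x ≤ᴿ y +ᴿ fromℚ ε
  to+ᴿ h = h

0ᴿ≈ : # 0 ≈ᴿ 0ᴿ
0ᴿ≈ = ≈-reflexive (ι-def 0ℚ)

1ᴿ≈ : # 1 ≈ᴿ 1ᴿ
1ᴿ≈ = ≈-reflexive (ι-def 1ℚ)

#-cancel-≤ : ∀ {m n} → # m ≤ᴿ # n → m ℕ.≤ n
#-cancel-≤ {m} {n} h with m ℕₚ.≤? n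
... | yes p = p
... | no ¬p = ⊥-elim (<-irreflᴿ (+gap⇒< {x = # n} 0<1ℚ (≤ᴿ-trans (≈-≤ (+-comm (# n) (# 1))
  (≈-≤ (≈-sym (#-+ 1 n)) (#-mono-≤ (ℕₚ.≰⇒> ¬p)))) h)))

1/_ : (n : ℕ) → .⦃ NonZero n ⦄ → ℝ
1/ n = ι (+ 1 ℚ./ n)

0≤1/ᴿ : ∀ n .⦃ _ : NonZero n ⦄ → # 0 ≤ᴿ 1/ n
0≤1/ᴿ n = ι-mono-≤ (0≤1/ n)

1/*# : ∀ n .⦃ _ : NonZero n ⦄ → 1/ n * # n ≈ᴿ # 1
1/*# n = ≈-trans (≈-sym (ι-* (+ 1 ℚ./ n) (ℚℕ n))) (≈-reflexive (cong ι (n/n≡1 n)))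

*1/ : ∀ n .⦃ _ : NonZero n ⦄ x → 1/ n * (# n * x) ≈ᴿ x
*1/ n x = ≈-trans (≈-sym (*-assoc (1/ n) (# n) x)) (≈-trans (*-congʳ x (1/*# n)) (*-identityˡ x))

/≈ : ∀ c n .⦃ _ : NonZero n ⦄ → fromℚ (+ c ℚ./ n) ≈ᴿ 1/ n * # c
/≈ c n = ≈-trans (≈-reflexive (trans (cong fromℚ (/≡*1/ c n)) (sym (ι-def ((+ 1 ℚ./ n) ℚ.* ℚℕ c)))))
  (ι-* (+ 1 ℚ./ n) (ℚℕ c))

-- The threshold is a natural number at least `K / ε`, with `J` the inverse of `ε`.
small : ∀ K ε → 0ℚ ℚ.< ε → ∃[ N ] (∀ n .⦃ _ : NonZero n ⦄ → N ℕ.≤ n → 1/ n * # K ≤ᴿ ι ε)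
small K ε ε>0 =
  let J , J>0 , εJ = inverse ε>0
      N , le = archimedean (J ℚ.* ℚℕ K)
  in N , λ n N≤n → ≤-≈ (*-monoˡ-≤ (0≤1/ᴿ n) (≈-≤
        (≈-trans (≈-trans (≈-sym (*-identityˡ (# K)))
            (*-congʳ (# K) (≈-sym (≈-trans (≈-sym (ι-* ε J)) (≈-reflexive (cong ι εJ))))))
          (*-assoc (ι ε) (ι J) (# K)))
        (*-monoˡ-≤ (ι-mono-≤ (ℚₚ.<⇒≤ ε>0)) (≈-≤ (≈-sym (ι-* J (ℚℕ K))) (≤ᴿ-trans (ι-mono-≤ le)
            (#-mono-≤ N≤n))))))
      (≈-trans (*-congˡ (1/ n) (*-comm (ι ε) (# n))) (*1/ n (ι ε)))

eventually-∈ : ∀ {A : Set} (xs : List A) {P : A → ℕ → Set} → (∀ x → Eventually (P x)) →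
               Eventually (λ n → ∀ {x} → x ∈ xs → P x n)
eventually-∈ []       h = 0 , λ _ ()
eventually-∈ (x ∷ xs) h = eventually-zip (λ { n p q (here refl) → p ; n p q (there i) → q i }) (h x)
    (eventually-∈ xs h)

-- Flows as limits of long walks, and walks following a flow

module Sampling (G : Multigraph) (Es : List (Multigraph.Edge G))
                (complete : ∀ e → e ∈ Es) (unique : Unique Es)
                (_≟ⱽ_ : DecidableEquality (Multigraph.Vertex G)) (L : ℕ) where

  open Multigraph G
  open Flows G Es complete unique _≟ⱽ_

  -- A vector is sampled to precision ε by a walk of n - L edges, counts being divided by n.
  record Sample (v : Edge → ℝ) (ε : ℚ) : Set where
    field
      edges   : List Edge
      {a b}   : Vertex
      isWalk  : IsWalk G a edges b
      n       : ℕ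
      ⦃ n≢0 ⦄ : NonZero n
      length≡ : length edges ℕ.+ L ≡ n
      1/n≤ε   : 1/ n ≤ᴿ ι ε
      above   : ∀ e → v e ≤ᴿ 1/ n * χ edges e + ι ε
      below   : ∀ e → 1/ n * χ edges e ≤ᴿ v e + ι ε

  module _ {v : Edge → ℝ} {ε : ℚ} (s : Sample v ε) where
    open Sample s

    mass≤1 : 1/ n * # length edges ≤ᴿ # 1
    mass≤1 = ≤-≈ (*-monoˡ-≤ (0≤1/ᴿ n)
      (#-mono-≤ (ℕₚ.≤-trans (ℕₚ.m≤m+n (length edges) L) (ℕₚ.≤-reflexive length≡)))) (1/*# n)

    -- The `L` positions at which no window starts cost `L / n`, and `1 / n` is at most `ε`.
    1≤mass+ : # 1 ≤ᴿ 1/ n * # length edges + # L * ι ε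
    1≤mass+ = ≈-≤ (begin
        # 1                                   ≈⟨ 1/*# n ⟨
        1/ n * # n                            ≈⟨ *-congˡ (1/ n) (≈-reflexive (cong #_ (sym length≡))) ⟩
        1/ n * # (length edges ℕ.+ L)         ≈⟨ *-congˡ (1/ n) (#-+ (length edges) L) ⟩
        1/ n * (# length edges + # L)         ≈⟨ *-distribˡ-+ (1/ n) (# length edges) (# L) ⟩
        1/ n * # length edges + 1/ n * # L    ≈⟨ +-congˡ (1/ n * # length edges) (*-comm (1/ n) (# L)) ⟩
        1/ n * # length edges + # L * 1/ n    ∎)
      (+-monoʳ-≤ (1/ n * # length edges) (*-monoˡ-≤ (0≤# L) 1/n≤ε))
      where open ≈-Reasoning

  module _ {v : Edge → ℝ} {ε : ℚ} (ε>0 : 0ℚ ℚ.< ε) (s : Sample v ε) (h : Edge → ℕ) where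
    open Sample s
    private
      -- An error of `ε` on every edge changes the pairing with `h` by `M ε`.
      M = sum (map h Es)

    pairing-ε : (f : Edge → ℝ) → Sum Es (λ e → # h e * (f e + ι ε)) ≈ᴿ Sum Es (λ e → # h e * f e) + # M
        * ι ε
    pairing-ε f = begin
      Sum Es (λ e → # h e * (f e + ι ε))
        ≈⟨ Sum-cong Es (λ e → solve 3 (λ h f ε → h :* (f :+ ε) := h :* f :+ ε :* h) ≈-refl (# h e)
            (f e) (ι ε)) ⟩
      Sum Es (λ e → # h e * f e + ι ε * # h e)
        ≈⟨ Sum-+ Es (λ e → # h e * f e) (λ e → ι ε * # h e) ⟩
      Sum Es (λ e → # h e * f e) + Sum Es (λ e → ι ε * # h e)
        ≈⟨ +-congˡ (Sum Es (λ e → # h e * f e)) (≈-trans (Sum-*ˡ Es (ι ε) (#_ ∘ h))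
             (≈-trans (*-congˡ (ι ε) (Sum-# Es h)) (*-comm (ι ε) (# M)))) ⟩
      Sum Es (λ e → # h e * f e) + # M * ι ε ∎
      where open ≈-Reasoning

    pairing-sample : Sum Es (λ e → # h e * (1/ n * χ edges e)) ≈ᴿ 1/ n * Sum edges (#_ ∘ h)
    pairing-sample = ≈-trans (pairing-* (#_ ∘ h) (1/ n) (χ edges))
        (*-congˡ (1/ n) (pairing-χ (#_ ∘ h) edges))

    pairing-above : Sum Es (λ e → # h e * v e) ≤ᴿ 1/ n * Sum edges (#_ ∘ h) + # M * ι ε
    pairing-above = ≤-≈ (Sum-mono-≤ Es (λ e → *-monoˡ-≤ (0≤# (h e)) (above e)))
      (≈-trans (pairing-ε (λ e → 1/ n * χ edges e)) (+-congʳ (# M * ι ε) pairing-sample))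

    pairing-below : 1/ n * Sum edges (#_ ∘ h) ≤ᴿ Sum Es (λ e → # h e * v e) + # M * ι ε
    pairing-below = ≈-≤ (≈-sym pairing-sample)
      (≤-≈ (Sum-mono-≤ Es (λ e → *-monoˡ-≤ (0≤# (h e)) (below e))) (pairing-ε v))

  -- A comparison that holds along every walk up to a constant passes to the limit, as the constant
  -- is divided by the size. Applied to a potential at sources and at targets, in both orders, it
  -- yields conservation.
  limit-≤ : ∀ {v} → (∀ ε → 0ℚ ℚ.< ε → Sample v ε) → (h₁ h₂ : Edge → ℕ) (K : ℕ) →
    (∀ {es a b} → IsWalk G a es b → Sum es (#_ ∘ h₁) ≤ᴿ Sum es (#_ ∘ h₂) + # K) →
    Sum Es (λ e → # h₁ e * v e) ≤ᴿ Sum Es (λ e → # h₂ e * v e)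
  limit-≤ {v} samples h₁ h₂ K along = ≤-from-* {K = (M₁ ℕ.+ K) ℕ.+ M₂} λ ε ε>0 →
    ≤-≈ (≤ᴿ-trans (pairing-above ε>0 (samples ε ε>0) h₁) (+-monoˡ-≤ (# M₁ * ι ε)
        (mass-≤ ε>0 (samples ε ε>0))))
      (≈-trans (solve 5 (λ s m₁ m₂ k ε → ((s :+ m₂ :* ε) :+ k :* ε) :+ m₁ :* ε := s :+
          ((m₁ :+ k) :+ m₂) :* ε) ≈-refl
          S₂ (# M₁) (# M₂) (# K) (ι ε))
        (+-congˡ S₂ (*-congʳ (ι ε) (≈-sym (≈-trans (#-+ (M₁ ℕ.+ K) M₂) (+-congʳ (# M₂) (#-+ M₁ K)))))))
    where
    M₁ = sum (map h₁ Es)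
    M₂ = sum (map h₂ Es)
    S₂ = Sum Es (λ e → # h₂ e * v e)
    module _ {ε : ℚ} (ε>0 : 0ℚ ℚ.< ε) (s : Sample v ε) where
      open Sample s
      mass-≤ : 1/ n * Sum edges (#_ ∘ h₁) ≤ᴿ (S₂ + # M₂ * ι ε) + # K * ι ε
      mass-≤ = ≤ᴿ-trans (*-monoˡ-≤ (0≤1/ᴿ n) (along isWalk))
        (≈-≤ (*-distribˡ-+ (1/ n) (Sum edges (#_ ∘ h₂)) (# K))
          (+-mono-≤ (pairing-below ε>0 s h₂)
            (≈-≤ (*-comm (1/ n) (# K)) (*-monoˡ-≤ (0≤# K) 1/n≤ε))))

  module _ (g : Vertex → ℕ) (K : ℕ) (bounded : ∀ v → g v ℕ.≤ K) where
    src≤tgt : ∀ {es a b} → IsWalk G a es b → Sum es (λ e → # g (src e)) ≤ᴿ Sum es (λ e → # g (tgt e)) +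
        # K
    src≤tgt {es} {a} {b} p = ≤ᴿ-trans (≈-≤ (≈-sym (+-identityʳ _)) (+-monoʳ-≤ _ (0≤# (g b))))
      (≈-≤ (walk-balance g p) (+-monoʳ-≤ _ (#-mono-≤ (bounded a))))

    tgt≤src : ∀ {es a b} → IsWalk G a es b → Sum es (λ e → # g (tgt e)) ≤ᴿ Sum es (λ e → # g (src e)) +
        # K
    tgt≤src {es} {a} {b} p = ≤ᴿ-trans (≈-≤ (≈-sym (+-identityʳ _)) (+-monoʳ-≤ _ (0≤# (g a))))
      (≈-≤ (≈-sym (walk-balance g p)) (+-monoʳ-≤ _ (#-mono-≤ (bounded b))))

  sampled⇒flow : ∀ {f} → NonNeg f → (∀ ε → 0ℚ ℚ.< ε → Sample f ε) → IsFlow f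
  sampled⇒flow {f} f≥0 samples = record
    { nonNeg    = f≥0
    ; total     = ≈-trans (≈-sym total′) (≤ᴿ-antisym total≤1 1≤total)
    ; conserved = λ g K b → ≤ᴿ-antisym
        (limit-≤ samples (g ∘ src) (g ∘ tgt) K (src≤tgt g K b))
        (limit-≤ samples (g ∘ tgt) (g ∘ src) K (tgt≤src g K b)) }
    where
    one : Edge → ℕ
    one _ = 1
    total′ : Sum Es (λ e → # 1 * f e) ≈ᴿ Sum Es f
    total′ = Sum-cong Es (λ e → *-identityˡ (f e))
    M = sum (map one Es)
    Sum-one : ∀ es → Sum es (#_ ∘ one) ≈ᴿ # length es
    Sum-one []       = ≈-refl
    Sum-one (e ∷ es) = ≈-trans (+-congˡ (# 1) (Sum-one es)) (≈-sym (#-+ 1 (length es)))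
    total≤1 : Sum Es (λ e → # 1 * f e) ≤ᴿ # 1
    total≤1 = ≤-from-* {K = M} λ ε ε>0 → ≤ᴿ-trans (pairing-above ε>0 (samples ε ε>0) one)
      (+-monoˡ-≤ (# M * ι ε) (≈-≤ (*-congˡ _ (Sum-one (Sample.edges (samples ε ε>0))))
          (mass≤1 (samples ε ε>0))))
    1≤total : # 1 ≤ᴿ Sum Es (λ e → # 1 * f e)
    1≤total = ≤-from-* {K = M ℕ.+ L} λ ε ε>0 →
      let S = Sum Es (λ e → # 1 * f e)
      in ≤-≈ (≤ᴿ-trans (1≤mass+ (samples ε ε>0))
          (+-monoˡ-≤ (# L * ι ε) (≈-≤ (*-congˡ _ (≈-sym (Sum-one (Sample.edges (samples ε ε>0)))))
            (pairing-below ε>0 (samples ε ε>0) one))))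
        (≈-trans (solve 4 (λ s m l ε → (s :+ m :* ε) :+ l :* ε := s :+ (m :+ l) :* ε) ≈-refl S (# M)
            (# L) (ι ε))
          (+-congˡ S (*-congʳ (ι ε) (≈-sym (#-+ M L)))))

  walk-++ : ∀ {a b c es es′} → IsWalk G a es b → IsWalk G b es′ c → IsWalk G a (es ++ es′) c
  walk-++ []      q = q
  walk-++ (e ∷ p) q = e ∷ walk-++ p q

  repeat : ℕ → List Edge → List Edge
  repeat zero    es = []
  repeat (suc a) es = es ++ repeat a es

  repeat-walk : ∀ a {u es} → IsWalk G u es u → IsWalk G u (repeat a es) u
  repeat-walk zero    p = []
  repeat-walk (suc a) p = walk-++ p (repeat-walk a p)

  count-repeat : ∀ e a es → count e (repeat a es) ≡ a ℕ.* count e es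
  count-repeat e zero    es = refl
  count-repeat e (suc a) es = trans (count-++ e es (repeat a es)) (cong (count e es ℕ.+_)
      (count-repeat e a es))

  χ-++ : ∀ es es′ e → χ (es ++ es′) e ≈ᴿ χ es e + χ es′ e
  χ-++ es es′ e = ≈-trans (≈-reflexive (cong #_ (count-++ e es es′))) (#-+ (count e es) (count e es′))

  χ-repeat : ∀ a es e → χ (repeat a es) e ≈ᴿ # a * χ es e
  χ-repeat a es e = ≈-trans (≈-reflexive (cong #_ (count-repeat e a es))) (#-* a (count e es))

  module Tours (root : Vertex) (connect : ∀ a b → Σ[ es ∈ List Edge ] IsWalk G a es b) where

    -- The error `B` must not depend on `N`, so that dividing by a size of order `N` makes it
    -- vanish.
    record Tour (ws : List Weighted) (N B : ℕ) : Set where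
      field
        edges  : List Edge
        isWalk : IsWalk G root edges root
        above  : ∀ e → χ edges e ≤ᴿ # N * combination ws e + # B
        below  : ∀ e → # N * combination ws e ≤ᴿ χ edges e + # B

    χ≤length : ∀ es e → χ es e ≤ᴿ # length es
    χ≤length es e = #-mono-≤ (count≤length e es)

    -- Go to each cycle in turn, follow it about N m times, and return to the root.
    tour : ∀ ws → All (λ w → # 0 ≤ᴿ proj₁ w) ws → Σ[ B ∈ ℕ ] (∀ N → Tour ws N B)
    tour [] [] = 0 , λ N → record
      { edges = [] ; isWalk = []
      ; above = λ e → ≈⇒≤ (solve 1 (λ n → con 0ℚ := n :* con 0ℚ :+ con 0ℚ) ≈-refl (# N))
      ; below = λ e → ≈⇒≤ (solve 1 (λ n → n :* con 0ℚ := con 0ℚ :+ con 0ℚ) ≈-refl (# N)) }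
    -- The number of rounds is within 2 of `N m`, and a round passes an edge at most `length es`
    -- times; the connecting walks add their lengths once.
    tour ((m , C , s) ∷ ws) (m≥0 ∷ ws≥0) = (2 ℕ.* length es ℕ.+ (length to ℕ.+ length from)) ℕ.+ B ,
        λ N → extendTour N
      where
      B = proj₁ (tour ws ws≥0)
      es = edgesOf C
      u = proj₁ (Cycle.closed C)
      closed = proj₂ (Cycle.closed C)
      to = proj₁ (connect root u)
      from = proj₁ (connect u root)
      extendTour : ∀ N → Tour ((m , C , s) ∷ ws) N ((2 ℕ.* length es ℕ.+ (length to ℕ.+ length from))
          ℕ.+ B)
      extendTour N = record
        { edges  = to ++ (repeat a es ++ (from ++ W))
        ; isWalk = walk-++ (proj₂ (connect root u)) (walk-++ (repeat-walk a closed)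
            (walk-++ (proj₂ (connect u root)) isWalk))
        ; above  = λ e → ≈-≤ (χ-total e) (≤-≈
            (+-mono-≤ (χ≤length to e) (+-mono-≤ (loops≤ e) (+-mono-≤ (χ≤length from e) (above e))))
            (≈-trans (solve 7 (λ n m x t f l c → t :+ ((n :* (m :* x) :+ con (ℚℕ 2) :* l) :+ (f :+ c))
                :=
                 n :* (m :* x) :+ (con (ℚℕ 2) :* l :+ (t :+ f)) :+ c) ≈-refl
                 (# N) m (χ es e) (# length to) (# length from) (# length es) (# N * combination ws e +
                     # B))
              (≈-trans (solve 6 (λ n m x y k b → n :* (m :* x) :+ k :+ (n :* y :+ b) := n :*
                  (m :* x :+ y) :+ (k :+ b)) ≈-refl
                 (# N) m (χ es e) (combination ws e) (# 2 * # length es + (# length to + # length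
                     from)) (# B))
                (+-congˡ (# N * (m * χ es e + combination ws e)) (≈-sym error≈)))))
        ; below  = λ e → ≤-≈ (≈-≤ (*-distribˡ-+ (# N) (m * χ es e) (combination ws e))
              (+-mono-≤ (loops≥ e) (≤-≈ (below e) (≈-sym (+-identityˡ (χ W e + # B))))))
            (≈-refl) ⟫ rest≥ e }
        where
        open Tour (proj₂ (tour ws ws≥0) N) renaming (edges to W)
        _⟫_ : ∀ {x y z} → x ≤ᴿ y → y ≤ᴿ z → x ≤ᴿ z
        _⟫_ = ≤ᴿ-trans
        approximation = natural-approximation (# N * m) (0≤* (0≤# N) m≥0)
        a = proj₁ approximation
        χ-total : ∀ e → χ (to ++ (repeat a es ++ (from ++ W))) e ≈ᴿ χ to e +
            (# a * χ es e + (χ from e + χ W e))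
        χ-total e = ≈-trans (χ-++ to _ e) (+-congˡ (χ to e) (≈-trans (χ-++ (repeat a es) _ e)
          (+-cong (χ-repeat a es e) (χ-++ from W e))))
        error≈ : # ((2 ℕ.* length es ℕ.+ (length to ℕ.+ length from)) ℕ.+ B) ≈ᴿ (# 2 * # length es +
            (# length to + # length from)) + # B
        error≈ = ≈-trans (#-+ (2 ℕ.* length es ℕ.+ (length to ℕ.+ length from)) B)
          (+-congʳ (# B) (≈-trans (#-+ (2 ℕ.* length es) (length to ℕ.+ length from))
            (+-cong (#-* 2 (length es)) (#-+ (length to) (length from)))))
        loops≤ : ∀ e → # a * χ es e ≤ᴿ # N * (m * χ es e) + # 2 * # length es
        loops≤ e = ≈-≤ (*-comm (# a) (χ es e)) (≤ᴿ-trans (*-monoˡ-≤ (0≤# (count e es))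
            (proj₁ (proj₂ approximation)))
          (≈-≤ (solve 3 (λ x n m → x :* (n :* m :+ con (ℚℕ 2)) := n :* (m :* x) :+ con (ℚℕ 2) :* x)
              ≈-refl (χ es e) (# N) m)
            (+-monoʳ-≤ _ (*-monoˡ-≤ (0≤# 2) (χ≤length es e)))))
        loops≥ : ∀ e → # N * (m * χ es e) ≤ᴿ # a * χ es e + # 2 * # length es
        loops≥ e = ≈-≤ (solve 3 (λ x n m → n :* (m :* x) := x :* (n :* m)) ≈-refl (χ es e) (# N) m)
          (≤ᴿ-trans (*-monoˡ-≤ (0≤# (count e es)) (proj₂ (proj₂ approximation)))
            (≈-≤ (solve 2 (λ x a → x :* (a :+ con (ℚℕ 2)) := a :* x :+ con (ℚℕ 2) :* x) ≈-refl (χ es e)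
                (# a))
              (+-monoʳ-≤ _ (*-monoˡ-≤ (0≤# 2) (χ≤length es e)))))
        rest≥ : ∀ e → (# a * χ es e + # 2 * # length es) + (# 0 + (χ W e + # B)) ≤ᴿ
                      χ (to ++ (repeat a es ++ (from ++ W))) e + #
                          ((2 ℕ.* length es ℕ.+ (length to ℕ.+ length from)) ℕ.+ B)
        rest≥ e = ≤-≈ (≤-diffᴿ
            (+-mono-≤ (0≤+ (0≤# (count e to)) (0≤# (count e from))) (0≤+ (0≤# (length to))
                (0≤# (length from))))
            (solve 8 (λ x y z w l t f b → ((x :+ con (ℚℕ 2) :* l) :+ (con 0ℚ :+ (w :+ b))) :-
                ((y :+ (x :+ (z :+ w))) :+ ((con (ℚℕ 2) :* l :+ (t :+ f)) :+ b)) := (con 0ℚ :+ con 0ℚ)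
                    :- ((y :+ z) :+ (t :+ f))) ≈-refl
              (# a * χ es e) (χ to e) (χ from e) (χ W e) (# length es) (# length to) (# length from)
                  (# B)))
          (+-cong (≈-sym (χ-total e)) (≈-sym error≈))

    flow≤1 : ∀ {f} → IsFlow f → ∀ e → f e ≤ᴿ # 1
    flow≤1 φ e = ≤-≈ (∈⇒≤Sum (nonNeg φ) (complete e)) (total φ)

    -- A flow f is approximated by closed walks of n - L edges, with error C / n, for
    -- n within D of any prescribed N.
    approximate-flow : ∀ {f} → IsFlow f → Σ[ C ∈ ℕ ] Σ[ D ∈ ℕ ] (∀ N → Σ[ es ∈ List Edge ]
      (IsWalk G root es root × N ℕ.≤ (length es ℕ.+ L) ℕ.+ D ×
       (∀ n .⦃ _ : NonZero n ⦄ → n ≡ length es ℕ.+ L → ∀ e →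
         1/ n * χ es e ≤ᴿ f e + 1/ n * # C × f e ≤ᴿ 1/ n * χ es e + 1/ n * # C)))
    approximate-flow {f} φ = B ℕ.+ D , D , λ N →
      Tour.edges (tours N) , Tour.isWalk (tours N) , N≤ N , λ { n refl e → close≤ N n refl e , close≥ N
          n refl e }
      where
      decomposition = decompose (nonNeg φ) (conserved φ)
      ws = proj₁ decomposition
      B = proj₁ (tour ws (proj₁ (proj₂ decomposition)))
      tours : ∀ N → Tour ws N B
      tours = proj₂ (tour ws (proj₁ (proj₂ decomposition)))
      -- The flow has total 1 and each edge count errs by at most `B`, so the length of the walk
      -- differs from `N` by at most `length Es` times `B`; `L` accounts for passing from edges to
      -- size.
      D = length Es ℕ.* B ℕ.+ L
      Sum-B : Sum Es (λ _ → # B) ≈ᴿ # (length Es ℕ.* B)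
      Sum-B = go Es
        where
        go : ∀ xs → Sum xs (λ _ → # B) ≈ᴿ # (length xs ℕ.* B)
        go []       = ≈-refl
        go (x ∷ xs) = ≈-trans (+-congˡ (# B) (go xs)) (≈-sym (#-+ B (length xs ℕ.* B)))
      module _ (N : ℕ) where
        open Tour (tours N)
        len = length edges ℕ.+ L
        above′ : ∀ e → χ edges e ≤ᴿ # N * f e + # B
        above′ e = ≤-≈ (above e) (+-congʳ (# B) (*-congˡ (# N) (≈-sym (proj₂ (proj₂ decomposition) e))))
        below′ : ∀ e → # N * f e ≤ᴿ χ edges e + # B
        below′ e = ≈-≤ (*-congˡ (# N) (proj₂ (proj₂ decomposition) e)) (below e)
        Sum-N : Sum Es (λ e → # N * f e) ≈ᴿ # N
        Sum-N = ≈-trans (Sum-*ˡ Es (# N) f) (≈-trans (*-congˡ (# N) (total φ)) (*-identityʳ (# N)))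
        len≤ᴿ : # length edges ≤ᴿ # N + # (length Es ℕ.* B)
        len≤ᴿ = ≈-≤ (≈-sym (Sum-χ-total edges)) (≤-≈ (Sum-mono-≤ Es above′)
          (≈-trans (Sum-+ Es (λ e → # N * f e) (λ _ → # B)) (+-cong Sum-N Sum-B)))
        N≤ᴿ : # N ≤ᴿ # length edges + # (length Es ℕ.* B)
        N≤ᴿ = ≈-≤ (≈-sym Sum-N) (≤-≈ (Sum-mono-≤ Es below′)
          (≈-trans (Sum-+ Es (χ edges) (λ _ → # B)) (+-cong (Sum-χ-total edges) Sum-B)))
        N≤len+D : # N ≤ᴿ # (len ℕ.+ D)
        N≤len+D = ≤ᴿ-trans N≤ᴿ (≈-≤ (≈-sym (#-+ (length edges) (length Es ℕ.* B)))
          (#-mono-≤ (ℕₚ.+-mono-≤ (ℕₚ.m≤m+n (length edges) L) (ℕₚ.m≤m+n (length Es ℕ.* B) L))))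
        N≤ : N ℕ.≤ len ℕ.+ D
        N≤ = #-cancel-≤ N≤len+D
        len≤N+D : # len ≤ᴿ # N + # D
        len≤N+D = ≈-≤ (#-+ (length edges) L) (≤-≈ (+-monoˡ-≤ (# L) len≤ᴿ)
          (≈-trans (+-assoc (# N) (# (length Es ℕ.* B)) (# L))
              (+-congˡ (# N) (≈-sym (#-+ (length Es ℕ.* B) L)))))
        D*f≤ : ∀ e → # D * f e ≤ᴿ # D
        D*f≤ e = ≤-≈ (*-monoˡ-≤ (0≤# D) (flow≤1 φ e)) (*-identityʳ (# D))
        -- Replacing `N` by the actual size changes `N f e` by at most `D`, because `f e ≤ 1`; hence
        -- the error constant `B + D`.
        count≤ : ∀ e → χ edges e ≤ᴿ # len * f e + # (B ℕ.+ D)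
        count≤ e = ≤ᴿ-trans (above′ e) (≤-≈ (+-monoˡ-≤ (# B) (≤ᴿ-trans
            (≈-≤ (*-comm (# N) (f e)) (≤-≈ (*-monoˡ-≤ (nonNeg φ e) (≤-≈ N≤len+D (#-+ len D)))
              (solve 3 (λ f n d → f :* (n :+ d) := n :* f :+ d :* f) ≈-refl (f e) (# len) (# D))))
            (+-monoʳ-≤ (# len * f e) (D*f≤ e))))
          (≈-trans (solve 3 (λ x d b → (x :+ d) :+ b := x :+ (b :+ d)) ≈-refl (# len * f e) (# D) (# B))
            (+-congˡ (# len * f e) (≈-sym (#-+ B D)))))
        count≥ : ∀ e → # len * f e ≤ᴿ χ edges e + # (B ℕ.+ D)
        count≥ e = ≤ᴿ-trans
          (≈-≤ (*-comm (# len) (f e)) (≤-≈ (*-monoˡ-≤ (nonNeg φ e) len≤N+D)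
            (solve 3 (λ f n d → f :* (n :+ d) := n :* f :+ d :* f) ≈-refl (f e) (# N) (# D))))
          (≤-≈ (+-mono-≤ (below′ e) (D*f≤ e))
            (≈-trans (+-assoc (χ edges e) (# B) (# D)) (+-congˡ (χ edges e) (≈-sym (#-+ B D)))))
        close≤ : ∀ n .⦃ _ : NonZero n ⦄ → n ≡ len → ∀ e → 1/ n * χ edges e ≤ᴿ f e + 1/ n * # (B ℕ.+ D)
        close≤ n refl e = ≤-≈ (*-monoˡ-≤ (0≤1/ᴿ n) (count≤ e))
          (≈-trans (*-distribˡ-+ (1/ n) (# len * f e) (# (B ℕ.+ D))) (+-congʳ _ (*1/ n (f e))))
        close≥ : ∀ n .⦃ _ : NonZero n ⦄ → n ≡ len → ∀ e → f e ≤ᴿ 1/ n * χ edges e + 1/ n * # (B ℕ.+ D)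
        close≥ n refl e = ≈-≤ (≈-sym (*1/ n (f e))) (≤-≈ (*-monoˡ-≤ (0≤1/ᴿ n) (count≥ e))
          (*-distribˡ-+ (1/ n) (χ edges e) (# (B ℕ.+ D))))

-- The operations of the statement in terms of their opaque copies

opaque
  unfolding _+_

  ∑-suc : ∀ {n} (f : Fin (suc n) → ℝ) → ∑ f ≈ᴿ f fzero + ∑ (λ i → f (fsuc i))
  ∑-suc f = ≈-refl

∑-tabulate : ∀ {m n} (f : Fin n → ℝ) (h : Fin m → Fin n) → ∑ (λ i → f (h i)) ≈ᴿ Sum (tabulate h) f
∑-tabulate {zero}  f h = ∑-lookup [] f
∑-tabulate {suc m} f h = ≈-trans (∑-suc (λ i → f (h i))) (+-congˡ (f (h fzero))
    (∑-tabulate f (λ i → h (fsuc i))))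

∑-allFin : ∀ {n} (f : Fin n → ℝ) → ∑ f ≈ᴿ Sum (allFin n) f
∑-allFin f = ∑-tabulate f id

*ᴿ≈* : ∀ x y → x *ᴿ y ≈ᴿ x * y
*ᴿ≈* x y = ≈-reflexive (sym (*-def x y))

linComb≈ : ∀ {X : Set} {n} (c : Fin n → ℝ) (p : Fin n → X → ℝ) x →
           linComb c p x ≈ᴿ Sum (allFin n) (λ i → c i * p i x)
linComb≈ {n = n} c p x = ≈-trans (∑-allFin (λ i → c i *ᴿ p i x)) (Sum-cong (allFin n)
    (λ i → *ᴿ≈* (c i) (p i x)))

linComb-lookup : ∀ {X I : Set} (is : List I) (c : I → ℝ) (p : I → X → ℝ) x →
                 linComb (λ i → c (lookup is i)) (λ i → p (lookup is i)) x ≈ᴿ Sum is (λ i → c i * p i x)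
linComb-lookup is c p x = ≈-trans {linComb (λ i → c (lookup is i)) (λ i → p (lookup is i)) x}
    {Sum is (λ i → c i *ᴿ p i x)}
  (∑-lookup is (λ i → c i *ᴿ p i x)) (Sum-cong is (λ i → *ᴿ≈* (c i) (p i x)))

⊕≈+ : ∀ {X : Set} (v w : X → ℝ) x → (v ⊕ w) x ≈ᴿ v x + w x
⊕≈+ v w x = ≈-reflexive (sym (+-def (v x) (w x)))

·≈* : ∀ {X : Set} c (v : X → ℝ) x → (c · v) x ≈ᴿ c * v x
·≈* c v x = ≈-reflexive (sym (*-def c (v x)))

⊖≈- : ∀ {X : Set} (v w : X → ℝ) x → (v ⊖ w) x ≈ᴿ v x - w x
⊖≈- v w x = ≈-sym (-‿def (v x) (w x))

1-≈ : ∀ t → 1ᴿ -ᴿ t ≈ᴿ # 1 - t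
1-≈ t = ≈-trans (≈-sym (-‿def 1ᴿ t)) (-‿cong (≈-sym 1ᴿ≈) ≈-refl)

mixture : ∀ {X : Set} t (u w : X → ℝ) x → (t · u ⊕ (1ᴿ -ᴿ t) · w) x ≈ᴿ t * u x + (# 1 - t) * w x
mixture t u w x = ≈-trans (⊕≈+ (t · u) ((1ᴿ -ᴿ t) · w) x)
  (+-cong (·≈* t u x) (≈-trans (·≈* (1ᴿ -ᴿ t) w x) (*-congʳ (w x) (1-≈ t))))

-- Unit flows as the cycle polytope, and its extreme points

module Polytope (G : Multigraph) (Es : List (Multigraph.Edge G))
                (complete : ∀ e → e ∈ Es) (unique : Unique Es)
                (_≟ⱽ_ : DecidableEquality (Multigraph.Vertex G)) where

  open Multigraph G
  open Flows G Es complete unique _≟ⱽ_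

  module _ {I : Set} (is : List I) (c : I → ℝ) (p : I → Edge → ℝ) where

    pairing-combination : (w : Edge → ℝ) →
      Sum Es (λ e → w e * Sum is (λ i → c i * p i e)) ≈ᴿ Sum is (λ i → c i * Sum Es (λ e → w e * p i e))
    pairing-combination w = begin
      Sum Es (λ e → w e * Sum is (λ i → c i * p i e))
        ≈⟨ Sum-cong Es (λ e → ≈-sym (Sum-*ˡ is (w e) (λ i → c i * p i e))) ⟩
      Sum Es (λ e → Sum is (λ i → w e * (c i * p i e)))
        ≈⟨ Sum-comm Es is (λ e i → w e * (c i * p i e)) ⟩
      Sum is (λ i → Sum Es (λ e → w e * (c i * p i e)))
        ≈⟨ Sum-cong is (λ i → pairing-* w (c i) (p i)) ⟩
      Sum is (λ i → c i * Sum Es (λ e → w e * p i e)) ∎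
      where open ≈-Reasoning

    conserved-combination : (∀ i → Conserved (p i)) → Conserved (λ e → Sum is (λ i → c i * p i e))
    conserved-combination h g K b = ≈-trans (pairing-combination (#_ ∘ g ∘ src))
      (≈-trans (Sum-cong is (λ i → *-congˡ (c i) (h i g K b)))
          (≈-sym (pairing-combination (#_ ∘ g ∘ tgt))))

    total-combination : (∀ i → Sum Es (p i) ≈ᴿ # 1) → Sum is c ≈ᴿ # 1 →
                        Sum Es (λ e → Sum is (λ i → c i * p i e)) ≈ᴿ # 1
    total-combination h c≈1 = ≈-trans (Sum-comm Es is (λ e i → c i * p i e))
      (≈-trans (Sum-cong is (λ i → ≈-trans (Sum-*ˡ Es (c i) (p i)) (≈-trans (*-congˡ (c i) (h i))
          (*-identityʳ (c i))))) c≈1)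

  cyclePolytope⇒flow : ∀ {f} → CyclePolytope G f → IsFlow f
  cyclePolytope⇒flow {f} (n , c , p , cycles , c≥0 , ∑c , f≋) = isFlow-cong
      (λ e → ≈-sym (≈-trans (f≋ e) (linComb≈ c p e))) (record
    { nonNeg    = λ e → 0≤Sum (allFin n) (λ i → 0≤* (≈-≤ 0ᴿ≈ (c≥0 i)) (nonNeg (flows i) e))
    ; total     = total-combination (allFin n) c p (total ∘ flows) (≈-trans (≈-sym (∑-allFin c))
        (≈-trans ∑c (≈-sym 1ᴿ≈)))
    ; conserved = conserved-combination (allFin n) c p (conserved ∘ flows) })
    where
    flows : ∀ i → IsFlow (p i)
    flows i = let C , _ , p≋ = cycles i in isFlow-cong (≈-sym ∘ p≋) (cycleVector-isFlow C)

  -- The parts carry unnormalised multiplicities, so each coefficient is multiplied by the length of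
  -- its cycle. The coefficients then sum to the total of `f`.
  combination⇒cyclePolytope : ∀ {f} (ws : List Weighted) → All (λ w → # 0 ≤ᴿ proj₁ w) ws →
    (∀ e → f e ≈ᴿ combination ws e) → Sum Es f ≈ᴿ # 1 → CyclePolytope G f
  combination⇒cyclePolytope {f} ws ws≥0 f≈ total-f = length ws ,
    (λ i → coefficient (lookup ws i)) , (λ i → vector (lookup ws i)) ,
    (λ i → cycleOf (lookup ws i) , proj₂ (proj₂ (lookup ws i)) , λ e → ≈-refl) ,
    (λ i → ≈-≤ (≈-sym 0ᴿ≈) (coefficient≥0 (∈ₚ.∈-lookup i))) ,
    ≈-trans (∑-lookup ws coefficient) (≈-trans (≈-sym total≈) (≈-trans total-f 1ᴿ≈)) ,
    λ e → ≈-trans (≈-trans (f≈ e) (Sum-cong ws (λ w → ≈-sym (term w e))))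
        (≈-sym (linComb-lookup ws coefficient vector e))
    where
    cycleOf : Weighted → Cycle G
    cycleOf (_ , C , _) = C
    coefficient : Weighted → ℝ
    coefficient (m , C , _) = m * # length (edgesOf C)
    vector : Weighted → Edge → ℝ
    vector w = cycleVector G (cycleOf w)
    coefficient≥0 : ∀ {w} → w ∈ ws → # 0 ≤ᴿ coefficient w
    coefficient≥0 {w} i = 0≤* (All.lookup ws≥0 i) (0≤# (length (edgesOf (cycleOf w))))
    rescale : ∀ m l w x → w * l ≈ᴿ # 1 → (m * l) * (w * x) ≈ᴿ m * x
    rescale m l w x e = ≈-trans (solve 4 (λ m l w x → (m :* l) :* (w :* x) := (w :* l) :* (m :* x))
        ≈-refl m l w x)
      (≈-trans (*-congʳ (m * x) e) (*-identityˡ (m * x)))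
    term : ∀ w e → coefficient w * vector w e ≈ᴿ proj₁ w * χ (edgesOf (cycleOf w)) e
    term (m , C , _) e = ≈-trans (*-congˡ (m * # length (edgesOf C)) (cycleVector≈ C e))
      (rescale m (# length (edgesOf C)) (weightOf C) (χ (edgesOf C) e) (weight*length C))
    total≈ : Sum Es f ≈ᴿ Sum ws coefficient
    total≈ = ≈-trans (Sum-cong Es f≈)
      (≈-trans (Sum-comm Es ws (λ { e (m , C , _) → m * χ (edgesOf C) e }))
        (Sum-cong ws (λ { (m , C , _) → ≈-trans (Sum-*ˡ Es m (χ (edgesOf C)))
            (*-congˡ m (Sum-χ-total (edgesOf C))) })))

  flow⇒cyclePolytope : ∀ {f} → IsFlow f → CyclePolytope G f
  flow⇒cyclePolytope φ = let ws , ws≥0 , f≈ = decompose (nonNeg φ) (conserved φ)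
    in combination⇒cyclePolytope ws ws≥0 f≈ (total φ)

  -- Extreme flows

  summand-vanishes : ∀ {t s x y} → # 0 <ᴿ t → # 0 ≤ᴿ s → # 0 ≤ᴿ x → # 0 ≤ᴿ y → t * x + s * y ≈ᴿ # 0 → x
      ≈ᴿ # 0
  summand-vanishes {t} {s} {x} {y} 0<t 0≤s 0≤x 0≤y e = ≤ᴿ-antisym (*-cancel-≤0 0<t 0≤x
    (≤-≈ (≈-≤ (≈-sym (+-identityʳ (t * x))) (+-monoʳ-≤ (t * x) (0≤* 0≤s 0≤y))) e)) 0≤x

  -- Off the cycle both nonnegative summands vanish, so `f₁` is supported on the cycle, and only one
  -- unit flow is.
  cycle-extreme : (C : SimpleCycle) → ∀ {f₁ f₂ t s} → IsFlow f₁ → IsFlow f₂ → # 0 <ᴿ t → # 0 ≤ᴿ s →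
    (∀ e → cycleVector G (proj₁ C) e ≈ᴿ t * f₁ e + s * f₂ e) → ∀ e → f₁ e ≈ᴿ cycleVector G (proj₁ C) e
  cycle-extreme C@(C₀ , _) φ₁ φ₂ 0<t 0≤s mix e = ≈-trans (supported⇒≈cycle φ₁ C
    (λ e ∉ → summand-vanishes 0<t 0≤s (nonNeg φ₁ e) (nonNeg φ₂ e) (≈-trans (≈-sym (mix e))
      (≈-trans (cycleVector≈ C₀ e) (≈-trans (*-congˡ (weightOf C₀) (χ-∉ (edgesOf C₀) ∉))
          (*-zeroʳ (weightOf C₀)))))) e)
    (≈-sym (cycleVector≈ C₀ e))

  weight≤1 : ∀ C → weightOf C ≤ᴿ # 1
  weight≤1 C = ≤-≈ (≈-≤ (≈-sym (*-identityʳ (weightOf C))) (*-monoˡ-≤ (0≤weight C)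
      (#-mono-≤ {1} {length (edgesOf C)} (s≤s z≤n)))) (weight*length C)

  -- Remove a little of some positive cycle and rescale the rest. The mixture is proper whether or
  -- not `f` is itself a cycle vector, so that question is never decided: extremality alone
  -- identifies `f` with the cycle.
  split : ∀ {f} → IsFlow f → Σ[ C ∈ SimpleCycle ] Σ[ t ∈ ℝ ] Σ[ r ∈ (Edge → ℝ) ]
    (IsFlow r × # 0 <ᴿ t × t <ᴿ # 1 × (∀ e → f e ≈ᴿ t * cycleVector G (proj₁ C) e + (# 1 - t) * r e))
  split {f} φ = C , ι t , r , record { nonNeg = r≥0 ; total = total-r ; conserved = conserved-r } ,
    ι-mono-< t>0 , ι-mono-< t<1 , λ e → ≈-sym
        (≈-trans (+-congˡ (ι t * cyc e) (unscale (f e - ι t * cyc e)))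
      (solve 2 (λ a b → a :+ (b :- a) := b) ≈-refl (ι t * cyc e) (f e)))
    where
    start = 0<Sum⇒ Es f (<-≤-transᴿ (ι-mono-< 0<1ℚ) (≈⇒≥ (total φ)))
    found = positiveCycle (nonNeg φ) (conserved φ) (proj₂ (proj₂ start))
    C = proj₁ found
    C₀ = proj₁ C
    cyc = cycleVector G C₀
    0<min : # 0 <ᴿ minimum f (List⁺.head (Cycle.edges C₀)) (List⁺.tail (Cycle.edges C₀))
    0<min = minimum-glb-< f (List⁺.head (Cycle.edges C₀)) (List⁺.tail (Cycle.edges C₀)) (proj₂ found)
    γ = _<ᴿ_.gap 0<min
    -- The rational `γ` is at most the minimum of `f` on the cycle, which keeps the remainder
    -- nonnegative. The cap by one half keeps `1 - t` positive, and a rational `t` makes it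
    -- invertible.
    t = γ ℚ.⊓ ½
    t>0 : 0ℚ ℚ.< t
    t>0 = ⊓-pos (ℚₚ.⊓-sel γ ½)
      where
      ⊓-pos : _ → 0ℚ ℚ.< t
      ⊓-pos (inj₁ e) = subst (0ℚ ℚ.<_) (sym e) (_<ᴿ_.positive 0<min)
      ⊓-pos (inj₂ e) = subst (0ℚ ℚ.<_) (sym e) (ℚₚ.positive⁻¹ ½)
    t<1 : t ℚ.< 1ℚ
    t<1 = ℚₚ.≤-<-trans (ℚₚ.p⊓q≤q γ ½) (ℚₚ.<-respʳ-≡ (half+half 1ℚ) (subst (ℚ._< ½ ℚ.* 1ℚ ℚ.+ ½ ℚ.* 1ℚ)
        (ℚₚ.+-identityʳ ½) (ℚₚ.+-monoʳ-< ½ (ℚₚ.positive⁻¹ ½))))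
    inv = inverse {1ℚ ℚ.- t} (subst (ℚ._< 1ℚ ℚ.- t) (ℚₚ.+-inverseʳ t) (ℚₚ.+-monoˡ-< (ℚ.- t) t<1))
    s = proj₁ inv
    scale : (# 1 - ι t) * ι s ≈ᴿ # 1
    scale = ≈-trans (*-congʳ (ι s) (≈-sym (≈-trans (ι-+ 1ℚ (ℚ.- t)) (+-congˡ (# 1) (ι-neg t)))))
      (≈-trans (≈-sym (ι-* (1ℚ ℚ.- t) s)) (≈-reflexive (cong ι (proj₂ (proj₂ inv)))))
    unscale : ∀ x → (# 1 - ι t) * (ι s * x) ≈ᴿ x
    unscale x = ≈-trans (≈-sym (*-assoc (# 1 - ι t) (ι s) x)) (≈-trans (*-congʳ x scale)
        (*-identityˡ x))
    r : Edge → ℝ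
    r e = ι s * (f e - ι t * cyc e)
    t≤f : ∀ {e} → e ∈ edgesOf C₀ → ι t * weightOf C₀ ≤ᴿ f e
    t≤f i = ≤ᴿ-trans (*-monoˡ-≤ (ι-mono-≤ (ℚₚ.<⇒≤ t>0)) (weight≤1 C₀))
      (≈-≤ (*-identityʳ (ι t)) (≤ᴿ-trans (ι-mono-≤ (ℚₚ.p⊓q≤p γ ½))
        (≤ᴿ-trans (≈-≤ (≈-sym (+-identityˡ (ι γ))) (<⇒+gap 0<min))
          (minimum-≤ f (List⁺.head (Cycle.edges C₀)) (List⁺.tail (Cycle.edges C₀)) i))))
    tcyc≤f : ∀ e → ι t * cyc e ≤ᴿ f e
    tcyc≤f e = ≈-≤ (≈-trans (*-congˡ (ι t) (cycleVector≈ C₀ e))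
        (≈-sym (*-assoc (ι t) (weightOf C₀) (χ (edgesOf C₀) e))))
      (*χ≤ (nonNeg φ) C t≤f e)
    r≥0 : NonNeg r
    r≥0 e = 0≤* (ι-mono-≤ (ℚₚ.<⇒≤ (proj₁ (proj₂ inv)))) (≤⇒0≤- (tcyc≤f e))
    cyc-flow = cycleVector-isFlow C₀
    conserved-r : Conserved r
    conserved-r = conserved-* (ι s) (conserved-‿- (conserved φ) (conserved-* (ι t)
        (conserved cyc-flow)))
    total-r : Sum Es r ≈ᴿ # 1
    total-r = begin
      Sum Es r                                      ≈⟨ Sum-*ˡ Es (ι s) (λ e → f e - ι t * cyc e) ⟩
      ι s * Sum Es (λ e → f e - ι t * cyc e)        ≈⟨ *-congˡ (ι s) (Sum-‿- Es f (λ e → ι t * cyc e)) ⟩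
      ι s * (Sum Es f - Sum Es (λ e → ι t * cyc e)) ≈⟨ *-congˡ (ι s) (-‿cong (total φ)
                                                         (≈-trans (Sum-*ˡ Es (ι t) cyc)
                                                             (*-congˡ (ι t) (total cyc-flow)))) ⟩
      ι s * (# 1 - ι t * # 1)                       ≈⟨ solve 2 (λ s t → s :* (con 1ℚ :- t :* con 1ℚ) :=
          (con 1ℚ :- t) :* s) ≈-refl (ι s) (ι t) ⟩
      (# 1 - ι t) * ι s                             ≈⟨ scale ⟩
      # 1                                           ∎
      where open ≈-Reasoning

open Permutations
open Enumeration

-- Avoiders as walks in the overlap graph

module OverlapWalks where

  private
    variable
      l m n w : ℕ

  pat-pat : (I : Positions m n) (J : Positions l m) (I′ : Positions w n) (J′ : Positions l w) (σ : 𝒮 n)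
      →
            (∀ a → at I (at J a) ≡ at I′ (at J′ a)) → pat J (pat I σ) ≡ pat J′ (pat I′ σ)
  pat-pat I J I′ J′ σ e = trans (pat-∘ I J σ)
    (trans (pat-at-cong (I ∘ᴾ J) (I′ ∘ᴾ J′) σ e) (sym (pat-∘ I′ J′ σ)))

  module _ (σ : 𝒮 n) where
    window-full : window n ℕₚ.≤-refl σ ≡ σ
    window-full = order-ext _ σ λ a b lt → subst₂ (λ a b → σ ⟨ a ⟩ Fin.< σ ⟨ b ⟩) (at-full a)
        (at-full b)
      (pat-<⁻ (interval 0 n ℕₚ.≤-refl) σ lt)
      where
      at-full : ∀ a → at (interval {n} 0 n ℕₚ.≤-refl) a ≡ a
      at-full a = Fₚ.toℕ-injective (toℕ-at-interval 0 ℕₚ.≤-refl a)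

    window-window : ∀ .(p : m ℕ.≤ n) .(q : w ℕ.≤ m) .(r : w ℕ.≤ n) → window w q (window m p σ) ≡ window
        w r σ
    window-window {m} {w} p q r = trans (pat-∘ (interval 0 m p) (interval 0 w q) σ)
      (pat-at-cong (interval 0 m p ∘ᴾ interval 0 w q) (interval 0 w r) σ λ a → Fₚ.toℕ-injective
        (trans (toℕ-at-interval 0 p _) (trans (toℕ-at-interval 0 q a) (sym (toℕ-at-interval 0 r a)))))

  rest-window : (σ : 𝒮 (suc n)) .(p : suc w ℕ.≤ suc n) .(q : w ℕ.≤ n) → rest (window (suc w) p σ) ≡
      window w q (rest σ)
  rest-window {n} {w} σ p q = pat-pat (interval 0 (suc w) p) (interval 1 w ℕₚ.≤-refl)
    (interval 1 n ℕₚ.≤-refl) (interval 0 w q) σ λ a → Fₚ.toℕ-injective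
      (trans (trans (toℕ-at-interval 0 p _) (toℕ-at-interval 1 ℕₚ.≤-refl a))
        (sym (trans (toℕ-at-interval 1 ℕₚ.≤-refl _) (cong suc (toℕ-at-interval 0 q a)))))

  -- Occurrences as prepending proceeds

  module _ {A : Set} {P Q : A → Set} (P? : Decidable P) (Q? : Decidable Q) where
    filter-length-⇔ : ∀ xs → (∀ x → P x ⇔ Q x) → length (filter P? xs) ≡ length (filter Q? xs)
    filter-length-⇔ xs e = cong length (Listₚ.filter-≐ P? Q?
      ((λ {x} → Equivalence.to (e x)) , (λ {x} → Equivalence.from (e x))) xs)

  filter-length-map : ∀ {A B : Set} {P : B → Set} (P? : Decidable P) (h : A → B) xs →
                      length (filter P? (map h xs)) ≡ length (filter (P? ∘ h) xs)
  filter-length-map P? h []       = refl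
  filter-length-map P? h (x ∷ xs) with P? (h x)
  ... | yes _ = cong suc (filter-length-map P? h xs)
  ... | no _  = filter-length-map P? h xs

  c-occ-short : (π : 𝒮 m) (σ : 𝒮 n) → n ℕ.< m → c-occ π σ ≡ 0
  c-occ-short {m} {n} π σ n<m = cong length (Listₚ.filter-none (occursAt? π σ) {xs = allFin n}
    (All.tabulate λ {i} _ (p , _) → ℕₚ.<⇒≱ n<m (ℕₚ.≤-trans (ℕₚ.m≤n+m m (toℕ i)) p)))

  module _ {m : ℕ} where
    open Indicator (_≟ˢ_ {m}) using (δ; count; δ-refl; δ-≢)

    occursAt-suc : (π : 𝒮 m) (σ : 𝒮 (suc n)) (i : Fin n) → OccursAt π σ (fsuc i) ⇔ OccursAt π (rest σ) i
    occursAt-suc {n} π σ i = mk⇔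
      (λ { (s≤s p , e) → p , trans (sym (shift p)) e })
      (λ { (p , e) → s≤s p , trans (shift p) e })
      where
      shift : ∀ p → pat (interval (suc (toℕ i)) m (s≤s p)) σ ≡ pat (interval (toℕ i) m p) (rest σ)
      shift p = trans
        (pat-at-cong (interval (suc (toℕ i)) m (s≤s p)) (interval 1 n ℕₚ.≤-refl ∘ᴾ interval (toℕ i) m
            p) σ λ a → Fₚ.toℕ-injective
          (trans (toℕ-at-interval (suc (toℕ i)) (s≤s p) a)
            (sym (trans (toℕ-at-interval 1 ℕₚ.≤-refl _) (cong suc (toℕ-at-interval (toℕ i) p a))))))
        (sym (pat-∘ (interval 1 n ℕₚ.≤-refl) (interval (toℕ i) m p) σ))

    filter-length-∷ : ∀ {A : Set} {P : A → Set} (P? : Decidable P) {ρ τ : 𝒮 m} {x} xs → P x ⇔ ρ ≡ τ →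
                      length (filter P? (x ∷ xs)) ≡ δ ρ τ ℕ.+ length (filter P? xs)
    filter-length-∷ P? {ρ} {τ} {x} xs e with P? x
    ... | yes p = cong (ℕ._+ length (filter P? xs)) (sym (trans (cong (δ ρ) (sym (Equivalence.to e p)))
        (δ-refl ρ)))
    ... | no ¬p = cong (ℕ._+ length (filter P? xs)) (sym (δ-≢ (¬p ∘ Equivalence.from e)))

    -- Apart from the initial window, every window lies in the tail, shifted by one position.
    c-occ-step : (π : 𝒮 m) (σ : 𝒮 (suc n)) (p : m ℕ.≤ suc n) →
                 c-occ π σ ≡ δ π (window m p σ) ℕ.+ c-occ π (rest σ)
    c-occ-step {n} π σ p = trans
      (filter-length-∷ (occursAt? π σ) {π} {window m p σ} {fzero} (tabulate fsuc)
          (mk⇔ (λ { (_ , e) → sym e }) (λ e → p , sym e)))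
      (cong (δ π (window m p σ) ℕ.+_) (trans
        (cong (λ xs → length (filter (occursAt? π σ) xs)) (sym (Listₚ.map-tabulate id fsuc)))
        (trans (filter-length-map (occursAt? π σ) fsuc (allFin n))
          (filter-length-⇔ (occursAt? π σ ∘ fsuc) (occursAt? π (rest σ)) (allFin n)
              (occursAt-suc π σ)))))

  module Overlap (L : ℕ) where

    G : Multigraph
    G = OverlapGraph (suc L) ⟦312⟧

    open Multigraph G using (Vertex; Edge; src; tgt)

    open Flows G (avoiders (suc L)) (avoiders-complete (suc L)) (avoiders-unique (suc L)) (_≟ᴬ_) public

    windowᴬ : (w : ℕ) → .(w ℕ.≤ n) → 𝒜 n → 𝒜 w
    windowᴬ w p = patᴬ (interval 0 w p)

    L≤ : ∀ n → L ℕ.≤ n ℕ.+ L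
    L≤ n = ℕₚ.m≤n+m L n

    src-window : (σ : 𝒜 n) .(p : suc L ℕ.≤ n) .(q : L ℕ.≤ n) → src (windowᴬ (suc L) p σ) ≡ windowᴬ L q σ
    src-window σ p q = 𝒜-cong (window-window (underlying σ) p (ℕₚ.n≤1+n L) q)

    tgt-window : (σ : 𝒜 (suc n)) .(p : suc L ℕ.≤ suc n) .(q : L ℕ.≤ n) → tgt (windowᴬ (suc L) p σ) ≡
        windowᴬ L q (tail σ)
    tgt-window σ p q = 𝒜-cong (rest-window (underlying σ) p q)

    Trace : 𝒜 n → L ℕ.≤ n → Set
    Trace {n} σ p = Σ[ es ∈ List Edge ] Σ[ b ∈ Vertex ] (IsWalk G (windowᴬ L p σ) es b ×
      (∀ e → c-occ (underlying e) (underlying σ) ≡ count e es) × length es ℕ.+ L ≡ n)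

    -- Recursion on the tail: the initial window of length `suc L` is an edge from the initial
    -- `L`-window of `σ` to that of its tail. At `n = L` no edge is left.
    traceOf : ∀ n (σ : 𝒜 n) (p : L ℕ.≤ n) → Trace σ p
    traceOf n σ p = byCases n σ p (ℕₚ.m≤n⇒m<n∨m≡n p)
      where
      traceStep : ∀ {n} (σ : 𝒜 (suc n)) (q : L ℕ.≤ n) (p : L ℕ.≤ suc n) → Trace (tail σ) q → Trace σ p
      traceStep σ q p (es , b , walk , occ , size) = windowᴬ (suc L) (s≤s q) σ ∷ es , b
        , src-window σ (s≤s q) p ∷ subst (λ v → IsWalk G v es b) (sym (tgt-window σ (s≤s q) q)) walk
        , (λ e → trans (c-occ-step (underlying e) (underlying σ) (s≤s q))
            (trans (cong (δ e (windowᴬ (suc L) (s≤s q) σ) ℕ.+_) (occ e))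
              (sym (count-∷ e (windowᴬ (suc L) (s≤s q) σ) es))))
        , cong suc size
      traceBase : ∀ {n} (σ : 𝒜 n) (p : L ℕ.≤ n) → L ≡ n → Trace σ p
      traceBase σ p refl = [] , windowᴬ L p σ , [] , (λ e → c-occ-short (underlying e) (underlying σ)
          ℕₚ.≤-refl) , refl
      byCases : ∀ n (σ : 𝒜 n) (p : L ℕ.≤ n) → L ℕ.< n ⊎ L ≡ n → Trace σ p
      byCases n       σ p (inj₂ e)       = traceBase σ p e
      byCases (suc n) σ p (inj₁ (s≤s q)) = traceStep σ q p (byCases n (tail σ) q (ℕₚ.m≤n⇒m<n∨m≡n q))

    Lift : Vertex → List Edge → Set
    Lift a es = Σ[ σ ∈ 𝒜 (length es ℕ.+ L) ] (windowᴬ L (L≤ (length es)) σ ≡ a ×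
      (∀ e → c-occ (underlying e) (underlying σ) ≡ count e es))

    -- The avoider grows backwards from the last vertex of the walk. When `e` is reached, the
    -- initial window is already `tgt e`, so `extend` realises the head of `e` by some admissible
    -- value.
    liftOf : ∀ {a b es} → IsWalk G a es b → Lift a es
    liftOf {a} [] = a , 𝒜-cong (window-full (underlying a)) , λ e → c-occ-short (underlying e)
        (underlying a) ℕₚ.≤-refl
    liftOf {es = e ∷ es} (refl ∷ walk) = extendLift (liftOf walk)
      where
      p = L≤ (length es)
      extendLift : Lift (tgt e) es → Lift (src e) (e ∷ es)
      extendLift (σ , σ-begins , occ) = consᴬ x σ x≤
        , trans (sym (src-window (consᴬ x σ x≤) (s≤s p) (L≤ (suc (length es))))) (cong src window≡e)
        , λ e′ → trans (c-occ-step (underlying e′) (cons x (underlying σ)) (s≤s p))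
            (trans (cong₂ ℕ._+_ (cong (δ e′) window≡e)
                (trans (cong (c-occ (underlying e′)) (rest-cons x (underlying σ))) (occ e′)))
              (sym (count-∷ e′ e es)))
        where
        room : toℕ (head e) ℕ.≤ bound (window L p (underlying σ))
        room = subst (λ v → toℕ (head e) ℕ.≤ boundᴬ v) (sym σ-begins) (head≤bound e)
        extension = extend (underlying σ) p (head e) room
        x = proj₁ extension
        x≤ = proj₁ (proj₂ extension)
        window≡e : windowᴬ (suc L) (s≤s p) (consᴬ x σ x≤) ≡ e
        window≡e = 𝒜-cong (trans (proj₂ (proj₂ extension))
          (trans (cong (λ v → cons (head e) (underlying v)) σ-begins) (cons-rest (underlying e))))

    walk-++ : ∀ {a b c es es′} → IsWalk G a es b → IsWalk G b es′ c → IsWalk G a (es ++ es′) c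
    walk-++ []      q = q
    walk-++ (e ∷ p) q = e ∷ walk-++ p q

    -- Any vertex is reached backwards from b by prepending its entries one at a time.
    reach : ∀ w (p : w ℕ.≤ L) (τ : 𝒜 w) b → Σ[ a ∈ Vertex ] Σ[ es ∈ List Edge ] (IsWalk G a es b ×
        windowᴬ w p a ≡ τ)
    reach zero    p τ b = b , [] , [] , 𝒜-cong (order-ext _ (underlying τ) λ ())
    reach (suc w) p τ b =
      let a , es , walk , begins = reach w w≤L (tail τ) b
          y , y≤ , window≡ = extend (underlying a) w≤L (head τ)
            (subst (λ v → toℕ (head τ) ℕ.≤ boundᴬ v) (sym begins) (head≤bound τ))
          e = consᴬ y a y≤
      in src e , e ∷ es , refl ∷ subst (λ v → IsWalk G v es b) (sym (tail-consᴬ y a y≤)) walk ,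
         𝒜-cong (trans (window-window (underlying e) (ℕₚ.n≤1+n L) p (s≤s w≤L))
           (trans window≡ (trans (cong (λ v → cons (head τ) (underlying v)) begins)
               (cons-rest (underlying τ)))))
      where
      w≤L = ℕₚ.<⇒≤ p

    connect : ∀ a b → Σ[ es ∈ List Edge ] IsWalk G a es b
    connect a b = let a′ , es , walk , begins = reach L ℕₚ.≤-refl a b in
      es , subst (λ v → IsWalk G v es b) (trans (sym (𝒜-cong (window-full (underlying a′)))) begins)
          walk

    -- The edges cons₀ v form a spanning tree directed away from the identity.

    parent : Vertex → Vertex
    parent v = src (cons₀ v)

    ancestor : ℕ → Vertex → Vertex
    ancestor zero    v = v
    ancestor (suc j) v = ancestor j (parent v)

    ancestor-suc : ∀ j v → ancestor (suc j) v ≡ parent (ancestor j v)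
    ancestor-suc zero    v = refl
    ancestor-suc (suc j) v = ancestor-suc j (parent v)

    zeros : ∀ n → 𝒜 n
    zeros zero    = empty
    zeros (suc n) = cons₀ (zeros n)

    root : Vertex
    root = zeros L

    -- Each step towards the root prepends a least value and drops the last entry, so after `j`
    -- steps the first `j` entries are increasing; after `L` steps nothing of `v` is left.
    window-ancestor : ∀ j (p : j ℕ.≤ L) v → windowᴬ j p (ancestor j v) ≡ zeros j
    window-ancestor zero    p v = 𝒜-cong (order-ext _ (underlying empty) λ ())
    window-ancestor (suc j) p v = trans (cong (windowᴬ (suc j) p) (ancestor-suc j v)) (𝒜-cong
      (trans (window-window (cons Fin.zero (underlying u)) (ℕₚ.n≤1+n L) p (s≤s j≤L))
        (trans (window-cons-0 (underlying u) j≤L) (cong (cons Fin.zero ∘ underlying) (window-ancestor j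
            j≤L v)))))
      where
      j≤L = ℕₚ.<⇒≤ p
      u = ancestor j v

    ancestor-L : ∀ v → ancestor L v ≡ root
    ancestor-L v = trans (sym (𝒜-cong (window-full (underlying (ancestor L v))))) (window-ancestor L
        ℕₚ.≤-refl v)

    -- Every branch of depth `j` has length `j`: a vertex closer to the root has its path padded
    -- with the loop there. The equal lengths later make differences of closed walks sum to zero.
    branch : ℕ → Vertex → List Edge
    branch zero    v = []
    branch (suc j) v = branch j (parent v) ++ cons₀ v ∷ []

    branch-walk : ∀ j v → IsWalk G (ancestor j v) (branch j v) v
    branch-walk zero    v = []
    branch-walk (suc j) v = walk-++ (branch-walk j (parent v))
      (refl ∷ subst (λ u → IsWalk G u [] v) (sym (tail-consᴬ Fin.zero v z≤n)) [])

    length-branch : ∀ j v → length (branch j v) ≡ j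
    length-branch zero    v = refl
    length-branch (suc j) v = trans (Listₚ.length-++ (branch j (parent v)))
      (trans (cong (ℕ._+ 1) (length-branch j (parent v))) (ℕₚ.+-comm j 1))

    count-branch-suc : ∀ e j v → count e (branch (suc j) v) ≡ count e (branch j (parent v)) ℕ.+ δ e
        (cons₀ v)
    count-branch-suc e j v = trans (count-++ e (branch j (parent v)) (cons₀ v ∷ []))
      (cong (count e (branch j (parent v)) ℕ.+_) (trans (count-∷ e (cons₀ v) []) (ℕₚ.+-identityʳ _)))

    -- `branch` peels off the edge nearest to `v`; this peels off the farthest, which at `j = L` is
    -- the loop at the root.
    count-branch-top : ∀ e j v → count e (branch (suc j) v) ≡ δ e (cons₀ (ancestor j v)) ℕ.+ count e
        (branch j v)
    count-branch-top e zero    v = trans (count-branch-suc e 0 v) (sym (ℕₚ.+-identityʳ _))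
    count-branch-top e (suc j) v = begin
      count e (branch (suc (suc j)) v)                            ≡⟨ count-branch-suc e (suc j) v ⟩
      count e (branch (suc j) (parent v)) ℕ.+ δ e (cons₀ v)       ≡⟨ cong (ℕ._+ δ e (cons₀ v))
          (count-branch-top e j (parent v)) ⟩
      (top ℕ.+ count e (branch j (parent v))) ℕ.+ δ e (cons₀ v)   ≡⟨ ℕₚ.+-assoc top _ _ ⟩
      top ℕ.+ (count e (branch j (parent v)) ℕ.+ δ e (cons₀ v))   ≡⟨ cong (top ℕ.+_)
          (count-branch-suc e j v) ⟨
      top ℕ.+ count e (branch (suc j) v)                          ∎
      where
      open ≡-Reasoning
      top = δ e (cons₀ (ancestor (suc j) v))

open OverlapWalks

-- Feasible vectors and unit flows

module Limits (L : ℕ) where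

  open Overlap L
  open Multigraph G using (Vertex; Edge; src; tgt)

  P : (𝒮 (suc L) → ℝ) → Set
  P = FeasibleRegion (suc L) ⟦312⟧

  private
    Es = avoiders (suc L)

  freq≈ : ∀ (σ : Av⁺ ⟦312⟧) (π : 𝒮 (suc L)) k → c-occ π (underlying (element σ)) ≡ k →
          fromℚ (freq σ π) ≈ᴿ (1/_ (size σ) ⦃ Av⁺.nonEmpty σ ⦄) * # k
  freq≈ σ π k refl = /≈ (c-occ π (underlying (element σ))) (size σ) ⦃ Av⁺.nonEmpty σ ⦄

  -- Searching the complete list of avoiders decides avoidance, which by itself quantifies over all
  -- sets of positions.
  by-avoidance : (Q : 𝒮 (suc L) → Set) → (∀ (e : 𝒜 (suc L)) → Q (underlying e)) →
                 (∀ π → ¬ Avoids ⟦312⟧ π → Q π) → ∀ π → Q π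
  by-avoidance Q q ¬q π = decide (Any.any? (λ e → underlying e ≟ˢ π) Es)
    where
    decide : Dec (Any.Any (λ e → underlying e ≡ π) Es) → Q π
    decide (yes p) = subst Q (proj₂ (Any.satisfied p)) (q (proj₁ (Any.satisfied p)))
    decide (no ¬p) = ¬q π (λ a → ¬p (lose (avoiders-complete (suc L) (av π a)) refl))

  c-occ-nonAvoider : ∀ {n} (σ : 𝒜 n) (π : 𝒮 (suc L)) → ¬ Avoids ⟦312⟧ π → c-occ π (underlying σ) ≡ 0
  c-occ-nonAvoider {n} (av σ a) π ¬a = cong length (Listₚ.filter-none (occursAt? π σ) {xs = allFin n}
    (All.tabulate λ { {i} _ (p , refl) → ⊥-elim-irr (¬a (pat-avoids (interval (toℕ i) (suc L) p) σ a))
        }))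

  freq≈0 : ∀ (σ : Av⁺ ⟦312⟧) (π : 𝒮 (suc L)) → ¬ Avoids ⟦312⟧ π → fromℚ (freq σ π) ≈ᴿ # 0
  freq≈0 σ π ¬a = ≈-trans (freq≈ σ π 0 (c-occ-nonAvoider (element σ) π ¬a))
      (*-zeroʳ (1/_ (size σ) ⦃ Av⁺.nonEmpty σ ⦄))

  open Sampling G Es (avoiders-complete (suc L)) (avoiders-unique (suc L)) _≟ᴬ_ L using
      (Sample; sampled⇒flow; module Tours)

  sample : ∀ {v} → P v → ∀ ε → 0ℚ ℚ.< ε → Sample (v ∘ underlying) ε
  sample {v} (_ , σ , large , lim) ε ε>0 = record
    { edges = es ; isWalk = walk ; n = n ; n≢0 = Av⁺.nonEmpty (σ N) ; length≡ = size-es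
    ; 1/n≤ε = ≈-≤ (≈-sym (*-identityʳ (1/ n))) (proj₂ sm n (ℕₚ.≤-trans (ℕₚ.m≤n⊔m L (proj₁ sm))
        large-enough))
    ; above = λ e → ≤-≈ (from+ᴿ {v (underlying e)} {fromℚ (freq (σ N) (underlying e))}
        (proj₂ (close e))) (+-congʳ (ι ε) (frequency e))
    ; below = λ e → ≈-≤ (≈-sym (frequency e)) (from+ᴿ {fromℚ (freq (σ N) (underlying e))}
        {v (underlying e)} (proj₁ (close e))) }
    where
    sm = small 1 ε ε>0
    Close : Edge → ℕ → Set
    Close e m = fromℚ (freq (σ m) (underlying e)) ≤ᴿ v (underlying e) +ᴿ fromℚ ε ×
                v (underlying e) ≤ᴿ fromℚ (freq (σ m) (underlying e)) +ᴿ fromℚ ε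
    near : Eventually (λ m → ∀ {e} → e ∈ Es → Close e m)
    near = eventually-∈ Es {Close} (λ e → lim (underlying e) ε ε>0)
    -- Size at least `L` gives the permutation a trace; size beyond the threshold of `small` makes
    -- `1 / n` at most `ε`.
    big = large (L ℕ.⊔ proj₁ sm)
    N = proj₁ near ℕ.⊔ proj₁ big
    n = size (σ N)
    instance
      n≢0 : NonZero n
      n≢0 = Av⁺.nonEmpty (σ N)
    close : ∀ e → Close e N
    close e = proj₂ near {N} (ℕₚ.m≤m⊔n (proj₁ near) (proj₁ big)) {e} (avoiders-complete (suc L) e)
    large-enough : L ℕ.⊔ proj₁ sm ℕ.≤ n
    large-enough = proj₂ big (ℕₚ.m≤n⊔m (proj₁ near) (proj₁ big))
    tr = traceOf n (element (σ N)) (ℕₚ.≤-trans (ℕₚ.m≤m⊔n L (proj₁ sm)) large-enough)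
    es = proj₁ tr
    walk = proj₁ (proj₂ (proj₂ tr))
    size-es = proj₂ (proj₂ (proj₂ (proj₂ tr)))
    frequency : ∀ e → fromℚ (freq (σ N) (underlying e)) ≈ᴿ 1/ n * χ es e
    frequency e = freq≈ (σ N) (underlying e) (count e es) (proj₁ (proj₂ (proj₂ (proj₂ tr))) e)

  feasible⇒flow : ∀ v → P v → IsFlow (v ∘ underlying)
  feasible⇒flow v feasible@(bounds , _) = sampled⇒flow
    (λ e → ≈-≤ 0ᴿ≈ (proj₁ (bounds (underlying e)))) (sample {v} feasible)

  feasible⇒vanishes : ∀ v → P v → ∀ π → ¬ Avoids ⟦312⟧ π → v π ≈ᴿ 0ᴿ
  feasible⇒vanishes v (bounds , σ , _ , lim) π ¬a = ≤ᴿ-antisym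
    (≤-≈ (≤-from-ε λ ε ε>0 →
      let N , close = lim π ε ε>0
          h = proj₂ (close {N} ℕₚ.≤-refl)
      in ≤-≈ (from+ᴿ {v π} {fromℚ (freq (σ N) π)} h) (+-congʳ (ι ε) (freq≈0 (σ N) π ¬a))) 0ᴿ≈)
    (proj₁ (bounds π))

  flow⇒feasible : ∀ (v : 𝒮 (suc L) → ℝ) {f : Edge → ℝ} → IsFlow f → (∀ (e : Edge) → v (underlying e) ≈ᴿ
      f e) →
                  (∀ π → ¬ Avoids ⟦312⟧ π → v π ≈ᴿ 0ᴿ) → P v
  flow⇒feasible v {f} φ v≈f v≈0 = bounds , σ , large , converges
    where
    open Tours root connect
    C = proj₁ (approximate-flow φ)
    D = proj₁ (proj₂ (approximate-flow φ))
    walks = proj₂ (proj₂ (approximate-flow φ))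
    bounds : ∀ π → 0ᴿ ≤ᴿ v π × v π ≤ᴿ 1ᴿ
    bounds = by-avoidance (λ π → 0ᴿ ≤ᴿ v π × v π ≤ᴿ 1ᴿ)
      (λ e → ≈-≤ {0ᴿ} {# 0} (≈-sym 0ᴿ≈) (≤-≈ {# 0} {f e} (nonNeg φ e) (≈-sym (v≈f e))) , ≈-≤ (v≈f e)
          (≤-≈ (flow≤1 φ e) 1ᴿ≈))
      (λ π ¬a → ≈⇒≥ (v≈0 π ¬a) , ≈-≤ (v≈0 π ¬a) (≈-≤ (≈-sym 0ᴿ≈) (≤-≈ (#-mono-≤ {0} {1} z≤n) 1ᴿ≈)))
    es : ℕ → List Edge
    -- The walk for `N` only guarantees a size of at least `N - D`. Asking for `suc m + D` makes the
    -- size exceed `m`, hence nonzero and unbounded.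
    es m = proj₁ (walks (suc m ℕ.+ D))
    len : ℕ → ℕ
    len m = length (es m) ℕ.+ L
    m<len : ∀ m → m ℕ.< len m
    m<len m = ℕₚ.+-cancelʳ-≤ D (suc m) (len m) (proj₁ (proj₂ (proj₂ (walks (suc m ℕ.+ D)))))
    instance
      len≢0 : ∀ {m} → NonZero (len m)
      len≢0 {m} = ℕ.>-nonZero (ℕₚ.≤-<-trans z≤n (m<len m))
    lifts : ∀ m → Lift root (es m)
    lifts m = liftOf (proj₁ (proj₂ (walks (suc m ℕ.+ D))))
    σ : ℕ → Av⁺ ⟦312⟧
    σ m = record { size = len m ; nonEmpty = len≢0 {m} ; element = proj₁ (lifts m) }
    large : ∀ M → Eventually (λ m → M ℕ.≤ size (σ m))
    large M = M , λ {m} M≤m → ℕₚ.≤-trans M≤m (ℕₚ.<⇒≤ (m<len m))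
    frequency : ∀ m e → fromℚ (freq (σ m) (underlying e)) ≈ᴿ (1/_ (len m) ⦃ len≢0 {m} ⦄) * χ (es m) e
    frequency m e = freq≈ (σ m) (underlying e) (count e (es m)) (proj₂ (proj₂ (lifts m)) e)
    Close : ℚ → 𝒮 (suc L) → ℕ → Set
    Close ε π m = fromℚ (freq (σ m) π) ≤ᴿ v π +ᴿ fromℚ ε × v π ≤ᴿ fromℚ (freq (σ m) π) +ᴿ fromℚ ε
    converges : ∀ π → (λ m → fromℚ (freq (σ m) π)) ⟶ v π
    converges π ε ε>0 = by-avoidance (λ π → Eventually (Close ε π)) onAvoider offAvoider π
      where
      N = proj₁ (small C ε ε>0)
      below+ε : ∀ x → x ≤ᴿ x + ι ε
      below+ε x = ≈-≤ (≈-sym (+-identityʳ x)) (+-monoʳ-≤ x (ι-mono-≤ (ℚₚ.<⇒≤ ε>0)))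
      onAvoider : ∀ e → Eventually (Close ε (underlying e))
      onAvoider e = N , λ {m} N≤m →
        let q = fromℚ (freq (σ m) (underlying e))
            near = proj₂ (proj₂ (proj₂ (walks (suc m ℕ.+ D)))) (len m) ⦃ len≢0 {m} ⦄ refl e
            tiny = proj₂ (small C ε ε>0) (len m) ⦃ len≢0 {m} ⦄ (ℕₚ.≤-trans N≤m (ℕₚ.<⇒≤ (m<len m)))
        in to+ᴿ {q} {v (underlying e)} (≈-≤ (frequency m e) (≤ᴿ-trans (proj₁ near)
             (≤ᴿ-trans (+-monoʳ-≤ (f e) tiny) (+-monoˡ-≤ (ι ε) (≈⇒≥ (v≈f e))))))
         , to+ᴿ {v (underlying e)} {q} (≈-≤ (v≈f e) (≤ᴿ-trans (proj₂ near)
             (≤ᴿ-trans (+-monoʳ-≤ _ tiny) (+-monoˡ-≤ (ι ε) (≈⇒≥ (frequency m e))))))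
      offAvoider : ∀ π → ¬ Avoids ⟦312⟧ π → Eventually (Close ε π)
      offAvoider π ¬a = 0 , λ {m} _ → let q = fromℚ (freq (σ m) π) in
          to+ᴿ {q} {v π} (≈-≤ (≈-trans (≈-trans (freq≈0 (σ m) π ¬a) 0ᴿ≈) (≈-sym (v≈0 π ¬a)))
              (below+ε (v π)))
        , to+ᴿ {v π} {q} (≈-≤ (≈-trans (v≈0 π ¬a) (≈-sym (≈-trans (freq≈0 (σ m) π ¬a) 0ᴿ≈)))
            (below+ε q))

δ-sym : ∀ {A : Set} (_≟_ : DecidableEquality A) (x y : A) → Indicator.δ _≟_ x y ≡ Indicator.δ _≟_ y x
δ-sym _≟_ x y with x ≟ y
... | yes refl = sym (Indicator.δ-refl _≟_ x)
... | no x≢y   = sym (Indicator.δ-≢ _≟_ (x≢y ∘ sym))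

avoids-underlying : ∀ {n} (σ : 𝒜 n) {π} → underlying σ ≡ π → Avoids ⟦312⟧ π
avoids-underlying σ refl = no312⇒avoids (underlying σ) (no312 σ)

-- The polytope, its vertices and its dimension

module Theorem (L : ℕ) where

  open Overlap L
  open Multigraph G using (Vertex; Edge; src; tgt)
  open Limits L
  open Polytope G (avoiders (suc L)) (avoiders-complete (suc L)) (avoiders-unique (suc L)) (_≟ᴬ_)

  private
    Es = avoiders (suc L)

  -- The decision is an argument so that `ext-on` and `ext-off` can split on it.
  choose : (f : Edge → ℝ) (π : 𝒮 (suc L)) → Dec (Any (λ e → underlying e ≡ π) Es) → ℝ
  choose f π (yes p) = f (proj₁ (Any.satisfied p))
  choose f π (no _)  = # 0

  ext : (Edge → ℝ) → 𝒮 (suc L) → ℝ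
  ext f π = choose f π (Any.any? (λ e → underlying e ≟ˢ π) Es)

  ext-on : ∀ f e → ext f (underlying e) ≡ f e
  ext-on f e = go (Any.any? (λ e′ → underlying e′ ≟ˢ underlying e) Es)
    where
    go : ∀ d → choose f (underlying e) d ≡ f e
    go (yes p) = cong f (𝒜-cong (proj₂ (Any.satisfied p)))
    go (no ¬p) = contradiction (lose (avoiders-complete (suc L) e) refl) ¬p

  ext-off : ∀ f π → ¬ Avoids ⟦312⟧ π → ext f π ≡ # 0
  ext-off f π ¬a = go (Any.any? (λ e′ → underlying e′ ≟ˢ π) Es)
    where
    go : ∀ d → choose f π d ≡ # 0
    go (yes p) = ⊥-elim (¬a (avoids-underlying (proj₁ (Any.satisfied p)) (proj₂ (Any.satisfied p))))
    go (no _)  = refl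

  ext-feasible : ∀ {f} → IsFlow f → P (ext f)
  ext-feasible {f} φ = flow⇒feasible (ext f) φ (λ e → ≈-reflexive (ext-on f e))
    (λ π ¬a → ≈-trans (≈-reflexive (ext-off f π ¬a)) 0ᴿ≈)

  feasible⇔cyclePolytope : ∀ v → P v ⇔ (∃[ w ] (CyclePolytope G w × ExtensionByZero v w))
  feasible⇔cyclePolytope v = mk⇔ to from
    where
    to : P v → ∃[ w ] (CyclePolytope G w × ExtensionByZero v w)
    to p = (λ e → v (underlying e)) , flow⇒cyclePolytope (feasible⇒flow v p) , (λ e → ≈-refl) ,
        feasible⇒vanishes v p
    from : ∃[ w ] (CyclePolytope G w × ExtensionByZero v w) → P v
    from (w , c , on , off) = flow⇒feasible v (cyclePolytope⇒flow c) on off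

  -- Vertices

  -- One argument serves both points of the mixture, with `t` and `1 - t` exchanged.
  simple⇒vertex : ∀ v → ∃[ C ] (IsSimple G C × ExtensionByZero v (cycleVector G C)) → IsVertex P v
  simple⇒vertex v (C , s , on , off) = flow⇒feasible v (cycleVector-isFlow C) on off , extreme
    where
    extreme : ∀ u w t → P u → P w → 0ᴿ <ᴿ t → t <ᴿ 1ᴿ → v ≋ (t · u ⊕ (1ᴿ -ᴿ t) · w) → u ≋ v × w ≋ v
    extreme u w t Pu Pw 0<t t<1 mix =
        by-avoidance (λ π → u π ≈ᴿ v π)
          (λ e → ≈-trans (cycle-extreme (C , s) (feasible⇒flow u Pu) (feasible⇒flow w Pw) 0<t′
              (<⇒≤ᴿ 0<1-t) mix₁ e) (≈-sym (on e)))
          (λ π ¬a → ≈-trans (feasible⇒vanishes u Pu π ¬a) (≈-sym (off π ¬a)))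
      , by-avoidance (λ π → w π ≈ᴿ v π)
          (λ e → ≈-trans (cycle-extreme (C , s) (feasible⇒flow w Pw) (feasible⇒flow u Pu) 0<1-t
              (<⇒≤ᴿ 0<t′) mix₂ e) (≈-sym (on e)))
          (λ π ¬a → ≈-trans (feasible⇒vanishes w Pw π ¬a) (≈-sym (off π ¬a)))
      where
      0<t′ : # 0 <ᴿ t
      0<t′ = ≤-<-transᴿ (≈⇒≤ 0ᴿ≈) 0<t
      0<1-t : # 0 <ᴿ # 1 - t
      0<1-t = <⇒0<-ᴿ (<-≤-transᴿ t<1 (≈⇒≥ 1ᴿ≈))
      mix₁ : ∀ e → cycleVector G C e ≈ᴿ t * u (underlying e) + (# 1 - t) * w (underlying e)
      mix₁ e = ≈-trans (≈-sym (on e)) (≈-trans (mix (underlying e)) (mixture t u w (underlying e)))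
      mix₂ : ∀ e → cycleVector G C e ≈ᴿ (# 1 - t) * w (underlying e) + t * u (underlying e)
      mix₂ e = ≈-trans (mix₁ e) (+-comm (t * u (underlying e)) _)

  -- `split` writes `v` as a proper mixture with some simple cycle, and extremality forces `v` to be
  -- that cycle.
  vertex⇒simple : ∀ v → IsVertex P v → ∃[ C ] (IsSimple G C × ExtensionByZero v (cycleVector G C))
  vertex⇒simple v (Pv , extreme) = fromSplit (split φ)
    where
    φ = feasible⇒flow v Pv
    fromSplit : Σ[ C ∈ SimpleCycle ] Σ[ t ∈ ℝ ] Σ[ r ∈ (Edge → ℝ) ]
      (IsFlow r × # 0 <ᴿ t × t <ᴿ # 1 × (∀ e → v (underlying e) ≈ᴿ t * cycleVector G (proj₁ C) e +
          (# 1 - t) * r e)) →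
      ∃[ C ] (IsSimple G C × ExtensionByZero v (cycleVector G C))
    fromSplit ((C , s) , t , r , ψ , 0<t , t<1 , mix) = C , s ,
      (λ e → ≈-trans (≈-sym (u≋v (underlying e))) (≈-reflexive (ext-on cyc e))) , feasible⇒vanishes v Pv
      where
      cyc = cycleVector G C
      mixed : v ≋ (t · ext cyc ⊕ (1ᴿ -ᴿ t) · ext r)
      mixed = by-avoidance (λ π → v π ≈ᴿ (t · ext cyc ⊕ (1ᴿ -ᴿ t) · ext r) π)
        (λ e → ≈-trans (mix e) (≈-trans
          (+-cong (*-congˡ t (≈-reflexive (sym (ext-on cyc e)))) (*-congˡ (# 1 - t)
              (≈-reflexive (sym (ext-on r e)))))
          (≈-sym (mixture t (ext cyc) (ext r) (underlying e)))))
        (λ π ¬a → ≈-trans (≈-trans (feasible⇒vanishes v Pv π ¬a) (≈-sym 0ᴿ≈))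
            (≈-sym (≈-trans (mixture t (ext cyc) (ext r) π)
          (≈-trans (+-cong (*-congˡ t (≈-reflexive (ext-off cyc π ¬a))) (*-congˡ (# 1 - t)
              (≈-reflexive (ext-off r π ¬a))))
            (solve 1 (λ t → t :* con 0ℚ :+ (con 1ℚ :- t) :* con 0ℚ := con 0ℚ) ≈-refl t)))))
      u≋v : ext cyc ≋ v
      u≋v = proj₁ (extreme (ext cyc) (ext r) t (ext-feasible (cycleVector-isFlow C)) (ext-feasible ψ)
        (≤-<-transᴿ (≈⇒≥ 0ᴿ≈) 0<t) (<-≤-transᴿ t<1 (≈⇒≤ 1ᴿ≈)) mixed)

  -- Dimension

  module _ (e₁ : Edge) (es₁ : List Edge) (e₂ : Edge) (es₂ : List Edge) (u : Vertex)
           (walk₁ : IsWalk G u (e₁ ∷ es₁) u) (walk₂ : IsWalk G u (e₂ ∷ es₂) u)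
           (lengths : length es₁ ≡ length es₂) where
    private
      C₁ C₂ : Cycle G
      C₁ = record { edges = e₁ ∷ es₁ ; closed = u , walk₁ }
      C₂ = record { edges = e₂ ∷ es₂ ; closed = u , walk₂ }
      ω = weightOf C₁
      ℓ = # length (edgesOf C₁)
      p₁ p₂ : 𝒮 (suc L) → ℝ
      p₁ = ext (λ e → weightOf C₁ * χ (e₁ ∷ es₁) e)
      p₂ = ext (λ e → weightOf C₂ * χ (e₂ ∷ es₂) e)
      Pp₁ : P p₁
      Pp₁ = ext-feasible (weightedCycle-isFlow C₁)
      Pp₂ : P p₂
      Pp₂ = ext-feasible (weightedCycle-isFlow C₂)
      weights : weightOf C₂ ≡ ω
      weights = cong (λ n → 1/ (suc n)) (sym lengths)
      c : Fin 2 → ℝ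
      c fzero    = ℓ
      c (fsuc _) = # 1 - ℓ
      p : Fin 2 → 𝒮 (suc L) → ℝ
      p fzero    = p₁
      p (fsuc _) = p₂
      Pp : ∀ i → P (p i)
      Pp fzero    = Pp₁
      Pp (fsuc _) = Pp₂
      mixed≈ : ∀ π → linComb c p π ≈ᴿ ℓ * p₁ π + ((# 1 - ℓ) * p₂ π + # 0)
      mixed≈ = linComb≈ c p
      c-total : ∑ c ≈ᴿ 1ᴿ
      c-total = ≈-trans (∑-allFin c) (≈-trans (solve 1 (λ l → l :+ ((con 1ℚ :- l) :+ con 0ℚ) := con 1ℚ)
          ≈-refl ℓ) 1ᴿ≈)
      one : Fin 1 → ℝ
      one _ = # 1
      one-total : ∑ one ≈ᴿ 1ᴿ
      one-total = ≈-trans (∑-allFin one) (≈-trans (+-identityʳ (# 1)) 1ᴿ≈)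
      single≈ : ∀ π → p₂ π ≈ᴿ linComb one (λ _ → p₂) π
      single≈ π = ≈-sym (≈-trans (linComb≈ one (λ _ → p₂) π) (solve 1 (λ x → con 1ℚ :* x :+ con 0ℚ :=
          x) ≈-refl (p₂ π)))

    affine₁ : Aff P (linComb c p)
    affine₁ = 2 , c , p , Pp , c-total , λ π → ≈-refl

    affine₂ : Aff P p₂
    affine₂ = 1 , one , (λ _ → p₂) , (λ _ → Pp₂) , one-total , single≈

    -- For closed walks of common length `ℓ`, the affine point `ℓ p₁ + (1 - ℓ) p₂` minus `p₂` is
    -- `ℓ (p₁ - p₂)`. The factor undoes the normalisation and leaves the difference of
    -- multiplicities.
    difference-direction : ∀ {w : 𝒮 (suc L) → ℝ} →
      (∀ e → w (underlying e) ≈ᴿ χ (e₁ ∷ es₁) e - χ (e₂ ∷ es₂) e) → (∀ π → ¬ Avoids ⟦312⟧ π → w π ≈ᴿ #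
          0) →
      Direction (Aff P) w
    difference-direction {w} on off = linComb c p , p₂ , affine₁ , affine₂ ,
      by-avoidance (λ π → w π ≈ᴿ (linComb c p ⊖ p₂) π)
        (λ e → ≈-trans (≈-trans (on e) (≈-sym (scaled e))) (≈-sym (expand (underlying e))))
        (λ π ¬a → ≈-trans (off π ¬a) (≈-sym (≈-trans (expand π) (≈-trans
          (-‿cong (+-cong (*-congˡ ℓ (≈-reflexive (ext-off _ π ¬a)))
              (+-congʳ (# 0) (*-congˡ (# 1 - ℓ) (≈-reflexive (ext-off _ π ¬a)))))
                  (≈-reflexive (ext-off _ π ¬a)))
          (solve 1 (λ l → (l :* con 0ℚ :+ ((con 1ℚ :- l) :* con 0ℚ :+ con 0ℚ)) :- con 0ℚ := con 0ℚ)
              ≈-refl ℓ)))))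
      where
      expand : ∀ π → (linComb c p ⊖ p₂) π ≈ᴿ (ℓ * p₁ π + ((# 1 - ℓ) * p₂ π + # 0)) - p₂ π
      expand π = ≈-trans (⊖≈- (linComb c p) p₂ π) (-‿cong (mixed≈ π) ≈-refl)
      algebra : ∀ l w x y → w * l ≈ᴿ # 1 → (l * (w * x) + ((# 1 - l) * (w * y) + # 0)) - w * y ≈ᴿ x - y
      algebra l w x y e = ≈-trans
        (solve 4 (λ l w x y → (l :* (w :* x) :+ ((con 1ℚ :- l) :* (w :* y) :+ con 0ℚ)) :- w :* y :=
            (w :* l) :* (x :- y)) ≈-refl l w x y)
        (≈-trans (*-congʳ (x - y) e) (*-identityˡ (x - y)))
      scaled : ∀ e → (ℓ * p₁ (underlying e) + ((# 1 - ℓ) * p₂ (underlying e) + # 0)) - p₂ (underlying e)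
                     ≈ᴿ χ (e₁ ∷ es₁) e - χ (e₂ ∷ es₂) e
      scaled e = ≈-trans
        (-‿cong (+-cong (*-congˡ ℓ p₁≈) (+-congʳ (# 0) (*-congˡ (# 1 - ℓ) p₂≈))) p₂≈)
        (algebra ℓ ω (χ (e₁ ∷ es₁) e) (χ (e₂ ∷ es₂) e) (weight*length C₁))
        where
        p₁≈ : p₁ (underlying e) ≈ᴿ ω * χ (e₁ ∷ es₁) e
        p₁≈ = ≈-reflexive (ext-on _ e)
        p₂≈ : p₂ (underlying e) ≈ᴿ ω * χ (e₂ ∷ es₂) e
        p₂≈ = ≈-reflexive (trans (ext-on _ e) (cong (_* χ (e₂ ∷ es₂) e) weights))

  -- The linear equations of a flow without the inequalities: `s` is 1 on the affine hull and 0 on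
  -- its directions.
  Flat : ℝ → (𝒮 (suc L) → ℝ) → Set
  Flat s v = Conserved (v ∘ underlying) × Sum Es (v ∘ underlying) ≈ᴿ s × (∀ π → ¬ Avoids ⟦312⟧ π → v π
      ≈ᴿ # 0)

  affine⇒flat : ∀ {v} → Aff P v → Flat (# 1) v
  affine⇒flat {v} (n , c , p , Pp , ∑c , v≋) =
      conserved-cong (λ e → ≈-sym (v≈ (underlying e))) (conserved-combination (allFin n) c
          (λ i e → p i (underlying e)) (λ i → conserved (feasible⇒flow (p i) (Pp i))))
    , ≈-trans (Sum-cong Es (λ e → v≈ (underlying e))) (total-combination (allFin n) c
        (λ i e → p i (underlying e))
        (λ i → total (feasible⇒flow (p i) (Pp i))) (≈-trans (≈-sym (∑-allFin c))
            (≈-trans ∑c (≈-sym 1ᴿ≈))))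
    , λ π ¬a → ≈-trans (v≈ π) (≈-trans (Sum-cong (allFin n) (λ i → ≈-trans
        (*-congˡ (c i) (≈-trans (feasible⇒vanishes (p i) (Pp i) π ¬a) (≈-sym 0ᴿ≈))) (*-zeroʳ (c i))))
            (Sum-0 (allFin n)))
    where
    v≈ : ∀ π → v π ≈ᴿ Sum (allFin n) (λ i → c i * p i π)
    v≈ π = ≈-trans (v≋ π) (linComb≈ c p π)

  direction⇒flat : ∀ {w} → Direction (Aff P) w → Flat (# 0) w
  direction⇒flat {w} (u , v , Au , Av , w≋) =
    let cu , tu , ou = affine⇒flat Au
        cv , tv , ov = affine⇒flat Av
    in conserved-cong (λ e → ≈-sym (w≈ (underlying e))) (conserved-‿- cu cv)
     , ≈-trans (Sum-cong Es (λ e → w≈ (underlying e))) (≈-trans (Sum-‿- Es (u ∘ underlying)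
         (v ∘ underlying))
         (≈-trans (-‿cong tu tv) (+-inverseʳ (# 1))))
     , λ π ¬a → ≈-trans (w≈ π) (≈-trans (-‿cong (ou π ¬a) (ov π ¬a)) (+-inverseʳ (# 0)))
    where
    w≈ : ∀ π → w π ≈ᴿ u π - v π
    w≈ π = ≈-trans (w≋ π) (⊖≈- u v π)

  -- The fundamental cycle of e with respect to the spanning tree, balanced by
  -- the loop at the root so that its entries sum to zero.
  β : Edge → Edge → ℝ
  β e e′ = (# δ e e′ + χ (branch L (src e)) e′) - χ (branch (suc L) (tgt e)) e′

  -- Close both tree paths by the same way back from `tgt e` to the root, the path to `src e` after
  -- adding `e`. The two closed walks have equal length, and the way back cancels in their
  -- difference.
  β-direction : ∀ e → Direction (Aff P) (ext (β e))
  β-direction e = finish long₁ long₂ walk₁ walk₂ length₁ length₂ on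
    where
    back = proj₁ (connect (tgt e) root)
    walk-back : IsWalk G (tgt e) back root
    walk-back = proj₂ (connect (tgt e) root)
    long₁ = branch L (src e) ++ e ∷ back
    long₂ = branch (suc L) (tgt e) ++ back
    walk₁ : IsWalk G root long₁ root
    walk₁ = subst (λ v → IsWalk G v long₁ root) (ancestor-L (src e))
      (walk-++ (branch-walk L (src e)) (refl ∷ walk-back))
    walk₂ : IsWalk G root long₂ root
    walk₂ = subst (λ v → IsWalk G v long₂ root) (ancestor-L (parent (tgt e)))
      (walk-++ (branch-walk (suc L) (tgt e)) walk-back)
    length₁ : length long₁ ≡ suc (L ℕ.+ length back)
    length₁ = trans (Listₚ.length-++ (branch L (src e))) (trans (cong (ℕ._+ suc (length back))
        (length-branch L (src e))) (ℕₚ.+-suc L (length back)))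
    length₂ : length long₂ ≡ suc (L ℕ.+ length back)
    length₂ = trans (Listₚ.length-++ (branch (suc L) (tgt e))) (cong (ℕ._+ length back)
        (length-branch (suc L) (tgt e)))
    χ₁ : ∀ e′ → χ long₁ e′ ≈ᴿ χ (branch L (src e)) e′ + (# δ e e′ + χ back e′)
    χ₁ e′ = ≈-trans (≈-reflexive (cong #_ (count-++ e′ (branch L (src e)) (e ∷ back))))
      (≈-trans (#-+ (count e′ (branch L (src e))) (count e′ (e ∷ back)))
          (+-congˡ (χ (branch L (src e)) e′)
        (≈-trans (≈-reflexive (cong #_ (trans (count-∷ e′ e back) (cong (ℕ._+ count e′ back)
            (δ-sym _≟ᴬ_ e′ e)))))
          (#-+ (δ e e′) (count e′ back)))))
    χ₂ : ∀ e′ → χ long₂ e′ ≈ᴿ χ (branch (suc L) (tgt e)) e′ + χ back e′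
    χ₂ e′ = ≈-trans (≈-reflexive (cong #_ (count-++ e′ (branch (suc L) (tgt e)) back)))
      (#-+ (count e′ (branch (suc L) (tgt e))) (count e′ back))
    on : ∀ e′ → ext (β e) (underlying e′) ≈ᴿ χ long₁ e′ - χ long₂ e′
    on e′ = ≈-trans (≈-reflexive (ext-on (β e) e′)) (≈-sym (≈-trans (-‿cong (χ₁ e′) (χ₂ e′))
      (solve 4 (λ b d k c → (b :+ (d :+ k)) :- (c :+ k) := (d :+ b) :- c) ≈-refl
        (χ (branch L (src e)) e′) (# δ e e′) (χ back e′) (χ (branch (suc L) (tgt e)) e′))))
    off : ∀ π → ¬ Avoids ⟦312⟧ π → ext (β e) π ≈ᴿ # 0
    off π ¬a = ≈-reflexive (ext-off (β e) π ¬a)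
    -- The walks are generalised together with their lengths, so that matching can expose a first
    -- edge in each.
    finish : ∀ l₁ l₂ → IsWalk G root l₁ root → IsWalk G root l₂ root →
      length l₁ ≡ suc (L ℕ.+ length back) → length l₂ ≡ suc (L ℕ.+ length back) →
      (∀ e′ → ext (β e) (underlying e′) ≈ᴿ χ l₁ e′ - χ l₂ e′) → Direction (Aff P) (ext (β e))
    finish (a ∷ as) (b ∷ bs) w₁ w₂ n₁ n₂ on = difference-direction a as b bs root w₁ w₂
      (ℕₚ.suc-injective (trans n₁ (sym n₂))) on off

  -- The path to `v` is by construction the path to its parent followed by `cons₀ v`, so the
  -- fundamental cycle degenerates.
  β-tree : ∀ v e′ → β (cons₀ v) e′ ≈ᴿ # 0
  β-tree v e′ = ≈-trans (-‿cong (≈-refl {# δ (cons₀ v) e′ + χ (branch L (parent v)) e′})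
      (≈-reflexive (cong (λ u → χ (branch (suc L) u) e′) (tail-consᴬ fzero v z≤n))))
    (≈-trans (-‿cong (≈-refl {# δ (cons₀ v) e′ + χ (branch L (parent v)) e′})
        (≈-trans (≈-reflexive (cong #_ (count-branch-suc e′ L v)))
            (≈-trans (#-+ (count e′ (branch L (parent v))) (δ e′ (cons₀ v)))
          (+-congˡ (χ (branch L (parent v)) e′) (≈-reflexive (cong #_ (δ-sym _≟ᴬ_ e′ (cons₀ v))))))))
      (solve 2 (λ d b → (d :+ b) :- (b :+ d) := con 0ℚ) ≈-refl (# δ (cons₀ v) e′)
          (χ (branch L (parent v)) e′)))

  ∈-branch : ∀ j v {e} → e ∈ branch j v → toℕ (head e) ≡ 0
  ∈-branch (suc j) v {e} i = byCases (∈ₚ.∈-++⁻ (branch j (parent v)) i)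
    where
    byCases : e ∈ branch j (parent v) ⊎ e ∈ cons₀ v ∷ [] → toℕ (head e) ≡ 0
    byCases (inj₁ k)           = ∈-branch j (parent v) k
    byCases (inj₂ (here e≡)) = cong (toℕ ∘ head) e≡

  headed-∉-branch : ∀ j v {e} → e ∈ headed L → χ (branch j v) e ≈ᴿ # 0
  headed-∉-branch j v i = χ-∉ (branch j v) (λ k → ℕₚ.<⇒≢ (∈-headed⁻ i) (sym (∈-branch j v k)))

  -- Branches consist of edges with head 0. On the remaining edges the vectors `β e` therefore
  -- restrict to the identity matrix, which gives independence.
  β-headed : ∀ e {e′} → e′ ∈ headed L → β e e′ ≈ᴿ # δ e e′
  β-headed e {e′} i = ≈-trans (-‿cong (+-congˡ (# δ e e′) (headed-∉-branch L (src e) i))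
      (headed-∉-branch (suc L) (tgt e) i))
    (solve 1 (λ d → (d :+ con 0ℚ) :- con 0ℚ := d) ≈-refl (# δ e e′))

  -- Tree edges contribute nothing, and the telescoping of branches is
  -- conservation of f with the potential counting e′ on them.
  β-expansion : ∀ {f} → Conserved f → Sum Es f ≈ᴿ # 0 → ∀ e′ → Sum (headed L) (λ e → f e * β e e′) ≈ᴿ f
      e′
  β-expansion {f} c t e′ = begin
    Sum (headed L) (λ e → f e * β e e′)
      -- The sum is padded with the vanishing tree terms so that it runs over all edges, where
      -- conservation applies.
      ≈⟨ ≈-trans (≈-sym (+-identityˡ _)) (+-congʳ _ (≈-sym tree)) ⟩
    Sum (map cons₀ (avoiders L)) (λ e → f e * β e e′) + Sum (headed L) (λ e → f e * β e e′)
      ≈⟨ Sum-++ (map cons₀ (avoiders L)) (headed L) (λ e → f e * β e e′) ⟨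
    Sum Es (λ e → f e * β e e′)
      ≈⟨ Sum-cong Es split-β ⟩
    Sum Es (λ e → (# δ e e′ * f e + # A (src e) * f e) - (# A (tgt e) * f e + # top * f e))
      ≈⟨ Sum-‿- Es (λ e → # δ e e′ * f e + # A (src e) * f e) (λ e → # A (tgt e) * f e + # top * f e) ⟩
    Sum Es (λ e → # δ e e′ * f e + # A (src e) * f e) - Sum Es (λ e → # A (tgt e) * f e + # top * f e)
      ≈⟨ -‿cong (Sum-+ Es (λ e → # δ e e′ * f e) (λ e → # A (src e) * f e))
          (Sum-+ Es (λ e → # A (tgt e) * f e) (λ e → # top * f e)) ⟩
    (Sum Es (λ e → # δ e e′ * f e) + Sum Es (λ e → # A (src e) * f e)) -
        (Sum Es (λ e → # A (tgt e) * f e) + Sum Es (λ e → # top * f e))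
      ≈⟨ -‿cong (+-cong (Sum-δ _≟ᴬ_ id f (subst Unique (sym (Listₚ.map-id Es))
          (avoiders-unique (suc L))) (avoiders-complete (suc L) e′))
                        (c A L A≤L))
                -- The loop at the root enters every term alike, hence multiplied by the total of
                -- `f`, which is 0.
                (+-congˡ S (≈-trans (Sum-*ˡ Es (# top) f) (≈-trans (*-congˡ (# top) t)
                    (*-zeroʳ (# top))))) ⟩
    (f e′ + S) - (S + # 0)
      ≈⟨ solve 2 (λ f t → (f :+ t) :- (t :+ con 0ℚ) := f) ≈-refl (f e′) S ⟩
    f e′ ∎
    where
    open ≈-Reasoning
    A : Vertex → ℕ
    A v = count e′ (branch L v)
    A≤L : ∀ v → A v ℕ.≤ L
    A≤L v = ℕₚ.≤-trans (count≤length e′ (branch L v)) (ℕₚ.≤-reflexive (length-branch L v))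
    S = Sum Es (λ e → # A (tgt e) * f e)
    top = δ e′ (cons₀ root)
    count-suc : ∀ v → χ (branch (suc L) v) e′ ≈ᴿ # top + # A v
    count-suc v = ≈-trans (≈-reflexive (cong #_ (trans (count-branch-top e′ L v)
        (cong (λ u → δ e′ (cons₀ u) ℕ.+ A v) (ancestor-L v)))))
      (#-+ top (A v))
    split-β : ∀ e → f e * β e e′ ≈ᴿ (# δ e e′ * f e + # A (src e) * f e) - (# A (tgt e) * f e + # top *
        f e)
    split-β e = ≈-trans (*-congˡ (f e) (-‿cong (≈-refl {# δ e e′ + # A (src e)}) (count-suc (tgt e))))
      (solve 5 (λ f d a b t → f :* ((d :+ a) :- (t :+ b)) := (d :* f :+ a :* f) :- (b :* f :+ t :* f))
          ≈-refl
        (f e) (# δ e e′) (# A (src e)) (# A (tgt e)) (# top))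
    tree : Sum (map cons₀ (avoiders L)) (λ e → f e * β e e′) ≈ᴿ # 0
    tree = ≈-trans (≈-reflexive (Sum-map cons₀ (avoiders L) (λ e → f e * β e e′)))
      (≈-trans (Sum-cong (avoiders L) (λ v → ≈-trans (*-congˡ (f (cons₀ v)) (β-tree v e′))
          (*-zeroʳ (f (cons₀ v))))) (Sum-0 (avoiders L)))

  basis : Fin (length (headed L)) → 𝒮 (suc L) → ℝ
  basis i = ext (β (lookup (headed L) i))

  basis-independent : LinearlyIndependent basis
  basis-independent c zero-comb i = ≈-trans (≈-sym (Sum-δ _≟ᴬ_ (lookup (headed L)) c unique′
      (∈ₚ.∈-allFin i)))
      (≈-trans (Sum-cong (allFin d) (λ j → ≈-trans (*-comm (# δ (lookup (headed L) j) e′) (c j))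
          (*-congˡ (c j) (≈-sym (coordinate j)))))
        (≈-trans (≈-sym (linComb≈ c basis (underlying e′))) (zero-comb (underlying e′))))
    where
    d = length (headed L)
    e′ = lookup (headed L) i
    coordinate : ∀ j → basis j (underlying e′) ≈ᴿ # δ (lookup (headed L) j) e′
    coordinate j = ≈-trans (≈-reflexive (ext-on (β (lookup (headed L) j)) e′))
        (β-headed (lookup (headed L) j) (∈ₚ.∈-lookup i))
    unique′ : Unique (map (lookup (headed L)) (allFin d))
    unique′ = subst Unique (sym (trans (Listₚ.map-tabulate id (lookup (headed L)))
        (Listₚ.tabulate-lookup (headed L))))
      (headed-unique L (avoiders-unique L))

  basis-spans : ∀ w → Direction (Aff P) w → ∃[ c ] (w ≋ linComb c basis)
  basis-spans w dir = (λ i → w (underlying (lookup (headed L) i))) ,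
    λ π → ≈-trans (expansion π) (≈-sym (linComb-lookup (headed L) (λ e → w (underlying e))
        (λ e → ext (β e)) π))
    where
    flat = direction⇒flat dir
    expansion : ∀ π → w π ≈ᴿ Sum (headed L) (λ e → w (underlying e) * ext (β e) π)
    expansion = by-avoidance (λ π → w π ≈ᴿ Sum (headed L) (λ e → w (underlying e) * ext (β e) π))
      (λ e′ → ≈-sym (≈-trans (Sum-cong (headed L) (λ e → *-congˡ (w (underlying e))
          (≈-reflexive (ext-on (β e) e′))))
        (β-expansion (proj₁ flat) (proj₁ (proj₂ flat)) e′)))
      (λ π ¬a → ≈-trans (proj₂ (proj₂ flat) π ¬a) (≈-sym (≈-trans
        (Sum-cong (headed L) (λ e → ≈-trans (*-congˡ (w (underlying e))
            (≈-reflexive (ext-off (β e) π ¬a))) (*-zeroʳ (w (underlying e)))))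
        (Sum-0 (headed L)))))

  loop : IsWalk G root (cons₀ root ∷ []) root
  loop = trans (cong parent (sym (ancestor-L root))) (trans (sym (ancestor-suc L root))
      (ancestor-L (parent root)))
    ∷ subst (λ u → IsWalk G u [] root) (sym (tail-consᴬ fzero root z≤n)) []

  dimension : HasDimension P (Catalan (suc L) ∸ Catalan L)
  dimension = subst (HasDimension P) (length-headed L)
    -- The loop at the root supplies a point of the affine hull.
    ((_ , affine₂ (cons₀ root) [] (cons₀ root) [] root loop loop refl) ,
     basis , (λ i → β-direction (lookup (headed L) i)) , basis-independent , basis-spans)

mainTheorem3 :
  (k : ℕ) .⦃ _ : NonZero k ⦄ →
  let P = FeasibleRegion k ⟦312⟧
      G = OverlapGraph k ⟦312⟧ in
  (∀ v → P v ⇔ (∃[ w ] (CyclePolytope G w × ExtensionByZero v w)))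
  × HasDimension P (Catalan k ∸ Catalan (k ∸ 1))
  × (∀ v → IsVertex P v ⇔ (∃[ C ] (IsSimple G C × ExtensionByZero v (cycleVector G C))))
mainTheorem3 (suc L) = feasible⇔cyclePolytope , dimension , λ v → mk⇔ (vertex⇒simple v)
    (simple⇒vertex v)
  where open Theorem L
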